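{- Fix a constant dimension $d\ge 1$. For a finite nonempty set $P\subset\mathbb{R}^d$ let $\overline{\mathcal{G}}_P(x)=\frac{1}{|P|}\sum_{p\in P}e^{ -\|x-p\|^2}$ for $x\in\mathbb{R}^d$. There is a constant $c_d$ depending only on $d$ and an efficient (randomized, polynomial-time) algorithm which, given a finite $P\subset\mathbb{R}^d$ and $\varepsilon\in(0,1)$, constructs a subset $Q\subseteq P$ with $|Q|\le c_d/\varepsilon$ such that \[\sup_{x\in\mathbb{R}^d}\left|\overline{\mathcal{G}}_P(x)-\overline{\mathcal{G}}_Q(x)\right|<\varepsilon.\]
   Context: $\|\cdot\|$ denotes the Euclidean norm. The dimension $d$ is regarded as a constant, so constants may depend on $d$. -}

module Defs where

open import Algebra.Structures using (IsCommutativeRing)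
open import Data.Bool using (Bool; true; false; if_then_else_)
open import Data.Empty using (⊥-elim)
open import Data.Fin using (toℕ)
open import Data.Fin.Subset using (Subset; ∣_∣; Nonempty)
open import Data.List using (List; []; _∷_; _++_; length; map; foldr; filter; concatMap)
open import Data.Maybe using (Maybe; just; nothing; fromMaybe)
open import Data.Nat as ℕ using (ℕ; zero; suc; _≡ᵇ_; _<ᵇ_)
open import Data.Product using (∃; ∃-syntax; _×_; _,_)
open import Data.Sum using (_⊎_; inj₁; inj₂)
open import Data.Vec using (Vec; []; _∷_; toList; tabulate; zipWith)
open import Data.Vec.Relation.Unary.Unique.Propositional using (Unique)
open import Relation.Binary.Definitions using (tri<; tri≈; tri>)
open import Relation.Binary.PropositionalEquality using (_≡_; _≢_; refl; subst)
open import Relation.Binary.Structures using (IsStrictTotalOrder)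
open import Relation.Nullary using (¬_; Dec; yes; no; does)

-- The sublist of v at the positions in S.
select : ∀ {A : Set} {n} → Subset n → Vec A n → List A
select []          []       = []
select (true  ∷ S) (x ∷ xs) = x ∷ select S xs
select (false ∷ S) (x ∷ xs) = select S xs

-- The real numbers, characterised axiomatically as a Dedekind-complete ordered
-- field.  `complete` quantifies over arbitrary predicates and IsSup asks for
-- approximating elements, so excluded middle (for Set) follows from the axioms:
-- see `em` below.
record RealNumbers : Set₁ where
  infixl 6 _+_ _-_
  infixl 7 _*_
  infix  8 -_
  infix  9 _⁻¹
  infix  4 _<_ _≤_
  field
    ℝ                  : Set
    _+_ _*_            : ℝ → ℝ → ℝ
    -_                 : ℝ → ℝ
    0# 1#              : ℝ
    isCommutativeRing  : IsCommutativeRing _≡_ _+_ _*_ -_ 0# 1#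
    _⁻¹                : ℝ → ℝ
    *-inverse          : ∀ x → x ≢ 0# → x * x ⁻¹ ≡ 1#
    0⁻¹≡0              : 0# ⁻¹ ≡ 0#
    _<_                : ℝ → ℝ → Set
    isStrictTotalOrder : IsStrictTotalOrder _≡_ _<_
    0<1                : 0# < 1#
    +-monoˡ-<          : ∀ z {x y} → x < y → x + z < y + z
    *-pos              : ∀ {x y} → 0# < x → 0# < y → 0# < x * y

  _≤_ : ℝ → ℝ → Set
  x ≤ y = x < y ⊎ x ≡ y

  IsUpperBound : (ℝ → Set) → ℝ → Set
  IsUpperBound S u = ∀ y → S y → y ≤ u

  IsSup : (ℝ → Set) → ℝ → Set
  IsSup S s = IsUpperBound S s × (∀ b → b < s → ∃[ y ] S y × b < y)

  field
    complete : (S : ℝ → Set) → ∃ S → ∃ (IsUpperBound S) → ∃ (IsSup S)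

  open IsStrictTotalOrder isStrictTotalOrder public
    using (compare; _<?_; irrefl; asym) renaming (trans to <-trans)

  _-_ : ℝ → ℝ → ℝ
  x - y = x + (- y)

  abs : ℝ → ℝ
  abs x = if does (x <? 0#) then - x else x

  fromℕ : ℕ → ℝ
  fromℕ zero    = 0#
  fromℕ (suc n) = 1# + fromℕ n

  _^_ : ℝ → ℕ → ℝ
  x ^ zero  = 1#
  x ^ suc n = x * x ^ n

  sumℝ : List ℝ → ℝ
  sumℝ = foldr _+_ 0#

  em : (A : Set) → Dec A
  em A with complete S (0# , inj₁ refl) (1# , bounded)
    where
    S : ℝ → Set
    S x = x ≡ 0# ⊎ (x ≡ 1# × A)
    bounded : IsUpperBound S 1#
    bounded _ (inj₁ refl)       = inj₁ 0<1
    bounded _ (inj₂ (refl , _)) = inj₂ refl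
  ... | s , ub , approx with compare 0# s
  ... | tri< 0<s _ _ = yes (extract (approx 0# 0<s))
    where
    extract : ∃[ y ] (y ≡ 0# ⊎ (y ≡ 1# × A)) × 0# < y → A
    extract (_ , inj₁ refl , 0<0)    = ⊥-elim (irrefl refl 0<0)
    extract (_ , inj₂ (_ , a) , _) = a
  ... | tri≈ _ refl _ = no λ a → case-≤ (ub 1# (inj₂ (refl , a)))
    where
    case-≤ : ¬ (1# ≤ 0#)
    case-≤ (inj₁ 1<0) = asym 1<0 0<1
    case-≤ (inj₂ 1≡0) = irrefl refl (subst (0# <_) 1≡0 0<1)
  ... | tri> _ _ s<0 = no λ _ → case-≤ (ub 0# (inj₁ refl))
    where
    case-≤ : ¬ (0# ≤ s)
    case-≤ (inj₁ 0<s)  = asym s<0 0<s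
    case-≤ (inj₂ refl) = irrefl refl s<0

  -- Some real satisfying S, or 0 if there is none.
  the : (ℝ → Set) → ℝ
  the S with em (∃ S)
  ... | yes (x , _) = x
  ... | no _        = 0#

  ConvergesTo : (ℕ → ℝ) → ℝ → Set
  ConvergesTo a l = ∀ δ → 0# < δ → ∃[ N ] (∀ n → N ℕ.≤ n → abs (a n - l) < δ)

  lim : (ℕ → ℝ) → ℝ
  lim a = the (ConvergesTo a)

  sqrt : ℝ → ℝ
  sqrt a = the (λ y → 0# ≤ y × y * y ≡ a)

  -- Σ_{k<n} x^k / k!
  expSum : ℝ → ℕ → ℝ
  expSum x zero    = 0#
  expSum x (suc n) = expSum x n + x ^ n * (fromℕ (n ℕ.!)) ⁻¹

  exp : ℝ → ℝ
  exp x = lim (expSum x)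

  Point : ℕ → Set
  Point d = Vec ℝ d

  norm : ∀ {d} → Point d → ℝ
  norm v = sqrt (sumℝ (map (_^ 2) (toList v)))

  -- Meaningful for nonempty lists of distinct points only.
  Ḡ : ∀ {d} → List (Point d) → Point d → ℝ
  Ḡ P x = fromℕ (length P) ⁻¹ * sumℝ (map (λ p → exp (- (norm (zipWith _-_ x p) ^ 2))) P)

  -- s = sup_x |Ḡ_P(x) − Ḡ_Q(x)|
  IsSupDistance : ∀ {d} → List (Point d) → List (Point d) → ℝ → Set
  IsSupDistance P Q = IsSup (λ y → ∃[ x ] y ≡ abs (Ḡ P x - Ḡ Q x))

  IsCoreset : ∀ {d n} → ℝ → ℝ → Vec (Point d) n → Subset n → Set
  IsCoreset c ε P Q =
    Nonempty Q
    × fromℕ ∣ Q ∣ ≤ c * ε ⁻¹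
    × ∃[ s ] (IsSupDistance (toList P) (select Q P) s × s < ε)

  bitStrings : (T : ℕ) → List (Vec Bool T)
  bitStrings zero    = [] ∷ []
  bitStrings (suc T) = map (true ∷_) (bitStrings T) ++ map (false ∷_) (bitStrings T)

  -- Probability of E under the uniform distribution on T independent fair bits.
  Pr : (T : ℕ) → (Vec Bool T → Set) → ℝ
  Pr T E = fromℕ (length (filter (λ ω → em (E ω)) (bitStrings T))) * (fromℕ (2 ℕ.^ T)) ⁻¹

-- Randomised real RAM.  The store consists of an index memory I[0], I[1], …
-- of naturals and a real memory R[0], R[1], … of exact reals; real memory is
-- always addressed indirectly, through index memory.  Every instruction costs
-- one step.  There is no index multiplication and no rounding from reals to
-- indices, which would make the unit-cost measure unrealistic.
data Instr : Set where
  iconst  : (a k : ℕ) → Instr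
  iadd    : (a b c : ℕ) → Instr
  isub    : (a b c : ℕ) → Instr
  iload   : (a b : ℕ) → Instr
  istore  : (a b : ℕ) → Instr
  flip    : (a : ℕ) → Instr
  rone    : (a : ℕ) → Instr
  rcopy   : (a b : ℕ) → Instr
  radd    : (a b c : ℕ) → Instr
  rsub    : (a b c : ℕ) → Instr
  rmul    : (a b c : ℕ) → Instr
  rdiv    : (a b c : ℕ) → Instr
  rexp    : (a b : ℕ) → Instr
  jump    : (l : ℕ) → Instr
  ijumplt : (a b l : ℕ) → Instr
  rjumplt : (a b l : ℕ) → Instr

Program : Set
Program = List Instr

nth : ∀ {A : Set} → List A → ℕ → Maybe A
nth []       _       = nothing
nth (x ∷ _)  zero    = just x
nth (_ ∷ xs) (suc i) = nth xs i

_[_≔_] : ∀ {A : Set} → (ℕ → A) → ℕ → A → (ℕ → A)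
(f [ a ≔ v ]) b = if b ≡ᵇ a then v else f b

module RealRAM (𝓡 : RealNumbers) where
  open RealNumbers 𝓡

  record State : Set where
    constructor ⟨_,_,_⟩
    field
      pc : ℕ
      I  : ℕ → ℕ
      R  : ℕ → ℝ
  open State public

  -- The bit is the one delivered if the instruction is a `flip`.
  exec : Instr → Bool → State → State
  exec (iconst a k)    _   ⟨ p , I , R ⟩ = ⟨ suc p , I [ a ≔ k ] , R ⟩
  exec (iadd a b c)    _   ⟨ p , I , R ⟩ = ⟨ suc p , I [ a ≔ I b ℕ.+ I c ] , R ⟩
  exec (isub a b c)    _   ⟨ p , I , R ⟩ = ⟨ suc p , I [ a ≔ I b ℕ.∸ I c ] , R ⟩
  exec (iload a b)     _   ⟨ p , I , R ⟩ = ⟨ suc p , I [ a ≔ I (I b) ] , R ⟩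
  exec (istore a b)    _   ⟨ p , I , R ⟩ = ⟨ suc p , I [ I a ≔ I b ] , R ⟩
  exec (flip a)        bit ⟨ p , I , R ⟩ = ⟨ suc p , I [ a ≔ (if bit then 1 else 0) ] , R ⟩
  exec (rone a)        _   ⟨ p , I , R ⟩ = ⟨ suc p , I , R [ I a ≔ 1# ] ⟩
  exec (rcopy a b)     _   ⟨ p , I , R ⟩ = ⟨ suc p , I , R [ I a ≔ R (I b) ] ⟩
  exec (radd a b c)    _   ⟨ p , I , R ⟩ = ⟨ suc p , I , R [ I a ≔ R (I b) + R (I c) ] ⟩
  exec (rsub a b c)    _   ⟨ p , I , R ⟩ = ⟨ suc p , I , R [ I a ≔ R (I b) - R (I c) ] ⟩
  exec (rmul a b c)    _   ⟨ p , I , R ⟩ = ⟨ suc p , I , R [ I a ≔ R (I b) * R (I c) ] ⟩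
  exec (rdiv a b c)    _   ⟨ p , I , R ⟩ = ⟨ suc p , I , R [ I a ≔ R (I b) * R (I c) ⁻¹ ] ⟩
  exec (rexp a b)      _   ⟨ p , I , R ⟩ = ⟨ suc p , I , R [ I a ≔ exp (R (I b)) ] ⟩
  exec (jump l)        _   ⟨ p , I , R ⟩ = ⟨ l , I , R ⟩
  exec (ijumplt a b l) _   ⟨ p , I , R ⟩ = ⟨ (if I a <ᵇ I b then l else suc p) , I , R ⟩
  exec (rjumplt a b l) _   ⟨ p , I , R ⟩ = ⟨ (if does (R (I a) <? R (I b)) then l else suc p) , I , R ⟩

  step : Program → Bool → State → State
  step prog bit s with nth prog (pc s)
  ... | just i  = exec i bit s
  ... | nothing = s

  -- T steps; a fresh bit is drawn at every step, used or not.
  run : ∀ {T} → Program → Vec Bool T → State → State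
  run prog []        s = s
  run prog (bit ∷ ω) s = run prog ω (step prog bit s)

  Halted : Program → State → Set
  Halted prog s = nth prog (pc s) ≡ nothing

  -- I[0] = n, R[0] = ε, followed in real memory by the coordinates of the
  -- points one point after the other; everything else is 0.
  input : ∀ {d n} → Vec (Point d) n → ℝ → State
  input {n = n} P ε =
    ⟨ 0 , (λ _ → 0) [ 0 ≔ n ] , (λ a → fromMaybe 0# (nth (ε ∷ concatMap toList (toList P)) a)) ⟩

  -- Point number i is selected iff R[i] > 0 in the final state.
  output : ∀ n → State → Subset n
  output n s = tabulate (λ i → does (0# <? R s (toℕ i)))

  HaltsWithin : ℕ → Program → State → Set
  HaltsWithin T prog s = (ω : Vec Bool T) → Halted prog (run prog ω s)

  SuccessProbability : ℕ → Program → State → ∀ {n} → (Subset n → Set) → ℝ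
  SuccessProbability T prog s {n} Good = Pr T (λ ω → Good (output n (run prog ω s)))

  ⅔ : ℝ
  ⅔ = fromℕ 2 * fromℕ 3 ⁻¹

  -- Unique P: the finite set P is listed without repetition, so |P| = n and
  -- subsets of P are subsets of positions.  As d is a constant, polynomial time
  -- in the number n·d + 1 of input reals means polynomial in n.
  ConstructsCoresets : (d : ℕ) → ℝ → Program → (C k : ℕ) → Set
  ConstructsCoresets d c prog C k =
    (n : ℕ) → 1 ℕ.≤ n → (P : Vec (Point d) n) → Unique P →
    (ε : ℝ) → 0# < ε → ε < 1# →
      HaltsWithin (C ℕ.* n ℕ.^ k) prog (input P ε)
      × ⅔ ≤ SuccessProbability (C ℕ.* n ℕ.^ k) prog (input P ε) (IsCoreset c ε P)

{-# OPTIONS --safe #-}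
-- Give every point p the weight m/n, where m is about K/ε, and round the
-- weights to 0 and 1 without changing their sum m.  The points of weight 1 form
-- Q, and Ḡ_Q − Ḡ_P is 1/m times the sum of (final − initial weight) · kernel,
-- so it suffices to keep that sum bounded by a constant K depending on d only.
--
-- Split the points greedily into clusters of sup-norm radius 1 with centres at
-- distance more than 1.  Around a centre c the kernel e^{−|x−p|²} equals
-- e^{−|x−c|²} Σ_α (2(x−c))^α/α! · e^{−|p−c|²} (p−c)^α, so only the moments with
-- weights e^{−|p−c|²} (p−c)^α of each cluster matter, and those of high degree
-- matter very little.  As in the Beck–Fiala theorem, each round moves the
-- fractional weights along a direction that preserves the total and every
-- moment α of a cluster with more than (α_k+1)^d + 1 fractional weights for
-- all k, until one more weight becomes 0 or 1.  The preserved moments are fewer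
-- than the fractional weights, so such a direction exists; and once the moment α
-- is dropped, it changes by at most the number of fractional weights left,
-- which is at most 2 Π_k 2^{d α_k}.  Summing over α leaves 2 e^{−|z|²} e^{O(|z|)}
-- with z = x − c per cluster, and summing over the separated centres a constant.
--
-- The direction is a row of the orthogonal projection onto the space of
-- admissible directions; its trace counts the degrees of freedom.  The procedure
-- is deterministic, with a bounded nesting of loops of length n, so its running
-- time on the machine is polynomial.
module Submission where

open import Defs
open import Data.Bool using (Bool; true; false; if_then_else_)
open import Data.Empty using (⊥-elim)
open import Data.Fin using (Fin; zero; suc; toℕ)
open import Data.Nat as ℕ using (ℕ; zero; suc)
import Data.Nat.Properties as ℕP
open import Data.Product using (∃; ∃-syntax; _×_; _,_; proj₁; proj₂)
open import Data.Sum using (_⊎_; inj₁; inj₂)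
open import Data.Vec using (Vec; []; _∷_; lookup)
open import Relation.Binary.Definitions using (tri<; tri≈; tri>)
open import Relation.Binary.PropositionalEquality using (_≡_; _≢_; refl; sym; trans; cong; cong₂; subst; subst₂; module ≡-Reasoning)
open import Relation.Nullary using (¬_; Dec; yes; no; does)

-- Two estimates must fit together. Let a cluster have f fractional weights, and let s be the number
-- of degrees a with (a+1)^d + 1 < f. It enforces s^d moments, and s^d + 1 < f unless s = 0; so the
-- enforced moments fit into the degrees of freedom, and the spare 1 of a single cluster pays for
-- the total. A dropped moment, on the other hand, has an exponent a with f ≤ (a+1)^d + 1 ≤ 2
-- (2^d)^a. This growth is harmless since it only rescales the argument of the exponential series.
-- The weights sum to an integer m, so at the end a single weight cannot be fractional. The number m
-- is the least integer with m ε above a natural number C > K, or n if that is smaller; in the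
-- latter case all weights are 1 from the start. The machine has no index multiplication and no
-- rounding of reals, so the procedure is written in a language of n by n arrays whose loops all
-- have length n: its time can be read off the syntax. Case distinctions are arithmetic with the
-- values 0 and 1, and m is counted up as a real. The convention that the inverse of 0 is 0 lets a
-- dropped moment enter as the zero vector, which leaves the projection alone.

module Development (𝓡 : RealNumbers) where

  -- Ordered field arithmetic, with a ring solver over integer coefficients.

  module Reals where

    open import Algebra.Bundles using (CommutativeRing)
    open import Algebra.Structures using (IsCommutativeRing)
    import Algebra.Solver.Ring
    open import Algebra.Solver.Ring.AlmostCommutativeRing using (AlmostCommutativeRing; fromCommutativeRing; _-Raw-AlmostCommutative⟶_)
    open import Data.Integer as ℤ using (ℤ; -[1+_]; +[1+_]) renaming (+_ to posℤ)
    import Data.Integer.Properties as ℤP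
    open import Data.Maybe using (just; nothing)

    open RealNumbers 𝓡 public
    open IsCommutativeRing isCommutativeRing public
      using (+-assoc; +-comm; +-identityˡ; +-identityʳ; -‿inverseʳ; *-assoc; *-comm; *-identityˡ; *-identityʳ; distribˡ; distribʳ; zeroˡ; zeroʳ)

    commutativeRing : CommutativeRing _ _
    commutativeRing = record { isCommutativeRing = isCommutativeRing }

    private
      ring : AlmostCommutativeRing _ _
      ring = fromCommutativeRing commutativeRing

      open import Algebra.Properties.Ring (CommutativeRing.ring commutativeRing)
        using (-‿distribˡ-*; -‿distribʳ-*; -0#≈0#; -‿involutive; -‿+-comm)

      -- `fromℕ 1` is `1# + 0#`; here 1 goes to `1#` itself, so that the constant `:1` of the solver
      -- denotes exactly the `1#` that occurs in goals.
      nat : ℕ → ℝ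
      nat zero          = 0#
      nat (suc zero)    = 1#
      nat (suc (suc n)) = 1# + nat (suc n)

      nat-suc : ∀ n → nat (suc n) ≡ 1# + nat n
      nat-suc zero    = sym (+-identityʳ 1#)
      nat-suc (suc n) = refl

      nat-+ : ∀ m n → nat (m ℕ.+ n) ≡ nat m + nat n
      nat-+ zero n = sym (+-identityˡ _)
      nat-+ (suc m) n = trans (nat-suc (m ℕ.+ n)) (trans (cong (_+_ 1#) (nat-+ m n))
        (trans (sym (+-assoc _ _ _)) (cong (_+ nat n) (sym (nat-suc m)))))

      nat-* : ∀ m n → nat (m ℕ.* n) ≡ nat m * nat n
      nat-* zero n = sym (zeroˡ _)
      nat-* (suc m) n = trans (nat-+ n (m ℕ.* n)) (trans (cong₂ _+_ (sym (*-identityˡ _)) (nat-* m n))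
        (trans (sym (distribʳ _ _ _)) (cong (_* nat n) (sym (nat-suc m)))))

      int : ℤ → ℝ
      int (posℤ n)    = nat n
      int -[1+ n ] = - nat (suc n)

      int-⊖ : ∀ m n → int (m ℤ.⊖ n) ≡ nat m - nat n
      int-⊖ zero zero = sym (-‿inverseʳ 0#)
      int-⊖ zero (suc n) = sym (+-identityˡ _)
      int-⊖ (suc m) zero = sym (trans (cong (_+_ (nat (suc m))) -0#≈0#) (+-identityʳ _))
      int-⊖ (suc m) (suc n) = trans (cong int (ℤP.[1+m]⊖[1+n]≡m⊖n m n)) (trans (int-⊖ m n) (sym (trans (cong₂ _-_ (nat-suc m) (nat-suc n)) cancel)))
        where
        open ≡-Reasoning
        cancel : (1# + nat m) - (1# + nat n) ≡ nat m - nat n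
        cancel = begin
          (1# + nat m) - (1# + nat n)         ≡⟨ cong₂ _+_ (+-comm _ _) (sym (-‿+-comm _ _)) ⟩
          (nat m + 1#) + (- 1# + - nat n)     ≡⟨ +-assoc _ _ _ ⟩
          nat m + (1# + (- 1# + - nat n))     ≡⟨ cong (nat m +_) (sym (+-assoc _ _ _)) ⟩
          nat m + ((1# + - 1#) + - nat n)     ≡⟨ cong (λ z → nat m + (z + - nat n)) (-‿inverseʳ 1#) ⟩
          nat m + (0# + - nat n)              ≡⟨ cong (nat m +_) (+-identityˡ _) ⟩
          nat m - nat n ∎

      int-neg : ∀ i → int (ℤ.- i) ≡ - int i
      int-neg (posℤ zero) = sym -0#≈0#
      int-neg +[1+ n ] = refl
      int-neg -[1+ n ] = sym (-‿involutive _)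

      int-+ : ∀ i j → int (i ℤ.+ j) ≡ int i + int j
      int-+ (posℤ m) (posℤ n) = nat-+ m n
      int-+ (posℤ m) -[1+ n ] = int-⊖ m (suc n)
      int-+ -[1+ m ] (posℤ n) = trans (int-⊖ n (suc m)) (+-comm _ _)
      int-+ -[1+ m ] -[1+ n ] = trans (cong -_ (trans (cong nat (cong suc (sym (ℕP.+-suc m n)))) (nat-+ (suc m) (suc n)))) (sym (-‿+-comm _ _))

      int-* : ∀ i j → int (i ℤ.* j) ≡ int i * int j
      int-* (posℤ m) (posℤ n) = trans (cong int (sym (ℤP.pos-* m n))) (nat-* m n)
      int-* (posℤ m) -[1+ n ] = trans (cong int (trans (cong (posℤ m ℤ.*_) refl) (sym (ℤP.neg-distribʳ-* (posℤ m) (posℤ (suc n))))))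
        (trans (int-neg (posℤ m ℤ.* posℤ (suc n))) (trans (cong -_ (int-* (posℤ m) (posℤ (suc n)))) (-‿distribʳ-* _ _)))
      int-* -[1+ m ] (posℤ n) = trans (cong int (sym (ℤP.neg-distribˡ-* (posℤ (suc m)) (posℤ n))))
        (trans (int-neg (posℤ (suc m) ℤ.* posℤ n)) (trans (cong -_ (int-* (posℤ (suc m)) (posℤ n))) (-‿distribˡ-* _ _)))
      int-* -[1+ m ] -[1+ n ] = trans (nat-* (suc m) (suc n))
        (trans (sym (-‿involutive _)) (trans (cong -_ (-‿distribʳ-* _ _)) (-‿distribˡ-* _ _)))

      morphism : ℤ.+-*-rawRing -Raw-AlmostCommutative⟶ ring
      morphism = record { ⟦_⟧ = int ; +-homo = int-+ ; *-homo = int-* ; -‿homo = int-neg ; 0-homo = refl ; 1-homo = refl }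

      coeff≟ : ∀ i j → _
      coeff≟ i j with i ℤ.≟ j
      ... | yes i≡j = just (cong int i≡j)
      ... | no _    = nothing

    module Solver = Algebra.Solver.Ring ℤ.+-*-rawRing ring morphism coeff≟
    open Solver public using (solve; _:=_; _:+_; _:*_; _:-_; :-_; con; Polynomial)

    :0 :1 :2 : ∀ {m} → Polynomial m
    :0 = con (posℤ 0)
    :1 = con (posℤ 1)
    :2 = con (posℤ 2)

    0≢1 : 0# ≢ 1#
    0≢1 e = irrefl e 0<1

    ≤-refl : ∀ {x} → x ≤ x
    ≤-refl = inj₂ refl

    ≡⇒≤ : ∀ {x y} → x ≡ y → x ≤ y
    ≡⇒≤ = inj₂

    ≤-respˡ : ∀ {x y z} → x ≡ y → x ≤ z → y ≤ z
    ≤-respˡ refl p = p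

    ≤-respʳ : ∀ {x y z} → y ≡ z → x ≤ y → x ≤ z
    ≤-respʳ refl p = p

    <-respˡ : ∀ {x y z} → x ≡ y → x < z → y < z
    <-respˡ refl p = p

    <-respʳ : ∀ {x y z} → y ≡ z → x < y → x < z
    <-respʳ refl p = p

    <⇒≤ : ∀ {x y} → x < y → x ≤ y
    <⇒≤ = inj₁

    <-≤-trans : ∀ {x y z} → x < y → y ≤ z → x < z
    <-≤-trans p (inj₁ q)    = <-trans p q
    <-≤-trans p (inj₂ refl) = p

    ≤-<-trans : ∀ {x y z} → x ≤ y → y < z → x < z
    ≤-<-trans (inj₁ p)    q = <-trans p q
    ≤-<-trans (inj₂ refl) q = q

    ≤-trans : ∀ {x y z} → x ≤ y → y ≤ z → x ≤ z
    ≤-trans (inj₁ p)    q = inj₁ (<-≤-trans p q)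
    ≤-trans (inj₂ refl) q = q

    <⇒≱ : ∀ {x y} → x < y → ¬ (y ≤ x)
    <⇒≱ p q = irrefl refl (<-≤-trans p q)

    ≤-antisym : ∀ {x y} → x ≤ y → y ≤ x → x ≡ y
    ≤-antisym (inj₂ e) _ = e
    ≤-antisym (inj₁ p) q = ⊥-elim (<⇒≱ p q)

    ≮⇒≥ : ∀ {x y} → ¬ (x < y) → y ≤ x
    ≮⇒≥ {x} {y} x≮y with compare x y
    ... | tri< p _ _ = ⊥-elim (x≮y p)
    ... | tri≈ _ e _ = inj₂ (sym e)
    ... | tri> _ _ p = inj₁ p

    <-or-≥ : ∀ x y → x < y ⊎ y ≤ x
    <-or-≥ x y with x <? y
    ... | yes p = inj₁ p
    ... | no ¬p = inj₂ (≮⇒≥ ¬p)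

    data Sign (x : ℝ) : Set where
      is- : x < 0# → x ≢ 0# → Sign x
      is0 : x ≡ 0# → Sign x
      is+ : 0# < x → x ≢ 0# → Sign x

    sign : ∀ x → Sign x
    sign x with compare x 0#
    ... | tri< p q _ = is- p q
    ... | tri≈ _ e _ = is0 e
    ... | tri> _ q p = is+ p q

    ≤-total : ∀ x y → x ≤ y ⊎ y ≤ x
    ≤-total x y with <-or-≥ x y
    ... | inj₁ p = inj₁ (inj₁ p)
    ... | inj₂ q = inj₂ q

    infixr 2 _≤⟨_⟩_ _≡⟨_⟩≤_
    infix 3 _□
    _≤⟨_⟩_ : ∀ x {y z} → x ≤ y → y ≤ z → x ≤ z
    x ≤⟨ p ⟩ q = ≤-trans p q
    _≡⟨_⟩≤_ : ∀ x {y z} → x ≡ y → y ≤ z → x ≤ z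
    x ≡⟨ refl ⟩≤ q = q
    _□ : ∀ x → x ≤ x
    x □ = ≤-refl

    0<⇒< : ∀ {x y} → 0# < y - x → x < y
    0<⇒< {x} {y} p = subst₂ _<_ (+-identityˡ x) (solve 2 (λ x y → (y :- x) :+ x := y) refl x y) (+-monoˡ-< x p)

    <⇒0< : ∀ {x y} → x < y → 0# < y - x
    <⇒0< {x} {y} p = subst₂ _<_ (-‿inverseʳ x) refl (+-monoˡ-< (- x) p)

    0≤⇒≤ : ∀ {x y} → 0# ≤ y - x → x ≤ y
    0≤⇒≤ (inj₁ p) = inj₁ (0<⇒< p)
    0≤⇒≤ {x} {y} (inj₂ e) = inj₂ (trans (sym (+-identityˡ x)) (trans (cong (_+ x) e) (solve 2 (λ x y → (y :- x) :+ x := y) refl x y)))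

    ≤⇒0≤ : ∀ {x y} → x ≤ y → 0# ≤ y - x
    ≤⇒0≤ (inj₁ p) = inj₁ (<⇒0< p)
    ≤⇒0≤ (inj₂ refl) = inj₂ (sym (-‿inverseʳ _))

    -- Inequalities are proved by certificates: y - x is a visibly nonnegative expression.
    ≤-by : ∀ {x y z} → 0# ≤ z → y - x ≡ z → x ≤ y
    ≤-by p e = 0≤⇒≤ (subst (0# ≤_) (sym e) p)

    <-by : ∀ {x y z} → 0# < z → y - x ≡ z → x < y
    <-by p e = 0<⇒< (subst (0# <_) (sym e) p)

    +-mono-<-≤ : ∀ {a b c d} → a < b → c ≤ d → a + c < b + d
    +-mono-<-≤ {a} {b} {c} {d} p (inj₂ refl) = +-monoˡ-< c p
    +-mono-<-≤ {a} {b} {c} {d} p (inj₁ q) = <-trans (+-monoˡ-< c p) (subst₂ _<_ (+-comm c b) (+-comm d b) (+-monoˡ-< b q))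

    +-mono-≤ : ∀ {a b c d} → a ≤ b → c ≤ d → a + c ≤ b + d
    +-mono-≤ (inj₁ p) q = inj₁ (+-mono-<-≤ p q)
    +-mono-≤ {a} (inj₂ refl) (inj₂ refl) = ≤-refl
    +-mono-≤ {a} {b} {c} {d} (inj₂ refl) (inj₁ q) = inj₁ (subst₂ _<_ (+-comm c a) (+-comm d a) (+-monoˡ-< a q))

    +-mono-≤-< : ∀ {a b c d} → a ≤ b → c < d → a + c < b + d
    +-mono-≤-< {a} {b} {c} {d} p q = subst₂ _<_ (+-comm c a) (+-comm d b) (+-mono-<-≤ q p)

    +-nonneg : ∀ {x y} → 0# ≤ x → 0# ≤ y → 0# ≤ x + y
    +-nonneg p q = subst (_≤ _) (+-identityˡ 0#) (+-mono-≤ p q)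

    +-pos-nonneg : ∀ {x y} → 0# < x → 0# ≤ y → 0# < x + y
    +-pos-nonneg p q = subst (_< _) (+-identityˡ 0#) (+-mono-<-≤ p q)

    *-nonneg : ∀ {x y} → 0# ≤ x → 0# ≤ y → 0# ≤ x * y
    *-nonneg (inj₁ p) (inj₁ q) = inj₁ (*-pos p q)
    *-nonneg {x} {y} (inj₂ refl) _ = inj₂ (sym (zeroˡ y))
    *-nonneg {x} (inj₁ _) (inj₂ refl) = inj₂ (sym (zeroʳ x))

    *-monoˡ-≤ : ∀ {z x y} → 0# ≤ z → x ≤ y → z * x ≤ z * y
    *-monoˡ-≤ {z} {x} {y} 0≤z p = ≤-by (*-nonneg 0≤z (≤⇒0≤ p)) (solve 3 (λ x y z → z :* y :- z :* x := z :* (y :- x)) refl x y z)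

    *-monoʳ-≤ : ∀ {z x y} → 0# ≤ z → x ≤ y → x * z ≤ y * z
    *-monoʳ-≤ {z} {x} {y} 0≤z p = subst₂ _≤_ (*-comm z x) (*-comm z y) (*-monoˡ-≤ 0≤z p)

    *-mono-≤ : ∀ {a b c d} → 0# ≤ a → 0# ≤ c → a ≤ b → c ≤ d → a * c ≤ b * d
    *-mono-≤ 0≤a 0≤c p q = ≤-trans (*-monoʳ-≤ 0≤c p) (*-monoˡ-≤ (≤-trans 0≤a p) q)

    *-monoˡ-< : ∀ {z x y} → 0# < z → x < y → z * x < z * y
    *-monoˡ-< {z} {x} {y} 0<z p = <-by (*-pos 0<z (<⇒0< p)) (solve 3 (λ x y z → z :* y :- z :* x := z :* (y :- x)) refl x y z)

    neg-mono-≤ : ∀ {x y} → x ≤ y → - y ≤ - x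
    neg-mono-≤ {x} {y} p = ≤-by (≤⇒0≤ p) (solve 2 (λ x y → (:- x) :- (:- y) := y :- x) refl x y)

    neg-pos : ∀ {x} → x < 0# → 0# < - x
    neg-pos {x} p = subst (0# <_) (+-identityˡ _) (<⇒0< p)

    neg-nonneg : ∀ {x} → x ≤ 0# → 0# ≤ - x
    neg-nonneg {x} p = subst (0# ≤_) (+-identityˡ _) (≤⇒0≤ p)

    neg-nonpos : ∀ {x} → 0# ≤ x → - x ≤ 0#
    neg-nonpos {x} p = ≤-by p (solve 1 (λ x → :0 :- (:- x) := x) refl x)

    sq-nonneg : ∀ x → 0# ≤ x * x
    sq-nonneg x with ≤-total 0# x
    ... | inj₁ p = *-nonneg p p
    ... | inj₂ p = subst (0# ≤_) (solve 1 (λ x → (:- x) :* (:- x) := x :* x) refl x) (*-nonneg (neg-nonneg p) (neg-nonneg p))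

    sq-pos : ∀ x → x ≢ 0# → 0# < x * x
    sq-pos x x≢0 with compare x 0#
    ... | tri< p _ _ = subst (0# <_) (solve 1 (λ x → (:- x) :* (:- x) := x :* x) refl x) (*-pos (neg-pos p) (neg-pos p))
    ... | tri≈ _ e _ = ⊥-elim (x≢0 e)
    ... | tri> _ _ p = *-pos p p

    0≤1 : 0# ≤ 1#
    0≤1 = inj₁ 0<1

    x≤x+y : ∀ {x y} → 0# ≤ y → x ≤ x + y
    x≤x+y {x} {y} p = ≤-by p (solve 2 (λ x y → (x :+ y) :- x := y) refl x y)

    y≤x+y : ∀ {x y} → 0# ≤ x → y ≤ x + y
    y≤x+y {x} {y} p = ≤-by p (solve 2 (λ x y → (x :+ y) :- y := x) refl x y)

    >⇒≢ : ∀ {x} → 0# < x → x ≢ 0#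
    >⇒≢ p e = irrefl (sym e) p

    *-inverseˡ : ∀ x → x ≢ 0# → x ⁻¹ * x ≡ 1#
    *-inverseˡ x p = trans (*-comm _ _) (*-inverse x p)

    ⁻¹-pos : ∀ {x} → 0# < x → 0# < x ⁻¹
    ⁻¹-pos {x} p with compare 0# (x ⁻¹)
    ... | tri< q _ _ = q
    ... | tri≈ _ e _ = ⊥-elim (0≢1 (trans (sym (zeroʳ x)) (trans (cong (x *_) e) (*-inverse x (>⇒≢ p)))))
    ... | tri> _ _ q = ⊥-elim (asym 0<1 (subst (_< 0#) (*-inverse x (>⇒≢ p)) (subst₂ _<_ refl (zeroʳ x) (*-monoˡ-< p q))))

    ⁻¹-nonneg : ∀ {x} → 0# ≤ x → 0# ≤ x ⁻¹
    ⁻¹-nonneg (inj₁ p) = inj₁ (⁻¹-pos p)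
    ⁻¹-nonneg (inj₂ refl) = inj₂ (sym 0⁻¹≡0)

    -- Covers `0#` as well, where the product vanishes; a projection therefore loses at most 1 of
    -- its trace even if the constraint vector is already killed.
    x*x⁻¹≤1 : ∀ x → x * x ⁻¹ ≤ 1#
    x*x⁻¹≤1 x with compare x 0#
    ... | tri< _ n _ = inj₂ (*-inverse x n)
    ... | tri≈ _ refl _ = subst (_≤ 1#) (sym (zeroˡ _)) 0≤1
    ... | tri> _ n _ = inj₂ (*-inverse x n)

    ≤-*⁻¹ : ∀ {x y z} → 0# < z → x * z ≤ y → x ≤ y * z ⁻¹
    ≤-*⁻¹ {x} {y} {z} p q = subst (_≤ y * z ⁻¹) (trans (*-assoc _ _ _) (trans (cong (x *_) (*-inverse z (>⇒≢ p))) (*-identityʳ x))) (*-monoʳ-≤ (<⇒≤ (⁻¹-pos p)) q)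

    *⁻¹-≤ : ∀ {x y z} → 0# < z → x ≤ y * z → x * z ⁻¹ ≤ y
    *⁻¹-≤ {x} {y} {z} p q = subst (x * z ⁻¹ ≤_) (trans (*-assoc _ _ _) (trans (cong (y *_) (*-inverse z (>⇒≢ p))) (*-identityʳ y))) (*-monoʳ-≤ (<⇒≤ (⁻¹-pos p)) q)

    *-cancelˡ-≤ : ∀ {x y z} → 0# < z → z * x ≤ z * y → x ≤ y
    *-cancelˡ-≤ {x} {y} {z} p q with <-or-≥ y x
    ... | inj₁ r = ⊥-elim (<⇒≱ (*-monoˡ-< p r) q)
    ... | inj₂ r = r

    *-cancelˡ-≡ : ∀ {x y z} → z ≢ 0# → z * x ≡ z * y → x ≡ y
    *-cancelˡ-≡ {x} {y} {z} p q = trans (lem x) (trans (cong (z ⁻¹ *_) q) (sym (lem y)))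
      where
      lem : ∀ x → x ≡ z ⁻¹ * (z * x)
      lem x = sym (trans (sym (*-assoc _ _ _)) (trans (cong (_* x) (*-inverseˡ z p)) (*-identityˡ x)))

    abs-nonneg : ∀ x → 0# ≤ abs x
    abs-nonneg x with x <? 0#
    ... | yes p = <⇒≤ (neg-pos p)
    ... | no ¬p = ≮⇒≥ ¬p

    abs-≥0 : ∀ {x} → 0# ≤ x → abs x ≡ x
    abs-≥0 {x} p with x <? 0#
    ... | yes q = ⊥-elim (<⇒≱ q p)
    ... | no _ = refl

    abs-≤0 : ∀ {x} → x ≤ 0# → abs x ≡ - x
    abs-≤0 {x} p with x <? 0#
    ... | yes q = refl
    ... | no ¬q = subst (λ x → x ≡ - x) (sym x≡0) (sym -0#≈0#)
      where x≡0 = ≤-antisym p (≮⇒≥ ¬q)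

    x≤abs : ∀ x → x ≤ abs x
    x≤abs x with x <? 0#
    ... | yes p = ≤-trans (<⇒≤ p) (<⇒≤ (neg-pos p))
    ... | no _ = ≤-refl

    -x≤abs : ∀ x → - x ≤ abs x
    -x≤abs x with x <? 0#
    ... | yes p = ≤-refl
    ... | no ¬p = ≤-trans (neg-nonpos (≮⇒≥ ¬p)) (≮⇒≥ ¬p)

    abs-≤ : ∀ {x y} → x ≤ y → - x ≤ y → abs x ≤ y
    abs-≤ {x} p q with x <? 0#
    ... | yes _ = q
    ... | no _ = p

    abs-< : ∀ {x y} → x < y → - x < y → abs x < y
    abs-< {x} p q with x <? 0#
    ... | yes _ = q
    ... | no _ = p

    abs-+ : ∀ x y → abs (x + y) ≤ abs x + abs y
    abs-+ x y = abs-≤ (+-mono-≤ (x≤abs x) (x≤abs y))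
      (subst (_≤ abs x + abs y) (-‿+-comm x y) (+-mono-≤ (-x≤abs x) (-x≤abs y)))

    abs-neg : ∀ x → abs (- x) ≡ abs x
    abs-neg x with ≤-total 0# x
    ... | inj₁ p = trans (abs-≤0 (neg-nonpos p)) (trans (-‿involutive x) (sym (abs-≥0 p)))
    ... | inj₂ p = trans (abs-≥0 (neg-nonneg p)) (sym (abs-≤0 p))

    abs-* : ∀ x y → abs (x * y) ≡ abs x * abs y
    abs-* x y with ≤-total 0# x | ≤-total 0# y
    ... | inj₁ p | inj₁ q = trans (abs-≥0 (*-nonneg p q)) (sym (cong₂ _*_ (abs-≥0 p) (abs-≥0 q)))
    ... | inj₁ p | inj₂ q = trans (trans (cong abs (solve 2 (λ x y → x :* y := :- (x :* (:- y))) refl x y)) (trans (abs-neg _) (abs-≥0 (*-nonneg p (neg-nonneg q))))) (sym (cong₂ _*_ (abs-≥0 p) (abs-≤0 q)))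
    ... | inj₂ p | inj₁ q = trans (trans (cong abs (solve 2 (λ x y → x :* y := :- ((:- x) :* y)) refl x y)) (trans (abs-neg _) (abs-≥0 (*-nonneg (neg-nonneg p) q)))) (sym (cong₂ _*_ (abs-≤0 p) (abs-≥0 q)))
    ... | inj₂ p | inj₂ q = trans (trans (cong abs (solve 2 (λ x y → x :* y := (:- x) :* (:- y)) refl x y)) (abs-≥0 (*-nonneg (neg-nonneg p) (neg-nonneg q)))) (sym (cong₂ _*_ (abs-≤0 p) (abs-≤0 q)))

    abs-sub-comm : ∀ x y → abs (x - y) ≡ abs (y - x)
    abs-sub-comm x y = trans (cong abs (solve 2 (λ x y → x :- y := :- (y :- x)) refl x y)) (abs-neg _)

    ^-nonneg : ∀ {x} n → 0# ≤ x → 0# ≤ x ^ n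
    ^-nonneg zero p = 0≤1
    ^-nonneg (suc n) p = *-nonneg p (^-nonneg n p)

    ^-mono-≤ : ∀ {x y} n → 0# ≤ x → x ≤ y → x ^ n ≤ y ^ n
    ^-mono-≤ zero _ _ = ≤-refl
    ^-mono-≤ (suc n) p q = *-mono-≤ p (^-nonneg n p) q (^-mono-≤ n p q)

    1≤^ : ∀ {x} n → 1# ≤ x → 1# ≤ x ^ n
    1≤^ zero p = ≤-refl
    1≤^ {x} (suc n) p = subst (_≤ x * x ^ n) (*-identityʳ 1#) (*-mono-≤ 0≤1 0≤1 p (1≤^ n p))

    abs-^ : ∀ x n → abs (x ^ n) ≡ abs x ^ n
    abs-^ x zero = abs-≥0 0≤1
    abs-^ x (suc n) = trans (abs-* x (x ^ n)) (cong (abs x *_) (abs-^ x n))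

    *-^ : ∀ x y n → (x * y) ^ n ≡ x ^ n * y ^ n
    *-^ x y zero = sym (*-identityʳ 1#)
    *-^ x y (suc n) = trans (cong ((x * y) *_) (*-^ x y n)) (solve 4 (λ x y a b → (x :* y) :* (a :* b) := (x :* a) :* (y :* b)) refl x y (x ^ n) (y ^ n))

    ^-≤1 : ∀ {x} n → 0# ≤ x → x ≤ 1# → x ^ n ≤ 1#
    ^-≤1 zero _ _ = ≤-refl
    ^-≤1 {x} (suc n) p q = subst (x * x ^ n ≤_) (*-identityʳ 1#) (*-mono-≤ p (^-nonneg n p) q (^-≤1 n p q))

    fromℕ-nonneg : ∀ n → 0# ≤ fromℕ n
    fromℕ-nonneg zero = ≤-refl
    fromℕ-nonneg (suc n) = +-nonneg 0≤1 (fromℕ-nonneg n)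

    fromℕ-suc-pos : ∀ n → 0# < fromℕ (suc n)
    fromℕ-suc-pos n = +-pos-nonneg 0<1 (fromℕ-nonneg n)

    fromℕ-pos : ∀ {n} → 1 ℕ.≤ n → 0# < fromℕ n
    fromℕ-pos {suc n} _ = fromℕ-suc-pos n

    fromℕ-+ : ∀ m n → fromℕ (m ℕ.+ n) ≡ fromℕ m + fromℕ n
    fromℕ-+ zero n = sym (+-identityˡ _)
    fromℕ-+ (suc m) n = trans (cong (1# +_) (fromℕ-+ m n)) (sym (+-assoc _ _ _))

    fromℕ-* : ∀ m n → fromℕ (m ℕ.* n) ≡ fromℕ m * fromℕ n
    fromℕ-* zero n = sym (zeroˡ _)
    fromℕ-* (suc m) n = trans (fromℕ-+ n (m ℕ.* n)) (trans (cong (fromℕ n +_) (fromℕ-* m n)) (solve 2 (λ a b → b :+ a :* b := (:1 :+ a) :* b) refl (fromℕ m) (fromℕ n)))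

    fromℕ-mono-≤ : ∀ {m n} → m ℕ.≤ n → fromℕ m ≤ fromℕ n
    fromℕ-mono-≤ {m} {n} p with ℕP.m≤n⇒∃[o]m+o≡n p
    ... | o , refl = subst (fromℕ m ≤_) (sym (fromℕ-+ m o)) (x≤x+y (fromℕ-nonneg o))

    fromℕ-cancel-< : ∀ {m n} → fromℕ m < fromℕ n → m ℕ.< n
    fromℕ-cancel-< {m} {n} p with m ℕ.<? n
    ... | yes q = q
    ... | no ¬q = ⊥-elim (<⇒≱ p (fromℕ-mono-≤ (ℕP.≮⇒≥ ¬q)))

    fromℕ-1 : fromℕ 1 ≡ 1#
    fromℕ-1 = +-identityʳ 1#

  -- Finite sums and products.

  module Sums where

    open Reals

    -- The last summand is split off, as in an accumulating loop, so that this is both the semantics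
    -- of `sumE` and, step by step, the content of the machine's accumulator.
    Σ< : ℕ → (ℕ → ℝ) → ℝ
    Σ< zero    f = 0#
    Σ< (suc n) f = Σ< n f + f n

    Π< : ℕ → (ℕ → ℝ) → ℝ
    Π< zero    f = 1#
    Π< (suc n) f = Π< n f * f n

    Σ-cong : ∀ n {f g : ℕ → ℝ} → (∀ i → i ℕ.< n → f i ≡ g i) → Σ< n f ≡ Σ< n g
    Σ-cong zero    p = refl
    Σ-cong (suc n) p = cong₂ _+_ (Σ-cong n λ i i<n → p i (ℕP.m<n⇒m<1+n i<n)) (p n ℕP.≤-refl)

    Σ-ext : ∀ n {f g : ℕ → ℝ} → (∀ i → f i ≡ g i) → Σ< n f ≡ Σ< n g
    Σ-ext n p = Σ-cong n λ i _ → p i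

    Σ-+ : ∀ n (f g : ℕ → ℝ) → Σ< n (λ i → f i + g i) ≡ Σ< n f + Σ< n g
    Σ-+ zero    f g = sym (+-identityˡ 0#)
    Σ-+ (suc n) f g = trans (cong (_+ (f n + g n)) (Σ-+ n f g))
      (solve 4 (λ a b c d → (a :+ b) :+ (c :+ d) := (a :+ c) :+ (b :+ d)) refl (Σ< n f) (Σ< n g) (f n) (g n))

    Σ-*ˡ : ∀ n c (f : ℕ → ℝ) → Σ< n (λ i → c * f i) ≡ c * Σ< n f
    Σ-*ˡ zero    c f = sym (zeroʳ c)
    Σ-*ˡ (suc n) c f = trans (cong (_+ c * f n) (Σ-*ˡ n c f)) (sym (distribˡ c _ _))

    Σ-*ʳ : ∀ n c (f : ℕ → ℝ) → Σ< n (λ i → f i * c) ≡ Σ< n f * c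
    Σ-*ʳ n c f = trans (Σ-ext n λ i → *-comm (f i) c) (trans (Σ-*ˡ n c f) (*-comm c _))

    Σ-- : ∀ n (f g : ℕ → ℝ) → Σ< n (λ i → f i - g i) ≡ Σ< n f - Σ< n g
    Σ-- zero    f g = sym (-‿inverseʳ 0#)
    Σ-- (suc n) f g = trans (cong (_+ (f n - g n)) (Σ-- n f g))
      (solve 4 (λ a b c d → (a :- b) :+ (c :- d) := (a :+ c) :- (b :+ d)) refl (Σ< n f) (Σ< n g) (f n) (g n))

    Σ-0 : ∀ n {f : ℕ → ℝ} → (∀ i → i ℕ.< n → f i ≡ 0#) → Σ< n f ≡ 0#
    Σ-0 zero    p = refl
    Σ-0 (suc n) p = trans (cong₂ _+_ (Σ-0 n λ i i<n → p i (ℕP.m<n⇒m<1+n i<n)) (p n ℕP.≤-refl)) (+-identityˡ 0#)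

    Σ-swap : ∀ m n (f : ℕ → ℕ → ℝ) → Σ< m (λ i → Σ< n (λ j → f i j)) ≡ Σ< n (λ j → Σ< m (λ i → f i j))
    Σ-swap zero    n f = sym (Σ-0 n λ _ _ → refl)
    Σ-swap (suc m) n f = trans (cong (_+ Σ< n (f m)) (Σ-swap m n f)) (sym (Σ-+ n _ (f m)))

    Σ-mono-≤ : ∀ n {f g : ℕ → ℝ} → (∀ i → i ℕ.< n → f i ≤ g i) → Σ< n f ≤ Σ< n g
    Σ-mono-≤ zero    p = ≤-refl
    Σ-mono-≤ (suc n) p = +-mono-≤ (Σ-mono-≤ n λ i i<n → p i (ℕP.m<n⇒m<1+n i<n)) (p n ℕP.≤-refl)

    Σ-nonneg : ∀ n {f : ℕ → ℝ} → (∀ i → i ℕ.< n → 0# ≤ f i) → 0# ≤ Σ< n f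
    Σ-nonneg zero    p = ≤-refl
    Σ-nonneg (suc n) p = +-nonneg (Σ-nonneg n λ i i<n → p i (ℕP.m<n⇒m<1+n i<n)) (p n ℕP.≤-refl)

    Σ-abs : ∀ n (f : ℕ → ℝ) → abs (Σ< n f) ≤ Σ< n (λ i → abs (f i))
    Σ-abs zero    f = ≡⇒≤ (abs-≥0 ≤-refl)
    Σ-abs (suc n) f = ≤-trans (abs-+ (Σ< n f) (f n)) (+-mono-≤ (Σ-abs n f) ≤-refl)

    Σ-const : ∀ n c → Σ< n (λ _ → c) ≡ fromℕ n * c
    Σ-const zero    c = sym (zeroˡ c)
    Σ-const (suc n) c = trans (cong (_+ c) (Σ-const n c)) (solve 2 (λ a c → a :* c :+ c := (:1 :+ a) :* c) refl (fromℕ n) c)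

    term≤Σ : ∀ n {f : ℕ → ℝ} → (∀ i → i ℕ.< n → 0# ≤ f i) → ∀ i → i ℕ.< n → f i ≤ Σ< n f
    term≤Σ (suc n) {f} p i i<1+n with i ℕ.≟ n
    ... | yes refl = y≤x+y (Σ-nonneg n λ j j<n → p j (ℕP.m<n⇒m<1+n j<n))
    ... | no i≢n = ≤-trans (term≤Σ n (λ j j<n → p j (ℕP.m<n⇒m<1+n j<n)) i (ℕP.≤∧≢⇒< (ℕ.s≤s⁻¹ i<1+n) i≢n)) (x≤x+y (p n ℕP.≤-refl))

    Σ-pos⇒∃ : ∀ n {f : ℕ → ℝ} → 0# < Σ< n f → ∃[ i ] i ℕ.< n × 0# < f i
    Σ-pos⇒∃ zero    p = ⊥-elim (irrefl refl p)
    Σ-pos⇒∃ (suc n) {f} p with <-or-≥ 0# (f n)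
    ... | inj₁ q = n , ℕP.≤-refl , q
    ... | inj₂ q with Σ-pos⇒∃ n (<-≤-trans p (≤-by (neg-nonneg q) (solve 2 (λ a b → a :- (a :+ b) := :- b) refl (Σ< n f) (f n))))
    ... | i , i<n , r = i , ℕP.m<n⇒m<1+n i<n , r

    Σ-mono-< : ∀ n {f g : ℕ → ℝ} → (∀ i → i ℕ.< n → f i ≤ g i) → ∀ i c → i ℕ.< n → f i + c < g i → Σ< n f + c < Σ< n g
    Σ-mono-< (suc n) {f} {g} p i c i<1+n q with i ℕ.≟ n
    ... | yes refl = subst (_< Σ< n g + g n) (sym (+-assoc _ _ c)) (+-mono-≤-< (Σ-mono-≤ n λ j j<n → p j (ℕP.m<n⇒m<1+n j<n)) q)
    ... | no i≢n = subst (_< Σ< n g + g n) (solve 3 (λ a b c → (a :+ c) :+ b := (a :+ b) :+ c) refl (Σ< n f) (f n) c)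
      (+-mono-<-≤ (Σ-mono-< n (λ j j<n → p j (ℕP.m<n⇒m<1+n j<n)) i c (ℕP.≤∧≢⇒< (ℕ.s≤s⁻¹ i<1+n) i≢n) q) (p n ℕP.≤-refl))

    ΠF : ∀ {d} → (Fin d → ℝ) → ℝ
    ΠF {zero}  f = 1#
    ΠF {suc d} f = f zero * ΠF (λ k → f (suc k))

    ΠF-nonneg : ∀ {d} {f : Fin d → ℝ} → (∀ k → 0# ≤ f k) → 0# ≤ ΠF f
    ΠF-nonneg {zero}  p = 0≤1
    ΠF-nonneg {suc d} p = *-nonneg (p zero) (ΠF-nonneg λ k → p (suc k))

    ΠF-mono-≤ : ∀ {d} {f g : Fin d → ℝ} → (∀ k → 0# ≤ f k) → (∀ k → f k ≤ g k) → ΠF f ≤ ΠF g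
    ΠF-mono-≤ {zero}  p q = ≤-refl
    ΠF-mono-≤ {suc d} p q = *-mono-≤ (p zero) (ΠF-nonneg λ k → p (suc k)) (q zero) (ΠF-mono-≤ (λ k → p (suc k)) (λ k → q (suc k)))

    ΠF-cong : ∀ {d} {f g : Fin d → ℝ} → (∀ k → f k ≡ g k) → ΠF f ≡ ΠF g
    ΠF-cong {zero}  p = refl
    ΠF-cong {suc d} p = cong₂ _*_ (p zero) (ΠF-cong λ k → p (suc k))

    ΠF-* : ∀ {d} (f g : Fin d → ℝ) → ΠF (λ k → f k * g k) ≡ ΠF f * ΠF g
    ΠF-* {zero}  f g = sym (*-identityʳ 1#)
    ΠF-* {suc d} f g = trans (cong ((f zero * g zero) *_) (ΠF-* (λ k → f (suc k)) (λ k → g (suc k))))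
      (solve 4 (λ a b x y → (a :* b) :* (x :* y) := (a :* x) :* (b :* y)) refl (f zero) (g zero) _ _)

    ΠF-abs : ∀ {d} (f : Fin d → ℝ) → abs (ΠF f) ≡ ΠF (λ k → abs (f k))
    ΠF-abs {zero}  f = abs-≥0 0≤1
    ΠF-abs {suc d} f = trans (abs-* (f zero) _) (cong (abs (f zero) *_) (ΠF-abs λ k → f (suc k)))

    ΠF-const : ∀ d c → ΠF {d} (λ _ → c) ≡ c ^ d
    ΠF-const zero    c = refl
    ΠF-const (suc d) c = cong (c *_) (ΠF-const d c)

    ΠF-≤1 : ∀ {d} {f : Fin d → ℝ} → (∀ k → 0# ≤ f k) → (∀ k → f k ≤ 1#) → ΠF f ≤ 1#
    ΠF-≤1 {zero}  p q = ≤-refl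
    ΠF-≤1 {suc d} p q = ≤-respʳ (*-identityʳ 1#) (*-mono-≤ (p zero) (ΠF-nonneg λ k → p (suc k)) (q zero) (ΠF-≤1 (λ k → p (suc k)) λ k → q (suc k)))

    factor≤ΠF : ∀ {d} {f : Fin d → ℝ} → (∀ k → 1# ≤ f k) → ∀ k → f k ≤ ΠF f
    1≤ΠF : ∀ {d} {f : Fin d → ℝ} → (∀ k → 1# ≤ f k) → 1# ≤ ΠF f
    1≤ΠF {zero}  p = ≤-refl
    1≤ΠF {suc d} p = ≤-respˡ (*-identityʳ 1#) (*-mono-≤ 0≤1 0≤1 (p zero) (1≤ΠF λ k → p (suc k)))
    factor≤ΠF {suc d} {f} p zero    = ≤-respˡ (*-identityʳ _) (*-monoˡ-≤ (≤-trans 0≤1 (p zero)) (1≤ΠF λ k → p (suc k)))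
    factor≤ΠF {suc d} {f} p (suc k) = ≤-trans (factor≤ΠF (λ k → p (suc k)) k) (≤-respˡ (*-identityˡ _) (*-monoʳ-≤ (≤-trans 0≤1 (1≤ΠF λ k → p (suc k))) (p zero)))

  -- Limits and the exponential series.

  module Analysis where

    open Reals
    open Sums
    open import Data.Nat using (_!)

    -- Otherwise the naturals have a supremum `s`; some `N` exceeds `s - 1#`, and `suc N` exceeds
    -- `s`.
    archimedean : ∀ x → ∃[ N ] x < fromℕ N
    archimedean x with em (∃[ N ] x < fromℕ N)
    ... | yes p = p
    ... | no ¬p with complete (λ y → ∃[ N ] y ≡ fromℕ N) (0# , 0 , refl) (x , λ { _ (N , refl) → ≮⇒≥ λ q → ¬p (N , q) })
    ... | s , ub , approx with approx (s - 1#) (<-by 0<1 (solve 1 (λ s → s :- (s :- :1) := :1) refl s))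
    ... | _ , (N , refl) , q = ⊥-elim (<⇒≱ (<-by (<⇒0< q) (solve 2 (λ s n → (:1 :+ n) :- s := n :- (s :- :1)) refl s (fromℕ N))) (ub _ (suc N , refl)))

    the-spec : ∀ {S : ℝ → Set} → ∃ S → S (the S)
    the-spec {S} p with em (∃ S)
    ... | yes (_ , q) = q
    ... | no ¬q = ⊥-elim (¬q p)

    half : ℝ
    half = (1# + 1#) ⁻¹

    0<2 : 0# < 1# + 1#
    0<2 = +-pos-nonneg 0<1 0≤1

    0<half : 0# < half
    0<half = ⁻¹-pos 0<2

    half+half : half + half ≡ 1#
    half+half = trans (solve 1 (λ h → h :+ h := (:1 :+ :1) :* h) refl half) (*-inverse _ (>⇒≢ 0<2))

    pos-min : ∀ {a b} → 0# < a → 0# < b → ∃[ c ] 0# < c × c ≤ a × c ≤ b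
    pos-min {a} {b} 0<a 0<b with ≤-total a b
    ... | inj₁ p = a , 0<a , ≤-refl , p
    ... | inj₂ p = b , 0<b , p , ≤-refl

    -- Allows an error `K * δ` and only tolerances `δ ≤ 1`, as products of limits produce. The
    -- tolerance used is the smaller of 1 and δ / (K + 1); the summand 1 covers `K = 0` and gives
    -- the strict inequality.
    conv-by : ∀ {a l} K → 0# ≤ K → (∀ δ → 0# < δ → δ ≤ 1# → ∃[ N ] (∀ n → N ℕ.≤ n → abs (a n - l) ≤ K * δ)) → ConvergesTo a l
    conv-by {a} {l} K 0≤K h δ 0<δ = proj₁ (h δ' 0<δ' δ'≤1) , λ n N≤n → ≤-<-trans (proj₂ (h δ' 0<δ' δ'≤1) n N≤n) small
      where
      0<K+1 : 0# < K + 1#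
      0<K+1 = subst (0# <_) (+-comm 1# K) (+-pos-nonneg 0<1 0≤K)
      small-δ = pos-min 0<1 (*-pos 0<δ (⁻¹-pos 0<K+1))
      δ' = proj₁ small-δ
      0<δ' = proj₁ (proj₂ small-δ)
      δ'≤1 = proj₁ (proj₂ (proj₂ small-δ))
      δ'≤ = proj₂ (proj₂ (proj₂ small-δ))
      small : K * δ' < δ
      small = <-≤-trans (<-by 0<δ' (solve 2 (λ k d → (k :+ :1) :* d :- k :* d := d) refl K δ'))
        (≤-trans (*-monoˡ-≤ (<⇒≤ 0<K+1) δ'≤) (≡⇒≤ (trans (solve 3 (λ k d i → k :* (d :* i) := d :* (k :* i)) refl (K + 1#) δ _)
          (trans (cong (δ *_) (*-inverse _ (>⇒≢ 0<K+1))) (*-identityʳ δ)))))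

    conv-const : ∀ c → ConvergesTo (λ _ → c) c
    conv-const c δ 0<δ = 0 , λ _ _ → subst (_< δ) (sym (trans (cong abs (-‿inverseʳ c)) (abs-≥0 ≤-refl))) 0<δ

    conv-+ : ∀ {a b l m} → ConvergesTo a l → ConvergesTo b m → ConvergesTo (λ n → a n + b n) (l + m)
    conv-+ {a} {b} {l} {m} p q = conv-by (1# + 1#) (<⇒≤ 0<2) λ δ 0<δ _ → let (N , f) = p δ 0<δ ; (M , g) = q δ 0<δ in
      N ℕ.⊔ M , λ n le → ≤-trans (≤-respˡ (cong abs (solve 4 (λ a b l m → (a :- l) :+ (b :- m) := (a :+ b) :- (l :+ m)) refl (a n) (b n) l m)) (abs-+ (a n - l) (b n - m)))
        (≤-respʳ (solve 1 (λ d → d :+ d := (:1 :+ :1) :* d) refl δ) (+-mono-≤ (<⇒≤ (f n (ℕP.m⊔n≤o⇒m≤o N M le))) (<⇒≤ (g n (ℕP.m⊔n≤o⇒n≤o N M le)))))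

    conv-* : ∀ {a b l m} → ConvergesTo a l → ConvergesTo b m → ConvergesTo (λ n → a n * b n) (l * m)
    conv-* {a} {b} {l} {m} p q = conv-by (1# + (abs l + abs m)) (+-nonneg 0≤1 (+-nonneg (abs-nonneg l) (abs-nonneg m))) λ δ 0<δ δ≤1 →
      let (N , f) = p δ 0<δ ; (M , g) = q δ 0<δ in
      N ℕ.⊔ M , λ n le → let u = a n - l ; v = b n - m
                             u≤ = <⇒≤ (f n (ℕP.m⊔n≤o⇒m≤o N M le)) ; v≤ = <⇒≤ (g n (ℕP.m⊔n≤o⇒n≤o N M le)) in
        abs (a n * b n - l * m)
          ≡⟨ cong abs (solve 4 (λ a b l m → a :* b :- l :* m := (a :- l) :* (b :- m) :+ (l :* (b :- m) :+ m :* (a :- l))) refl (a n) (b n) l m) ⟩≤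
        abs (u * v + (l * v + m * u))
          ≤⟨ ≤-trans (abs-+ _ _) (+-mono-≤ ≤-refl (abs-+ _ _)) ⟩
        abs (u * v) + (abs (l * v) + abs (m * u))
          ≡⟨ cong₂ _+_ (abs-* u v) (cong₂ _+_ (abs-* l v) (abs-* m u)) ⟩≤
        abs u * abs v + (abs l * abs v + abs m * abs u)
          ≤⟨ +-mono-≤ (*-mono-≤ (abs-nonneg u) (abs-nonneg v) u≤ (≤-trans v≤ δ≤1)) (+-mono-≤ (*-monoˡ-≤ (abs-nonneg l) v≤) (*-monoˡ-≤ (abs-nonneg m) u≤)) ⟩
        δ * 1# + (abs l * δ + abs m * δ)
          ≡⟨ solve 3 (λ d l m → d :* :1 :+ (l :* d :+ m :* d) := (:1 :+ (l :+ m)) :* d) refl δ (abs l) (abs m) ⟩≤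
        (1# + (abs l + abs m)) * δ □

    conv-neg : ∀ {a l} → ConvergesTo a l → ConvergesTo (λ n → - a n) (- l)
    conv-neg {a} {l} p δ 0<δ = let (N , f) = p δ 0<δ in N , λ n le →
      <-respˡ (trans (abs-sub-comm (a n) l) (cong abs (solve 2 (λ a l → l :- a := (:- a) :- (:- l)) refl (a n) l))) (f n le)

    conv-ext : ∀ {a b l} → (∀ n → a n ≡ b n) → ConvergesTo a l → ConvergesTo b l
    conv-ext {l = l} e p δ 0<δ = proj₁ (p δ 0<δ) , λ n le → <-respˡ (cong (λ z → abs (z - l)) (e n)) (proj₂ (p δ 0<δ) n le)

    conv-≤ : ∀ {a l b} → ConvergesTo a l → (∀ n → a n ≤ b) → l ≤ b
    conv-≤ {a} {l} {b} p h with <-or-≥ b l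
    ... | inj₂ q = q
    ... | inj₁ q with p (l - b) (<⇒0< q)
    ... | N , f = ⊥-elim (<⇒≱ (≤-<-trans (≤-trans (x≤abs _) (≡⇒≤ (abs-sub-comm l (a N)))) (f N ℕP.≤-refl))
      (≤-by (≤⇒0≤ (h N)) (solve 3 (λ l a b → (l :- a) :- (l :- b) := b :- a) refl l (a N) b)))

    -- The index on the right may run ahead of the one on the left: a product of two partial sums of
    -- exponential series is bounded by a later partial sum, not by the one with the same index.
    conv-≤-seq : ∀ {a b l m} → ConvergesTo a l → ConvergesTo b m → (∀ n → ∃[ k ] n ℕ.≤ k × a n ≤ b k) → l ≤ m
    conv-≤-seq {a} {b} {l} {m} p q h with <-or-≥ m l
    ... | inj₂ r = r
    ... | inj₁ r = ⊥-elim (<⇒≱ gap (≤-trans (proj₂ (proj₂ (h n))) (≤-by (≤⇒0≤ b≤) (solve 3 (λ m d b → (m :+ d) :- b := d :- (b :- m)) refl m δ (b k)))))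
      where
      δ = (l - m) * half
      0<δ : 0# < δ
      0<δ = *-pos (<⇒0< r) 0<half
      N = proj₁ (p δ 0<δ)
      M = proj₁ (q δ 0<δ)
      n = N ℕ.⊔ M
      k = proj₁ (h n)
      b≤ : b k - m ≤ δ
      b≤ = ≤-trans (x≤abs _) (<⇒≤ (proj₂ (q δ 0<δ) k (ℕP.≤-trans (ℕP.m≤n⊔m N M) (proj₁ (proj₂ (h n))))))
      a> : l - a n < δ
      a> = ≤-<-trans (≤-trans (x≤abs _) (≡⇒≤ (abs-sub-comm l (a n)))) (proj₂ (p δ 0<δ) n (ℕP.m≤m⊔n N M))
      2δ : δ + δ ≡ l - m
      2δ = trans (sym (distribˡ _ _ _)) (trans (cong ((l - m) *_) half+half) (*-identityʳ _))
      gap : m + δ < a n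
      gap = <-by (<⇒0< a>) (trans (solve 4 (λ a m d l → a :- (m :+ d) := (d :- (l :- a)) :+ ((l :- m) :- (d :+ d))) refl (a n) m δ l)
        (trans (cong (λ z → (δ - (l - a n)) + ((l - m) - z)) 2δ) (solve 2 (λ x y → x :+ (y :- y) := x) refl (δ - (l - a n)) (l - m))))

    conv-Σ : ∀ n {a : ℕ → ℕ → ℝ} {l : ℕ → ℝ} → (∀ i → ConvergesTo (a i) (l i)) → ConvergesTo (λ N → Σ< n (λ i → a i N)) (Σ< n l)
    conv-Σ zero    p = conv-const 0#
    conv-Σ (suc n) p = conv-+ (conv-Σ n p) (p n)

    conv-mono : ∀ a → (∀ n → a n ≤ a (suc n)) → ∀ b → (∀ n → a n ≤ b) → ∃ (ConvergesTo a)
    conv-mono a inc b bd with complete (λ y → ∃[ n ] y ≡ a n) (a 0 , 0 , refl) (b , λ { _ (n , refl) → bd n })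
    ... | s , ub , approx = s , conv
      where
      mono : ∀ {N n} → N ℕ.≤′ n → a N ≤ a n
      mono ℕ.≤′-refl = ≤-refl
      mono (ℕ.≤′-step p) = ≤-trans (mono p) (inc _)
      conv : ConvergesTo a s
      conv δ 0<δ with approx (s - δ) (<-by 0<δ (solve 2 (λ s d → s :- (s :- d) := d) refl s δ))
      ... | _ , (N , refl) , q = N , λ n N≤n → abs-<
        (≤-<-trans (≤-by (≤⇒0≤ (ub _ (n , refl))) (solve 2 (λ a s → :0 :- (a :- s) := s :- a) refl (a n) s)) 0<δ)
        (<-by (<⇒0< (<-≤-trans q (mono (ℕP.≤⇒≤′ N≤n)))) (solve 3 (λ s a d → d :- (:- (a :- s)) := a :- (s :- d)) refl s (a n) δ))

    conv-bound : ∀ {a l} → (∀ n → a n ≤ a (suc n)) → ConvergesTo a l → ∀ n → a n ≤ l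
    conv-bound {a} {l} inc p n = conv-≤-seq (conv-const (a n)) p λ k → n ℕ.+ k , ℕP.m≤n+m k n , mono k
      where
      mono : ∀ k → a n ≤ a (n ℕ.+ k)
      mono zero = ≡⇒≤ (cong a (sym (ℕP.+-identityʳ n)))
      mono (suc k) = ≤-trans (mono k) (≤-respʳ (cong a (sym (ℕP.+-suc n k))) (inc _))

    term : ℝ → ℕ → ℝ
    term x k = x ^ k * fromℕ (k !) ⁻¹

    expSum-Σ : ∀ x n → expSum x n ≡ Σ< n (term x)
    expSum-Σ x zero    = refl
    expSum-Σ x (suc n) = cong (_+ term x n) (expSum-Σ x n)

    fact-pos : ∀ k → 0# < fromℕ (k !)
    fact-pos k = fromℕ-pos (ℕP.1≤n! k)

    term-0 : ∀ x → term x 0 ≡ 1#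
    term-0 x = trans (*-identityˡ _) (trans (sym (*-identityˡ _)) (trans (cong (_* fromℕ 1 ⁻¹) (sym fromℕ-1)) (*-inverse _ (>⇒≢ (fact-pos 0)))))

    -- The recurrence stands in for computing with factorials. In `diag-term` the factor `suc n` is
    -- split as `i + j` along the antidiagonal, and each of the two parts lowers one index by this
    -- recurrence.
    term-suc : ∀ x k → fromℕ (suc k) * term x (suc k) ≡ x * term x k
    term-suc x k = *-cancelˡ-≡ (>⇒≢ (fact-pos k)) (begin
      f * (s * ((x * x ^ k) * fromℕ (suc k !) ⁻¹))     ≡⟨ solve 4 (λ f s p i → f :* (s :* (p :* i)) := (s :* f) :* i :* p) refl f s (x * x ^ k) _ ⟩
      (s * f) * fromℕ (suc k !) ⁻¹ * (x * x ^ k)       ≡⟨ cong (λ z → z * fromℕ (suc k !) ⁻¹ * (x * x ^ k)) (sym (fromℕ-* (suc k) (k !))) ⟩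
      fromℕ (suc k !) * fromℕ (suc k !) ⁻¹ * (x * x ^ k) ≡⟨ cong (_* (x * x ^ k)) (trans (*-inverse _ (>⇒≢ (fact-pos (suc k)))) (sym (*-inverse _ (>⇒≢ (fact-pos k))))) ⟩
      f * f ⁻¹ * (x * x ^ k)                           ≡⟨ solve 4 (λ f i x p → f :* i :* (x :* p) := f :* (x :* (p :* i))) refl f (f ⁻¹) x (x ^ k) ⟩
      f * (x * (x ^ k * f ⁻¹)) ∎)
      where
      open ≡-Reasoning
      f = fromℕ (k !)
      s = fromℕ (suc k)

    term-nonneg : ∀ {x} k → 0# ≤ x → 0# ≤ term x k
    term-nonneg k p = *-nonneg (^-nonneg k p) (<⇒≤ (⁻¹-pos (fact-pos k)))

    abs-term : ∀ x k → abs (term x k) ≡ term (abs x) k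
    abs-term x k = trans (abs-* _ _) (cong₂ _*_ (abs-^ x k) (abs-≥0 (<⇒≤ (⁻¹-pos (fact-pos k)))))

    -- Partial sums of a double series, by rows: `diag` covers i + j = n, `tri` covers i + j < n,
    -- `box` a rectangle. For `prodTerm` the triangle is a partial sum of the series at x + y and
    -- the box a product of partial sums.
    diag : (ℕ → ℕ → ℝ) → ℕ → ℝ
    diag P zero    = P 0 0
    diag P (suc n) = P 0 (suc n) + diag (λ i j → P (suc i) j) n

    tri : (ℕ → ℕ → ℝ) → ℕ → ℝ
    tri P zero    = 0#
    tri P (suc n) = Σ< (suc n) (P 0) + tri (λ i j → P (suc i) j) n

    box : (ℕ → ℕ → ℝ) → ℕ → ℕ → ℝ
    box P zero    m = 0#
    box P (suc n) m = Σ< m (P 0) + box (λ i j → P (suc i) j) n m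

    diag-cong : ∀ n {P Q : ℕ → ℕ → ℝ} → (∀ i j → i ℕ.+ j ≡ n → P i j ≡ Q i j) → diag P n ≡ diag Q n
    diag-cong zero    p = p 0 0 refl
    diag-cong (suc n) p = cong₂ _+_ (p 0 (suc n) refl) (diag-cong n λ i j e → p (suc i) j (cong suc e))

    diag-+ : ∀ n (P Q : ℕ → ℕ → ℝ) → diag (λ i j → P i j + Q i j) n ≡ diag P n + diag Q n
    diag-+ zero    P Q = refl
    diag-+ (suc n) P Q = trans (cong (P 0 (suc n) + Q 0 (suc n) +_) (diag-+ n _ _))
      (solve 4 (λ a b c d → (a :+ b) :+ (c :+ d) := (a :+ c) :+ (b :+ d)) refl (P 0 (suc n)) (Q 0 (suc n)) _ _)

    diag-* : ∀ n c (P : ℕ → ℕ → ℝ) → diag (λ i j → c * P i j) n ≡ c * diag P n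
    diag-* zero    c P = refl
    diag-* (suc n) c P = trans (cong (c * P 0 (suc n) +_) (diag-* n c _)) (sym (distribˡ c _ _))

    diag-last : ∀ n (P : ℕ → ℕ → ℝ) → diag P (suc n) ≡ diag (λ i j → P i (suc j)) n + P (suc n) 0
    diag-last zero    P = refl
    diag-last (suc n) P = trans (cong (P 0 (suc (suc n)) +_) (diag-last n (λ i j → P (suc i) j))) (sym (+-assoc _ _ _))

    tri-diag : ∀ n (P : ℕ → ℕ → ℝ) → tri P (suc n) ≡ tri P n + diag P n
    tri-diag zero    P = solve 1 (λ a → (:0 :+ a) :+ :0 := :0 :+ a) refl (P 0 0)
    tri-diag (suc n) P = trans (cong (Σ< (suc (suc n)) (P 0) +_) (tri-diag n _))
      (solve 4 (λ a b c d → (a :+ b) :+ (c :+ d) := (a :+ c) :+ (b :+ d)) refl (Σ< (suc n) (P 0)) (P 0 (suc n)) _ _)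

    prodTerm : ℝ → ℝ → ℕ → ℕ → ℝ
    prodTerm x y i j = term x i * term y j

    -- The binomial theorem, divided by n!.
    diag-term : ∀ x y n → diag (prodTerm x y) n ≡ term (x + y) n
    diag-term x y zero    = trans (cong₂ _*_ (term-0 x) (term-0 y)) (trans (*-identityʳ 1#) (sym (term-0 (x + y))))
    diag-term x y (suc n) = *-cancelˡ-≡ (>⇒≢ (fromℕ-suc-pos n)) (begin
      s * diag P (suc n)                                          ≡⟨ sym (diag-* (suc n) s P) ⟩
      diag (λ i j → s * P i j) (suc n)                            ≡⟨ diag-cong (suc n) (λ i j e → trans (cong (λ z → fromℕ z * P i j) (sym e)) (trans (cong (_* P i j) (fromℕ-+ i j)) (distribʳ _ _ _))) ⟩
      diag (λ i j → fromℕ i * P i j + fromℕ j * P i j) (suc n)    ≡⟨ diag-+ (suc n) (λ i j → fromℕ i * P i j) (λ i j → fromℕ j * P i j) ⟩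
      diag (λ i j → fromℕ i * P i j) (suc n) + diag (λ i j → fromℕ j * P i j) (suc n) ≡⟨ cong₂ _+_ left right ⟩
      x * diag P n + y * diag P n                                 ≡⟨ sym (distribʳ _ _ _) ⟩
      (x + y) * diag P n                                          ≡⟨ cong ((x + y) *_) (diag-term x y n) ⟩
      (x + y) * term (x + y) n                                    ≡⟨ sym (term-suc (x + y) n) ⟩
      s * term (x + y) (suc n) ∎)
      where
      open ≡-Reasoning
      P = prodTerm x y
      s = fromℕ (suc n)
      left : diag (λ i j → fromℕ i * P i j) (suc n) ≡ x * diag P n
      left = trans (cong (_+ diag (λ i j → fromℕ (suc i) * P (suc i) j) n) (zeroˡ _)) (trans (+-identityˡ _) (trans
        (diag-cong n λ i j _ → trans (sym (*-assoc _ _ _)) (trans (cong (_* term y j) (term-suc x i)) (*-assoc _ _ _))) (diag-* n x P)))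
      right : diag (λ i j → fromℕ j * P i j) (suc n) ≡ y * diag P n
      right = trans (diag-last n (λ i j → fromℕ j * P i j)) (trans (cong (diag (λ i j → fromℕ (suc j) * P i (suc j)) n +_) (zeroˡ _)) (trans (+-identityʳ _) (trans
        (diag-cong n λ i j _ → trans (solve 3 (λ a b c → a :* (b :* c) := b :* (a :* c)) refl (fromℕ (suc j)) (term x i) (term y (suc j)))
          (trans (cong (term x i *_) (term-suc y j)) (solve 3 (λ a b c → a :* (b :* c) := b :* (a :* c)) refl (term x i) y (term y j)))) (diag-* n y P))))

    tri-expSum : ∀ x y n → tri (prodTerm x y) n ≡ expSum (x + y) n
    tri-expSum x y zero    = refl
    tri-expSum x y (suc n) = trans (tri-diag n _) (cong₂ _+_ (tri-expSum x y n) (diag-term x y n))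

    Σ-head : ∀ n (f : ℕ → ℝ) → Σ< (suc n) f ≡ f 0 + Σ< n (λ i → f (suc i))
    Σ-head zero    f = +-comm _ _
    Σ-head (suc n) f = trans (cong (_+ f (suc n)) (Σ-head n f)) (+-assoc _ _ _)

    box-Σ : ∀ n m (f g : ℕ → ℝ) → box (λ i j → f i * g j) n m ≡ Σ< n f * Σ< m g
    box-Σ zero    m f g = sym (zeroˡ _)
    box-Σ (suc n) m f g = trans (cong₂ _+_ (Σ-*ˡ m (f 0) g) (box-Σ n m (λ i → f (suc i)) g)) (trans (sym (distribʳ _ _ _)) (cong (_* Σ< m g) (sym (Σ-head n f))))

    box-expSum : ∀ x y n m → box (prodTerm x y) n m ≡ expSum x n * expSum y m
    box-expSum x y n m = trans (box-Σ n m (term x) (term y)) (sym (cong₂ _*_ (expSum-Σ x n) (expSum-Σ y m)))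

    Σ-tail-abs : ∀ {n m} (f g : ℕ → ℝ) → (∀ i → abs (f i) ≡ g i) → n ℕ.≤′ m → abs (Σ< m f - Σ< n f) ≤ Σ< m g - Σ< n g
    Σ-tail-abs {n} f g e ℕ.≤′-refl = ≡⇒≤ (trans (cong abs (-‿inverseʳ _)) (trans (abs-≥0 ≤-refl) (sym (-‿inverseʳ _))))
    Σ-tail-abs {n} {suc m} f g e (ℕ.≤′-step p) =
      abs (Σ< m f + f m - Σ< n f) ≡⟨ cong abs (solve 3 (λ a b c → (a :+ b) :- c := (a :- c) :+ b) refl (Σ< m f) (f m) (Σ< n f)) ⟩≤
      abs (Σ< m f - Σ< n f + f m) ≤⟨ abs-+ _ _ ⟩
      abs (Σ< m f - Σ< n f) + abs (f m) ≤⟨ +-mono-≤ (Σ-tail-abs f g e p) (≡⇒≤ (e m)) ⟩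
      (Σ< m g - Σ< n g) + g m ≡⟨ solve 3 (λ a b c → (a :- c) :+ b := (a :+ b) :- c) refl (Σ< m g) (g m) (Σ< n g) ⟩≤
      Σ< m g + g m - Σ< n g □

    -- The box minus the triangle is a sum of entries, because `n ≤ m` puts the triangle inside the
    -- box; each entry is replaced by its absolute value. This reduces `exp-+` to nonnegative
    -- arguments.
    box-tri-abs : ∀ n m (P Q : ℕ → ℕ → ℝ) → (∀ i j → abs (P i j) ≡ Q i j) → n ℕ.≤ m → abs (box P n m - tri P n) ≤ box Q n m - tri Q n
    box-tri-abs zero    m P Q e _ = ≡⇒≤ (trans (cong abs (-‿inverseʳ 0#)) (trans (abs-≥0 ≤-refl) (sym (-‿inverseʳ 0#))))
    box-tri-abs (suc n) m P Q e p = ≤-trans (≤-respˡ (cong abs (lem _ _ _ _)) (abs-+ _ _))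
      (≤-respʳ (lem _ _ _ _) (+-mono-≤ (Σ-tail-abs (P 0) (Q 0) (e 0) (ℕP.≤⇒≤′ p)) (box-tri-abs n m _ _ (λ i → e (suc i)) (ℕP.≤-trans (ℕP.n≤1+n n) p))))
      where
      lem : ∀ a b c d → (a - b) + (c - d) ≡ (a + c) - (b + d)
      lem = solve 4 (λ a b c d → (a :- b) :+ (c :- d) := (a :+ c) :- (b :+ d)) refl

    tri-nonneg : ∀ n (P : ℕ → ℕ → ℝ) → (∀ i j → 0# ≤ P i j) → 0# ≤ tri P n
    tri-nonneg zero    P p = ≤-refl
    tri-nonneg (suc n) P p = +-nonneg (Σ-nonneg (suc n) λ j _ → p 0 j) (tri-nonneg n _ λ i → p (suc i))

    Σ-nonneg-mono : ∀ {n m} {f : ℕ → ℝ} → (∀ i → 0# ≤ f i) → n ℕ.≤′ m → Σ< n f ≤ Σ< m f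
    Σ-nonneg-mono p ℕ.≤′-refl = ≤-refl
    Σ-nonneg-mono p (ℕ.≤′-step q) = ≤-trans (Σ-nonneg-mono p q) (x≤x+y (p _))

    box≤tri : ∀ n m (P : ℕ → ℕ → ℝ) → (∀ i j → 0# ≤ P i j) → box P n m ≤ tri P (n ℕ.+ m)
    box≤tri zero    m P p = tri-nonneg m P p
    box≤tri (suc n) m P p = +-mono-≤ (Σ-nonneg-mono (p 0) (ℕP.≤⇒≤′ (ℕP.≤-trans (ℕP.m≤n+m m n) (ℕP.n≤1+n _)))) (box≤tri n m _ λ i → p (suc i))

    expSum-+-abs : ∀ x y n → abs (expSum x n * expSum y n - expSum (x + y) n) ≤ expSum (abs x) n * expSum (abs y) n - expSum (abs x + abs y) n
    expSum-+-abs x y n = subst₂ _≤_ (cong abs (cong₂ _-_ (box-expSum x y n n) (tri-expSum x y n))) (cong₂ _-_ (box-expSum _ _ n n) (tri-expSum (abs x) (abs y) n))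
      (box-tri-abs n n (prodTerm x y) (prodTerm (abs x) (abs y)) (λ i j → trans (abs-* _ _) (cong₂ _*_ (abs-term x i) (abs-term y j))) ℕP.≤-refl)

    expSum-+-≤ : ∀ x y n → 0# ≤ x → 0# ≤ y → expSum (x + y) n ≤ expSum x n * expSum y n
    expSum-+-≤ x y n p q = 0≤⇒≤ (≤-respʳ (cong₂ _-_ (cong₂ _*_ (cong (λ z → expSum z n) (abs-≥0 p)) (cong (λ z → expSum z n) (abs-≥0 q)))
        (cong (λ z → expSum z n) (cong₂ _+_ (abs-≥0 p) (abs-≥0 q)))) (≤-trans (abs-nonneg _) (expSum-+-abs x y n)))

    expSum-+-≥ : ∀ x y n → 0# ≤ x → 0# ≤ y → expSum x n * expSum y n ≤ expSum (x + y) (n ℕ.+ n)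
    expSum-+-≥ x y n p q = subst₂ _≤_ (box-expSum x y n n) (tri-expSum x y (n ℕ.+ n)) (box≤tri n n _ λ i j → *-nonneg (term-nonneg i p) (term-nonneg j q))

    expSum-nonneg : ∀ {x} n → 0# ≤ x → 0# ≤ expSum x n
    expSum-nonneg zero    p = ≤-refl
    expSum-nonneg (suc n) p = +-nonneg (expSum-nonneg n p) (term-nonneg n p)

    expSum-inc : ∀ {x} → 0# ≤ x → ∀ n → expSum x n ≤ expSum x (suc n)
    expSum-inc p n = x≤x+y (term-nonneg n p)

    expSum-mono : ∀ {x y} n → 0# ≤ x → x ≤ y → expSum x n ≤ expSum y n
    expSum-mono zero    p q = ≤-refl
    expSum-mono (suc n) p q = +-mono-≤ (expSum-mono n p q) (*-monoʳ-≤ (<⇒≤ (⁻¹-pos (fact-pos n))) (^-mono-≤ n p q))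

    term-half : ∀ k → term half (suc k) + term half (suc k) ≤ term half k
    term-half k = ≤-trans (+-mono-≤ le le) (≡⇒≤ (trans (sym (distribʳ _ _ _)) (trans (cong (_* term half k) half+half) (*-identityˡ _))))
      where
      t = term half (suc k)
      le : t ≤ half * term half k
      le = ≤-respʳ (term-suc half k) (≤-by (*-nonneg (fromℕ-nonneg k) (term-nonneg (suc k) (<⇒≤ 0<half))) (solve 2 (λ s t → (:1 :+ s) :* t :- t := s :* t) refl (fromℕ k) t))

    -- Adding `term half n` once more makes the induction work: it bounds the whole remaining tail,
    -- because each term is at most half of the preceding one.
    expSum-half : ∀ n → expSum half (suc n) + term half n ≤ 1# + 1#
    expSum-half zero    = ≡⇒≤ (cong₂ _+_ (trans (+-identityˡ _) (term-0 half)) (term-0 half))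
    expSum-half (suc n) = ≤-trans (≡⇒≤ (+-assoc _ _ _)) (≤-trans (+-mono-≤ ≤-refl (term-half n)) (expSum-half n))

    expSum-half-≤2 : ∀ n → expSum half n ≤ 1# + 1#
    expSum-half-≤2 n = ≤-trans (expSum-inc (<⇒≤ 0<half) n) (≤-trans (x≤x+y (term-nonneg n (<⇒≤ 0<half))) (expSum-half n))

    -- Partial sums are submultiplicative at nonnegative arguments, so the bound at one half spreads
    -- to its multiples, uniformly in `n`.
    expSum-halves : ∀ N n → expSum (fromℕ N * half) n ≤ (1# + 1#) ^ N
    expSum-halves zero    zero    = 0≤1
    expSum-halves zero    (suc n) = go n
      where
      tail-0 : ∀ n → term (0# * half) (suc n) ≡ 0#
      tail-0 n = trans (cong (λ z → (z * z ^ n) * fromℕ (suc n !) ⁻¹) (zeroˡ half)) (trans (cong (_* fromℕ (suc n !) ⁻¹) (zeroˡ _)) (zeroˡ _))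
      go : ∀ n → expSum (0# * half) (suc n) ≤ 1#
      go zero    = ≡⇒≤ (trans (+-identityˡ _) (term-0 (0# * half)))
      go (suc n) = ≤-trans (≡⇒≤ (trans (cong (expSum (0# * half) (suc n) +_) (tail-0 n)) (+-identityʳ _))) (go n)
    expSum-halves (suc N) n = ≤-trans (≡⇒≤ (cong (λ z → expSum z n) (solve 2 (λ a h → (:1 :+ a) :* h := h :+ a :* h) refl (fromℕ N) half)))
      (≤-trans (expSum-+-≤ half (fromℕ N * half) n (<⇒≤ 0<half) Nh)
        (*-mono-≤ (expSum-nonneg n (<⇒≤ 0<half)) (expSum-nonneg n Nh) (expSum-half-≤2 n) (expSum-halves N n)))
      where Nh = *-nonneg (fromℕ-nonneg N) (<⇒≤ 0<half)

    expSum-bounded : ∀ x → 0# ≤ x → ∃[ b ] (∀ n → expSum x n ≤ b)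
    expSum-bounded x p with archimedean (x + x)
    ... | N , q = (1# + 1#) ^ N , λ n → ≤-trans (expSum-mono n p (≤-trans (≡⇒≤ x≡) (*-monoʳ-≤ (<⇒≤ 0<half) (<⇒≤ q)))) (expSum-halves N n)
      where
      x≡ : x ≡ (x + x) * half
      x≡ = sym (trans (solve 2 (λ x h → (x :+ x) :* h := x :* (h :+ h)) refl x half) (trans (cong (x *_) half+half) (*-identityʳ x)))

    exp-conv-nonneg : ∀ {x} → 0# ≤ x → ConvergesTo (expSum x) (exp x)
    exp-conv-nonneg {x} p = the-spec (conv-mono (expSum x) (expSum-inc p) (proj₁ (expSum-bounded x p)) (proj₂ (expSum-bounded x p)))

    -- Partial sums at negative arguments are not monotone; adding those at `abs x` makes every
    -- increment nonnegative, and the limit at `abs x` is subtracted again.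
    exp-conv : ∀ x → ConvergesTo (expSum x) (exp x)
    exp-conv x = the-spec {ConvergesTo (expSum x)} (l - exp (abs x) , subst-conv)
      where
      a = λ n → expSum x n + expSum (abs x) n
      b = proj₁ (expSum-bounded (abs x) (abs-nonneg x))
      absterm : ∀ n → 0# ≤ term x n + term (abs x) n
      absterm n = ≤-by (≤⇒0≤ (-x≤abs (term x n))) (trans (cong (λ z → (term x n + z) - 0#) (sym (abs-term x n)))
        (solve 2 (λ t u → (t :+ u) :- :0 := u :- (:- t)) refl (term x n) (abs (term x n))))
      inc : ∀ n → a n ≤ a (suc n)
      inc n = ≤-by (absterm n) (solve 4 (λ p q r s → ((p :+ r) :+ (q :+ s)) :- (p :+ q) := r :+ s) refl (expSum x n) (expSum (abs x) n) (term x n) (term (abs x) n))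
      expSum≤abs : ∀ n → expSum x n ≤ expSum (abs x) n
      expSum≤abs zero = ≤-refl
      expSum≤abs (suc n) = +-mono-≤ (expSum≤abs n) (≤-trans (x≤abs _) (≡⇒≤ (abs-term x n)))
      bd : ∀ n → a n ≤ b + b
      bd n = +-mono-≤ (≤-trans (expSum≤abs n) (proj₂ (expSum-bounded _ (abs-nonneg x)) n)) (proj₂ (expSum-bounded _ (abs-nonneg x)) n)
      L = conv-mono a inc (b + b) bd
      l = proj₁ L
      limit : ConvergesTo (λ n → a n + - expSum (abs x) n) (l - exp (abs x))
      limit = conv-+ (proj₂ L) (conv-neg (exp-conv-nonneg (abs-nonneg x)))
      subst-conv : ConvergesTo (expSum x) (l - exp (abs x))
      subst-conv = conv-ext (λ n → solve 2 (λ p q → (p :+ q) :- q := p) refl (expSum x n) (expSum (abs x) n)) limit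

    -- The product of the partial sums with n terms lies between the partial sums at x + y with n
    -- and with 2n terms.
    exp-+-nonneg : ∀ {x y} → 0# ≤ x → 0# ≤ y → exp (x + y) ≡ exp x * exp y
    exp-+-nonneg {x} {y} p q = ≤-antisym
      (conv-≤-seq (exp-conv (x + y)) (conv-* (exp-conv x) (exp-conv y)) λ n → n , ℕP.≤-refl , expSum-+-≤ x y n p q)
      (conv-≤-seq (conv-* (exp-conv x) (exp-conv y)) (exp-conv (x + y)) λ n → n ℕ.+ n , ℕP.m≤m+n n n , expSum-+-≥ x y n p q)

    -- The deviation of the partial sums from multiplicativity is dominated by the same deviation at
    -- `abs x` and `abs y`, which tends to 0 by the nonnegative case.
    exp-+ : ∀ x y → exp (x + y) ≡ exp x * exp y
    exp-+ x y = sym (trans (solve 2 (λ a b → a := (a :- b) :+ b) refl (exp x * exp y) (exp (x + y))) (trans (cong (_+ exp (x + y)) diff) (+-identityˡ _)))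
      where
      a b : ℕ → ℝ
      a n = expSum x n * expSum y n - expSum (x + y) n
      b n = expSum (abs x) n * expSum (abs y) n - expSum (abs x + abs y) n
      ca : ConvergesTo a (exp x * exp y - exp (x + y))
      ca = conv-+ (conv-* (exp-conv x) (exp-conv y)) (conv-neg (exp-conv (x + y)))
      cb : ConvergesTo b 0#
      cb = subst (ConvergesTo b) (trans (cong (_- exp (abs x + abs y)) (sym (exp-+-nonneg (abs-nonneg x) (abs-nonneg y)))) (-‿inverseʳ _))
        (conv-+ (conv-* (exp-conv (abs x)) (exp-conv (abs y))) (conv-neg (exp-conv (abs x + abs y))))
      diff : exp x * exp y - exp (x + y) ≡ 0#
      diff = ≤-antisym (conv-≤-seq ca cb λ n → n , ℕP.≤-refl , ≤-trans (x≤abs _) (expSum-+-abs x y n))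
        (≤-by (conv-≤-seq (conv-const 0#) (conv-+ ca cb) λ n → n , ℕP.≤-refl , ≤-by (≤⇒0≤ (≤-trans (-x≤abs _) (expSum-+-abs x y n)))
            (solve 2 (λ a b → (a :+ b) :- :0 := b :- (:- a)) refl (a n) (b n)))
          (solve 1 (λ e → e :- :0 := e :+ :0) refl _))

    exp-≥1+x : ∀ {x} → 0# ≤ x → 1# + x ≤ exp x
    exp-≥1+x {x} p = ≤-trans (≡⇒≤ (sym (cong₂ _+_ (trans (+-identityˡ _) (term-0 x)) t1))) (conv-bound (expSum-inc p) (exp-conv x) 2)
      where
      t1 : term x 1 ≡ x
      t1 = trans (sym (*-identityˡ _)) (trans (cong (_* term x 1) (sym fromℕ-1)) (trans (term-suc x 0) (trans (cong (x *_) (term-0 x)) (*-identityʳ x))))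

    exp-0 : exp 0# ≡ 1#
    exp-0 = ≤-antisym (conv-≤ (exp-conv 0#) λ n → subst (λ z → expSum z n ≤ 1#) (zeroˡ half) (expSum-halves 0 n)) (≤-trans (≡⇒≤ (sym (+-identityʳ 1#))) (exp-≥1+x ≤-refl))

    exp-neg : ∀ x → exp x * exp (- x) ≡ 1#
    exp-neg x = trans (sym (exp-+ x (- x))) (trans (cong exp (-‿inverseʳ x)) exp-0)

    -- Nonzero because `exp (- x)` is an inverse, and nonnegative as the square of `exp (x * half)`.
    exp-pos : ∀ x → 0# < exp x
    exp-pos x with compare (exp x) 0#
    ... | tri> _ _ p = p
    ... | tri≈ _ e _ = ⊥-elim (0≢1 (trans (sym (zeroˡ _)) (trans (cong (_* exp (- x)) (sym e)) (exp-neg x))))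
    ... | tri< p _ _ = ⊥-elim (<⇒≱ p (≤-respʳ (trans (sym (exp-+ _ _)) (cong exp (trans (sym (distribˡ x half half)) (trans (cong (x *_) half+half) (*-identityʳ x))))) (sq-nonneg (exp (x * half)))))

    exp-nonneg : ∀ x → 0# ≤ exp x
    exp-nonneg x = <⇒≤ (exp-pos x)

    exp-mono : ∀ {x y} → x ≤ y → exp x ≤ exp y
    exp-mono {x} {y} p = ≤-trans (≤-by (*-nonneg (exp-nonneg x) (≤⇒0≤ p)) (solve 2 (λ e z → e :* (:1 :+ z) :- e := e :* z) refl (exp x) (y - x)))
      (≤-trans (*-monoˡ-≤ (exp-nonneg x) (exp-≥1+x (≤⇒0≤ p)))
       (≡⇒≤ (trans (sym (exp-+ x (y - x))) (cong exp (solve 2 (λ x y → x :+ (y :- x) := y) refl x y)))))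

    exp-≤1 : ∀ {x} → x ≤ 0# → exp x ≤ 1#
    exp-≤1 p = ≤-respʳ exp-0 (exp-mono p)

    -- Expanding `exp (z * q p)` turns the left side into a series in the moments of `w`; with
    -- moments of growth `B ^ k` the bounds add up to the series at `B * abs z`. The comparison is
    -- made for partial sums, so only finite sums are interchanged.
    exp-moments : ∀ n (w q : ℕ → ℝ) z D B → 0# ≤ D → 0# ≤ B → (∀ k → abs (Σ< n (λ p → w p * q p ^ k)) ≤ D * B ^ k) →
      abs (Σ< n (λ p → w p * exp (z * q p))) ≤ D * exp (B * abs z)
    exp-moments n w q z D B 0≤D 0≤B h = abs-≤
      (conv-≤ conv λ N → ≤-trans (x≤abs _) (bound N)) (conv-≤ (conv-neg conv) λ N → ≤-trans (-x≤abs _) (bound N))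
      where
      s : ℕ → ℝ
      s N = Σ< n (λ p → w p * expSum (z * q p) N)
      conv : ConvergesTo s (Σ< n (λ p → w p * exp (z * q p)))
      conv = conv-Σ n λ p → conv-* (conv-const (w p)) (exp-conv (z * q p))
      0≤Bz : 0# ≤ B * abs z
      0≤Bz = *-nonneg 0≤B (abs-nonneg z)
      step : ∀ N → abs (Σ< n (λ p → w p * term (z * q p) N)) ≤ D * term (B * abs z) N
      step N =
        abs (Σ< n (λ p → w p * term (z * q p) N)) ≡⟨ cong abs (trans (Σ-ext n λ p → trans (cong (λ y → w p * (y * i)) (*-^ z (q p) N)) (solve 4 (λ w a b i → w :* ((a :* b) :* i) := (a :* i) :* (w :* b)) refl (w p) (z ^ N) (q p ^ N) i)) (Σ-*ˡ n (z ^ N * i) _)) ⟩≤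
        abs (z ^ N * i * Σ< n (λ p → w p * q p ^ N)) ≡⟨ trans (abs-* _ _) (cong (_* abs (Σ< n (λ p → w p * q p ^ N))) (abs-term z N)) ⟩≤
        term (abs z) N * abs (Σ< n (λ p → w p * q p ^ N)) ≤⟨ *-monoˡ-≤ (term-nonneg N (abs-nonneg z)) (h N) ⟩
        term (abs z) N * (D * B ^ N) ≡⟨ trans (solve 4 (λ a i d b → (a :* i) :* (d :* b) := d :* ((b :* a) :* i)) refl (abs z ^ N) i D (B ^ N)) (cong (λ y → D * (y * i)) (sym (*-^ B (abs z) N))) ⟩≤
        D * term (B * abs z) N □
        where i = fromℕ (N !) ⁻¹
      bound' : ∀ N → abs (s N) ≤ D * expSum (B * abs z) N
      bound' zero = ≡⇒≤ (trans (cong abs (Σ-0 n λ p _ → zeroʳ (w p))) (trans (abs-≥0 ≤-refl) (sym (zeroʳ D))))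
      bound' (suc N) =
        abs (s (suc N)) ≡⟨ cong abs (trans (Σ-ext n λ p → distribˡ (w p) _ _) (Σ-+ n _ _)) ⟩≤
        abs (s N + Σ< n (λ p → w p * term (z * q p) N)) ≤⟨ abs-+ _ _ ⟩
        abs (s N) + abs (Σ< n (λ p → w p * term (z * q p) N)) ≤⟨ +-mono-≤ (bound' N) (step N) ⟩
        D * expSum (B * abs z) N + D * term (B * abs z) N ≡⟨ sym (distribˡ D _ _) ⟩≤
        D * expSum (B * abs z) (suc N) □
      bound : ∀ N → abs (s N) ≤ D * exp (B * abs z)
      bound N = ≤-trans (bound' N) (*-monoˡ-≤ 0≤D (conv-bound (expSum-inc 0≤Bz) (exp-conv (B * abs z)) N))

  -- Square roots, the Gaussian kernel by coordinates, and the packing of centres.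

  module Geometry where

    open Reals
    open Sums
    open Analysis
    open import Data.List using (map)
    open import Data.Vec using (toList; zipWith)

    <-sq : ∀ {x y} → 0# ≤ x → x < y → x * x < y * y
    <-sq {x} {y} p q = <-by (*-pos (<⇒0< q) (≤-<-trans (≤-respˡ (+-identityˡ 0#) (+-mono-≤ p p)) (+-mono-≤-< (≤-refl {x}) q))) (solve 2 (λ x y → y :* y :- x :* x := (y :- x) :* (x :+ y)) refl x y)

    -- The root is the supremum of the `y` with `y * y ≤ a`; if its square missed `a` on either
    -- side, a small move would contradict the supremum.
    sqrt-exists : ∀ a → 0# ≤ a → ∃[ y ] 0# ≤ y × y * y ≡ a
    sqrt-exists a 0≤a = s , 0≤s , root
      where
      S : ℝ → Set
      S y = 0# ≤ y × y * y ≤ a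
      bounded : IsUpperBound S (1# + a)
      bounded y (0≤y , yy≤a) with <-or-≥ (1# + a) y
      ... | inj₂ q = q
      ... | inj₁ q = ⊥-elim (<⇒≱ (<-≤-trans (<-≤-trans (<-by 0<1 (solve 1 (λ a → (:1 :+ a) :- a := :1) refl a)) (≤-by (*-nonneg 0≤a (+-nonneg 0≤1 0≤a))
          (solve 1 (λ a → (:1 :+ a) :* (:1 :+ a) :- (:1 :+ a) := a :* (:1 :+ a)) refl a))) (<⇒≤ (<-sq (+-nonneg 0≤1 0≤a) q))) yy≤a)
      sup = complete S (0# , ≤-refl , ≤-respˡ (sym (zeroˡ 0#)) 0≤a) (1# + a , bounded)
      s = proj₁ sup
      ub = proj₁ (proj₂ sup)
      approx = proj₂ (proj₂ sup)
      0≤s : 0# ≤ s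
      0≤s = ub 0# (≤-refl , ≤-respˡ (sym (zeroˡ 0#)) 0≤a)
      ¬small : ¬ (s * s < a)
      ¬small p = <⇒≱ (<-by 0<δ (solve 2 (λ s d → (s :+ d) :- s := d) refl s δ)) (ub (s + δ) (+-nonneg 0≤s (<⇒≤ 0<δ) , fits))
        where
        -- For `δ ≤ 1` the square of `s + δ` exceeds that of `s` by at most `δ * k`.
        k = s + s + 1#
        0<k : 0# < k
        0<k = subst (0# <_) (+-comm 1# (s + s)) (+-pos-nonneg 0<1 (+-nonneg 0≤s 0≤s))
        m = pos-min 0<1 (*-pos (<⇒0< p) (⁻¹-pos 0<k))
        δ = proj₁ m
        0<δ = proj₁ (proj₂ m)
        δ≤1 = proj₁ (proj₂ (proj₂ m))
        kδ≤ : δ * k ≤ a - s * s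
        kδ≤ = ≤-trans (*-monoʳ-≤ (<⇒≤ 0<k) (proj₂ (proj₂ (proj₂ m)))) (≡⇒≤ (trans (*-assoc _ _ _) (trans (cong ((a - s * s) *_) (*-inverseˡ k (>⇒≢ 0<k))) (*-identityʳ _))))
        fits : (s + δ) * (s + δ) ≤ a
        fits = ≤-by (+-nonneg (≤⇒0≤ kδ≤) (*-nonneg (<⇒≤ 0<δ) (≤⇒0≤ δ≤1)))
          (solve 3 (λ s d a → a :- (s :+ d) :* (s :+ d) := ((a :- s :* s) :- d :* (s :+ s :+ :1)) :+ d :* (:1 :- d)) refl s δ a)
      ¬large : ¬ (a < s * s)
      ¬large p = <⇒≱ (<-≤-trans (≤-<-trans a≤bb (<-sq 0≤b (proj₂ (proj₂ y)))) (proj₂ (proj₁ (proj₂ y)))) ≤-refl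
        where
        0<s : 0# < s
        0<s with 0≤s
        ... | inj₁ q = q
        ... | inj₂ e = ⊥-elim (<⇒≱ p (≤-respˡ (trans (sym (zeroˡ 0#)) (cong₂ _*_ e e)) 0≤a))
        i = s ⁻¹ * half
        0<i : 0# < i
        0<i = *-pos (⁻¹-pos 0<s) 0<half
        δ = (s * s - a) * i
        0<δ : 0# < δ
        0<δ = *-pos (<⇒0< p) 0<i
        -- A Newton step: `b * b` equals `a + δ * δ`, so no element of `S` lies above `b`.
        b = s - δ
        2si : (s + s) * i ≡ 1#
        2si = trans (solve 3 (λ s u h → (s :+ s) :* (u :* h) := (s :* u) :* (h :+ h)) refl s (s ⁻¹) half) (trans (cong₂ _*_ (*-inverse s (>⇒≢ 0<s)) half+half) (*-identityʳ 1#))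
        2sδ : (s + s) * δ ≡ s * s - a
        2sδ = trans (solve 3 (λ s x i → (s :+ s) :* (x :* i) := x :* ((s :+ s) :* i)) refl s (s * s - a) i) (trans (cong ((s * s - a) *_) 2si) (*-identityʳ _))
        0≤b : 0# ≤ b
        0≤b = *-cancelˡ-≤ (<-≤-trans 0<s (x≤x+y 0≤s)) (≤-by (+-nonneg (sq-nonneg s) 0≤a)
          (trans (solve 2 (λ s d → (s :+ s) :* (s :- d) :- (s :+ s) :* :0 := (s :+ s) :* s :- (s :+ s) :* d) refl s δ) (trans (cong (λ z → (s + s) * s - z) 2sδ) (solve 2 (λ s a → (s :+ s) :* s :- (s :* s :- a) := s :* s :+ a) refl s a))))
        a≤bb : a ≤ b * b
        a≤bb = ≤-by (sq-nonneg δ) (trans (solve 3 (λ s d a → (s :- d) :* (s :- d) :- a := ((s :* s :- a) :- (s :+ s) :* d) :+ d :* d) refl s δ a)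
          (trans (cong (λ z → ((s * s - a) - z) + δ * δ) 2sδ) (solve 2 (λ x y → (x :- x) :+ y := y) refl (s * s - a) (δ * δ))))
        y : ∃[ y ] S y × b < y
        y = approx b (<-by 0<δ (solve 2 (λ s d → s :- (s :- d) := d) refl s δ))
      root : s * s ≡ a
      root = ≤-antisym (≮⇒≥ ¬large) (≮⇒≥ ¬small)

    sqrt-sq : ∀ a → 0# ≤ a → sqrt a ^ 2 ≡ a
    sqrt-sq a p = trans (cong (sqrt a *_) (*-identityʳ _)) (proj₂ (the-spec {λ y → 0# ≤ y × y * y ≡ a} (sqrt-exists a p)))

    sumsq : ∀ {d} → Vec ℝ d → ℝ
    sumsq v = sumℝ (map (_^ 2) (toList v))

    ^2-nonneg : ∀ x → 0# ≤ x ^ 2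
    ^2-nonneg x = ≤-respʳ (cong (x *_) (sym (*-identityʳ x))) (sq-nonneg x)

    sumsq-nonneg : ∀ {d} (v : Vec ℝ d) → 0# ≤ sumsq v
    sumsq-nonneg []      = ≤-refl
    sumsq-nonneg (x ∷ v) = +-nonneg (^2-nonneg x) (sumsq-nonneg v)

    exp-sumsq : ∀ {d} (x p : Vec ℝ d) → exp (- sumsq (zipWith _-_ x p)) ≡ ΠF (λ k → exp (- ((lookup x k - lookup p k) * (lookup x k - lookup p k))))
    exp-sumsq []      []      = trans (cong exp (solve 0 (:- :0 := :0) refl)) exp-0
    exp-sumsq (a ∷ x) (b ∷ p) = trans (cong exp (solve 2 (λ u s → :- (u :* (u :* :1) :+ s) := (:- (u :* u)) :+ (:- s)) refl (a - b) (sumsq (zipWith _-_ x p))))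
      (trans (exp-+ _ _) (cong (exp (- ((a - b) * (a - b))) *_) (exp-sumsq x p)))

    kernel-product : ∀ {d} (x p : Vec ℝ d) → exp (- (norm (zipWith _-_ x p) ^ 2)) ≡ ΠF (λ k → exp (- ((lookup x k - lookup p k) * (lookup x k - lookup p k))))
    kernel-product x p = trans (cong (λ z → exp (- z)) (sqrt-sq _ (sumsq-nonneg (zipWith _-_ x p)))) (exp-sumsq x p)

    -- Induction on the dimension. The first coordinate is expanded by `exp-moments`, with the
    -- product over the others as part of the weight; for its `j`-th moment the factor
    -- `q zero p ^ j` moves into the weight of the induction hypothesis, and `D` becomes
    -- `D * B ^ j`.
    exp-moments-product : ∀ {d} n (w : ℕ → ℝ) (g q : Fin d → ℕ → ℝ) (z : Fin d → ℝ) D B → 0# ≤ D → 0# ≤ B →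
      (∀ (α : Vec ℕ d) → abs (Σ< n (λ p → w p * ΠF (λ k → g k p * q k p ^ lookup α k))) ≤ D * ΠF (λ k → B ^ lookup α k)) →
      abs (Σ< n (λ p → w p * ΠF (λ k → g k p * exp (z k * q k p)))) ≤ D * ΠF (λ k → exp (B * abs (z k)))
    exp-moments-product {zero}  n w g q z D B 0≤D 0≤B h = h []
    exp-moments-product {suc d} n w g q z D B 0≤D 0≤B h =
      abs (Σ< n (λ p → w p * (g zero p * exp (z zero * q zero p) * R p))) ≡⟨ cong abs (Σ-ext n λ p → solve 4 (λ w g e r → w :* (g :* e :* r) := (w :* g :* r) :* e) refl (w p) (g zero p) (exp (z zero * q zero p)) (R p)) ⟩≤
      abs (Σ< n (λ p → (w p * g zero p * R p) * exp (z zero * q zero p))) ≤⟨ exp-moments n (λ p → w p * g zero p * R p) (q zero) (z zero) D' B (*-nonneg 0≤D (ΠF-nonneg {d} λ k → exp-nonneg _)) 0≤B moments ⟩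
      D' * exp (B * abs (z zero)) ≡⟨ solve 3 (λ d r e → d :* r :* e := d :* (e :* r)) refl D (ΠF (λ k → exp (B * abs (z (suc k))))) (exp (B * abs (z zero))) ⟩≤
      D * ΠF (λ k → exp (B * abs (z k))) □
      where
      R : ℕ → ℝ
      R p = ΠF (λ k → g (suc k) p * exp (z (suc k) * q (suc k) p))
      D' = D * ΠF (λ k → exp (B * abs (z (suc k))))
      moments : ∀ j → abs (Σ< n (λ p → (w p * g zero p * R p) * q zero p ^ j)) ≤ D' * B ^ j
      moments j =
        abs (Σ< n (λ p → (w p * g zero p * R p) * q zero p ^ j)) ≡⟨ cong abs (Σ-ext n λ p → solve 4 (λ w g r e → (w :* g :* r) :* e := (w :* (g :* e)) :* r) refl (w p) (g zero p) (R p) (q zero p ^ j)) ⟩≤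
        abs (Σ< n (λ p → (w p * (g zero p * q zero p ^ j)) * R p)) ≤⟨ exp-moments-product n (λ p → w p * (g zero p * q zero p ^ j)) (λ k → g (suc k)) (λ k → q (suc k)) (λ k → z (suc k)) (D * B ^ j) B
            (*-nonneg 0≤D (^-nonneg j 0≤B)) 0≤B (λ α → subst₂ _≤_
              (cong abs (Σ-ext n λ p → solve 3 (λ w u v → w :* (u :* v) := (w :* u) :* v) refl (w p) (g zero p * q zero p ^ j) _)) (sym (*-assoc _ _ _)) (h (j ∷ α))) ⟩
        (D * B ^ j) * ΠF (λ k → exp (B * abs (z (suc k)))) ≡⟨ solve 3 (λ d b r → d :* b :* r := d :* r :* b) refl D (B ^ j) _ ⟩≤
        D' * B ^ j □

    𝟙 : Set → ℝ
    𝟙 A = if does (em A) then 1# else 0#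

    𝟙-true : ∀ {A} → A → 𝟙 A ≡ 1#
    𝟙-true {A} a with em A
    ... | yes _ = refl
    ... | no ¬a = ⊥-elim (¬a a)

    𝟙-false : ∀ {A} → ¬ A → 𝟙 A ≡ 0#
    𝟙-false {A} ¬a with em A
    ... | yes a = ⊥-elim (¬a a)
    ... | no _ = refl

    𝟙-cases : ∀ A → (A × 𝟙 A ≡ 1#) ⊎ (¬ A × 𝟙 A ≡ 0#)
    𝟙-cases A with em A
    ... | yes a = inj₁ (a , refl)
    ... | no ¬a = inj₂ (¬a , refl)

    𝟙-nonneg : ∀ A → 0# ≤ 𝟙 A
    𝟙-nonneg A with 𝟙-cases A
    ... | inj₁ (_ , e) = ≤-respʳ (sym e) 0≤1
    ... | inj₂ (_ , e) = ≡⇒≤ (sym e)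

    -- The hypothesis on pairs expresses absurdity by `0# < 0#`.
    at-most-one : ∀ n (S : ℕ → Set) → (∀ c c' → c ≢ c' → S c → S c' → 0# < 0#) → Σ< n (λ c → 𝟙 (S c)) ≤ 1#
    at-most-one zero    S u = 0≤1
    at-most-one (suc n) S u with 𝟙-cases (S n)
    ... | inj₁ (s , e) = ≡⇒≤ (trans (cong₂ _+_ (Σ-0 n λ i i<n → 𝟙-false λ si → irrefl refl (u i n (ℕP.<⇒≢ i<n) si s)) e) (+-identityˡ 1#))
    ... | inj₂ (_ , e) = ≤-trans (≡⇒≤ (trans (cong (Σ< n (λ c → 𝟙 (S c)) +_) e) (+-identityʳ _))) (at-most-one n S u)

    floor : ∀ J u → 0# ≤ u → u < fromℕ J → ∃[ j ] j ℕ.< J × fromℕ j ≤ u × u < fromℕ (suc j)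
    floor zero    u p q = ⊥-elim (<⇒≱ q p)
    floor (suc J) u p q with <-or-≥ u (fromℕ J)
    ... | inj₂ r = J , ℕP.≤-refl , r , q
    ... | inj₁ r with floor J u p r
    ... | j , j<J , a , b = j , ℕP.m<n⇒m<1+n j<J , a , b

    exp-floor : ∀ j u → fromℕ j ≤ u → exp (- u) ≤ half ^ j
    exp-floor j u p = ≤-trans (exp-mono (neg-mono-≤ p)) (go j)
      where
      exp-1 : exp (- 1#) ≤ half
      exp-1 = *-cancelˡ-≤ (exp-pos 1#) (≤-respˡ (sym (exp-neg 1#)) (≤-trans (≡⇒≤ (sym (*-inverse _ (>⇒≢ 0<2)))) (*-monoʳ-≤ (<⇒≤ 0<half) (exp-≥1+x 0≤1))))
      go : ∀ j → exp (- fromℕ j) ≤ half ^ j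
      go zero    = ≡⇒≤ (trans (cong exp (solve 0 (:- :0 := :0) refl)) exp-0)
      go (suc j) = ≤-respˡ (trans (sym (exp-+ _ _)) (cong exp (solve 1 (λ j → (:- :1) :+ (:- j) := :- (:1 :+ j)) refl (fromℕ j))))
        (*-mono-≤ (exp-nonneg _) (exp-nonneg _) exp-1 (go j))

    -- Proved with an exact remainder: the partial sum plus `fromℕ 4 * half ^ J` stays 4. The
    -- doubled term accounts for the two slabs at distance `j` in `packing`.
    geometric : ∀ J → Σ< J (λ j → half ^ j + half ^ j) ≤ fromℕ 4
    geometric J = ≤-trans (x≤x+y (*-nonneg (fromℕ-nonneg 4) (^-nonneg J (<⇒≤ 0<half)))) (≡⇒≤ (go J))
      where
      go : ∀ J → Σ< J (λ j → half ^ j + half ^ j) + fromℕ 4 * half ^ J ≡ fromℕ 4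
      go zero    = trans (+-identityˡ _) (*-identityʳ _)
      go (suc J) = trans (solve 3 (λ s u h → (s :+ (u :+ u)) :+ (:1 :+ (:1 :+ (:1 :+ (:1 :+ :0)))) :* (h :* u) := s :+ (:2 :+ :2 :* (h :+ h)) :* u) refl (Σ< J (λ j → half ^ j + half ^ j)) (half ^ J) half)
        (trans (cong (λ z → Σ< J (λ j → half ^ j + half ^ j) + ((1# + 1#) + (1# + 1#) * z) * half ^ J) half+half)
        (trans (cong (Σ< J (λ j → half ^ j + half ^ j) +_) (cong (_* half ^ J) (solve 0 (:2 :+ :2 :* :1 := (:1 :+ (:1 :+ (:1 :+ (:1 :+ :0))))) refl))) (go J)))

    close-sq : ∀ {a b l} → l ≤ a → a < 1# + l → l ≤ b → b < 1# + l → (a - b) * (a - b) ≤ 1#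
    close-sq {a} {b} {l} p q r s = ≤-by (*-nonneg (+-nonneg (≤⇒0≤ p) (≤⇒0≤ (<⇒≤ s))) (+-nonneg (≤⇒0≤ (<⇒≤ q)) (≤⇒0≤ r)))
      (solve 3 (λ a b l → :1 :- (a :- b) :* (a :- b) := ((a :- l) :+ ((:1 :+ l) :- b)) :* (((:1 :+ l) :- a) :+ (b :- l))) refl a b l)

    -- Distance above 1 in the sup norm, with a coordinate as witness; the square is what the
    -- program compares with 1.
    Separated : ∀ {d} → (ℕ → Set) → (ℕ → Fin d → ℝ) → Set
    Separated S y = ∀ c c' → c ≢ c' → S c → S c' → ∃[ k ] 1# < (y c k - y c' k) * (y c k - y c' k)

    packing : ∀ {d} n (S : ℕ → Set) (y : ℕ → Fin d → ℝ) → Separated S y →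
      Σ< n (λ c → 𝟙 (S c) * ΠF (λ k → exp (- abs (y c k)))) ≤ fromℕ 4 ^ d
    packing {zero}  n S y sep = ≤-trans (≡⇒≤ (Σ-ext n λ c → *-identityʳ _)) (at-most-one n S λ c c' c≢c' s s' → no-index (proj₁ (sep c c' c≢c' s s')))
      where
      no-index : Fin 0 → 0# < 0#
      no-index ()
    packing {suc d} n S y sep =
      Σ< n (λ c → 𝟙 (S c) * (exp (- abs (t c)) * r c)) ≤⟨ Σ-mono-≤ n pointwise ⟩
      Σ< n (λ c → Σ< J (λ j → slabs j c)) ≡⟨ Σ-swap n J (λ c j → slabs j c) ⟩≤
      Σ< J (λ j → Σ< n (slabs j)) ≤⟨ Σ-mono-≤ J (λ j _ → each j) ⟩
      Σ< J (λ j → (half ^ j + half ^ j) * fromℕ 4 ^ d) ≡⟨ Σ-*ʳ J (fromℕ 4 ^ d) _ ⟩≤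
      Σ< J (λ j → half ^ j + half ^ j) * fromℕ 4 ^ d ≤⟨ *-monoʳ-≤ (^-nonneg d (fromℕ-nonneg 4)) (geometric J) ⟩
      fromℕ 4 * fromℕ 4 ^ d □
      where
      t : ℕ → ℝ
      t c = y c zero
      y' : ℕ → Fin d → ℝ
      y' c k = y c (suc k)
      r : ℕ → ℝ
      r c = ΠF (λ k → exp (- abs (y' c k)))
      0≤r : ∀ c → 0# ≤ r c
      0≤r c = ΠF-nonneg {d} λ k → exp-nonneg _
      P N : ℕ → ℕ → Set
      P j c = S c × fromℕ j ≤ t c × t c < 1# + fromℕ j
      N j c = S c × fromℕ j ≤ - t c × - t c < 1# + fromℕ j
      slabs : ℕ → ℕ → ℝ
      slabs j c = half ^ j * (𝟙 (P j c) * r c + 𝟙 (N j c) * r c)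
      -- The sum stands in for the maximum of the finitely many values `abs (t c)`.
      J = proj₁ (archimedean (Σ< n (λ c → abs (t c))))
      0≤h : ∀ j → 0# ≤ half ^ j
      0≤h j = ^-nonneg j (<⇒≤ 0<half)
      slabs-nonneg : ∀ j c → 0# ≤ slabs j c
      slabs-nonneg j c = *-nonneg (0≤h j) (+-nonneg (*-nonneg (𝟙-nonneg _) (0≤r c)) (*-nonneg (𝟙-nonneg _) (0≤r c)))
      sepP : ∀ j → Separated (P j) y'
      sepP j c c' c≢c' (s , lo , hi) (s' , lo' , hi') with sep c c' c≢c' s s'
      ... | zero  , q = ⊥-elim (<⇒≱ q (close-sq lo hi lo' hi'))
      ... | suc k , q = k , q
      sepN : ∀ j → Separated (N j) y'
      sepN j c c' c≢c' (s , lo , hi) (s' , lo' , hi') with sep c c' c≢c' s s'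
      ... | zero  , q = ⊥-elim (<⇒≱ q (≤-respˡ (solve 2 (λ a b → ((:- a) :- (:- b)) :* ((:- a) :- (:- b)) := (a :- b) :* (a :- b)) refl (t c) (t c')) (close-sq lo hi lo' hi')))
      ... | suc k , q = k , q
      each : ∀ j → Σ< n (slabs j) ≤ (half ^ j + half ^ j) * fromℕ 4 ^ d
      each j =
        Σ< n (slabs j) ≡⟨ trans (Σ-*ˡ n (half ^ j) _) (cong (half ^ j *_) (Σ-+ n _ _)) ⟩≤
        half ^ j * (Σ< n (λ c → 𝟙 (P j c) * r c) + Σ< n (λ c → 𝟙 (N j c) * r c)) ≤⟨ *-monoˡ-≤ (0≤h j) (+-mono-≤ (packing n (P j) y' (sepP j)) (packing n (N j) y' (sepN j))) ⟩
        half ^ j * (fromℕ 4 ^ d + fromℕ 4 ^ d) ≡⟨ solve 2 (λ h f → h :* (f :+ f) := (h :+ h) :* f) refl (half ^ j) (fromℕ 4 ^ d) ⟩≤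
        (half ^ j + half ^ j) * fromℕ 4 ^ d □
      pointwise : ∀ c → c ℕ.< n → 𝟙 (S c) * (exp (- abs (t c)) * r c) ≤ Σ< J (λ j → slabs j c)
      pointwise c c<n with 𝟙-cases (S c)
      ... | inj₂ (_ , e) = ≤-respˡ (sym (trans (cong (_* (exp (- abs (t c)) * r c)) e) (zeroˡ _))) (Σ-nonneg J λ j _ → slabs-nonneg j c)
      ... | inj₁ (s , e) with floor J (abs (t c)) (abs-nonneg _) (≤-<-trans (term≤Σ n (λ i _ → abs-nonneg (t i)) c c<n) (proj₂ (archimedean (Σ< n (λ c → abs (t c))))))
      ... | j , j<J , lo , hi = ≤-trans (≡⇒≤ (trans (cong (_* (exp (- abs (t c)) * r c)) e) (*-identityˡ _)))
        (≤-trans (*-mono-≤ (exp-nonneg _) (0≤r c) (exp-floor j _ lo) hit) (term≤Σ J (λ i _ → slabs-nonneg i c) j j<J))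
        where
        hit : r c ≤ 𝟙 (P j c) * r c + 𝟙 (N j c) * r c
        hit with ≤-total 0# (t c)
        ... | inj₁ p = ≤-trans (≡⇒≤ (sym (trans (cong (_* r c) (𝟙-true (s , ≤-respʳ (abs-≥0 p) lo , <-respˡ (abs-≥0 p) hi))) (*-identityˡ _)))) (x≤x+y (*-nonneg (𝟙-nonneg _) (0≤r c)))
        ... | inj₂ p = ≤-trans (≡⇒≤ (sym (trans (cong (_* r c) (𝟙-true (s , ≤-respʳ (abs-≤0 p) lo , <-respˡ (abs-≤0 p) hi))) (*-identityˡ _)))) (y≤x+y (*-nonneg (𝟙-nonneg _) (0≤r c)))

    -- With u = |z| and C = B + 1 the exponents differ by C² - C u + u², which is 3/4 C² plus the
    -- square of u - C/2.
    gauss-tail : ∀ B z → 0# ≤ B → exp (- (z * z)) * exp (B * abs z) ≤ exp ((B + 1#) * (B + 1#)) * exp (- abs z)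
    gauss-tail B z 0≤B = ≤-respˡ (exp-+ _ _) (≤-respʳ (exp-+ _ _) (exp-mono (≤-by (+-nonneg (*-nonneg c≥0 (sq-nonneg C)) (sq-nonneg _)) eq)))
      where
      u = abs z
      C = B + 1#
      c≥0 : 0# ≤ half + half * half
      c≥0 = +-nonneg (<⇒≤ 0<half) (*-nonneg (<⇒≤ 0<half) (<⇒≤ 0<half))
      zz : z * z ≡ u * u
      zz = trans (sym (abs-≥0 (sq-nonneg z))) (abs-* z z)
      h4 : half * half + half * half ≡ half
      h4 = trans (sym (distribˡ half half half)) (trans (cong (half *_) half+half) (*-identityʳ half))
      eq : (C * C + - u) - (- (z * z) + B * u) ≡ (half + half * half) * (C * C) + (u - half * C) * (u - half * C)
      eq = trans (cong (λ w → (C * C + - u) - (- w + B * u)) zz) (trans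
        (solve 2 (λ b u → ((b :+ :1) :* (b :+ :1) :+ (:- u)) :- ((:- (u :* u)) :+ b :* u) := (b :+ :1) :* (b :+ :1) :* :1 :- :1 :* u :* (b :+ :1) :+ u :* u) refl B u)
        (trans (cong₂ (λ p q → C * C * p - q * u * C + u * u) (trans (sym half+half) (cong (half +_) (sym h4))) (sym half+half))
        (solve 3 (λ c h u → c :* c :* (h :+ (h :* h :+ h :* h)) :- (h :+ h) :* u :* c :+ u :* u := (h :+ h :* h) :* (c :* c) :+ (u :- h :* c) :* (u :- h :* c)) refl C half u)))

  -- Orthogonal projections and their traces.

  module Projection where

    open Reals
    open Sums

    -- Definitionally the value of the expression `lt`, which makes the lemmas below applicable to
    -- evaluated programs.
    lt01 : ℝ → ℝ → ℝ
    lt01 a b = if does (a <? b) then 1# else 0#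

    lt01-true : ∀ {a b} → a < b → lt01 a b ≡ 1#
    lt01-true {a} {b} p with a <? b
    ... | yes _ = refl
    ... | no ¬p = ⊥-elim (¬p p)

    lt01-false : ∀ {a b} → b ≤ a → lt01 a b ≡ 0#
    lt01-false {a} {b} p with a <? b
    ... | yes q = ⊥-elim (<⇒≱ q p)
    ... | no _ = refl

    lt01-cases : ∀ a b → (a < b × lt01 a b ≡ 1#) ⊎ (b ≤ a × lt01 a b ≡ 0#)
    lt01-cases a b with <-or-≥ a b
    ... | inj₁ p = inj₁ (p , lt01-true p)
    ... | inj₂ p = inj₂ (p , lt01-false p)

    lt01-nonneg : ∀ a b → 0# ≤ lt01 a b
    lt01-nonneg a b with lt01-cases a b
    ... | inj₁ (_ , e) = ≤-respʳ (sym e) 0≤1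
    ... | inj₂ (_ , e) = ≡⇒≤ (sym e)

    module Projections (n : ℕ) where

      Matrix : Set
      Matrix = ℕ → ℕ → ℝ

      app : Matrix → (ℕ → ℝ) → ℕ → ℝ
      app u a i = Σ< n (λ q → u i q * a q)

      dot : (ℕ → ℝ) → (ℕ → ℝ) → ℝ
      dot a b = Σ< n (λ q → a q * b q)

      Kills : Matrix → (ℕ → ℝ) → Set
      Kills u a = ∀ i → i ℕ.< n → app u a i ≡ 0#

      trace : Matrix → ℝ
      trace u = Σ< n (λ i → u i i)

      record IsProjection (u : Matrix) : Set where
        field
          symm : ∀ i j → u i j ≡ u j i
          idem : ∀ i j → i ℕ.< n → j ℕ.< n → Σ< n (λ k → u i k * u k j) ≡ u i j
      open IsProjection public

      -- The projection onto the part of the range of u orthogonal to a; it is u itself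
      -- if u a = 0, because 0⁻¹ = 0.
      restrict : Matrix → (ℕ → ℝ) → Matrix
      restrict u a i j = u i j - (app u a i * app u a j) * (1# * (dot (app u a) (app u a)) ⁻¹)

      app-cong : ∀ u {a b} → (∀ q → q ℕ.< n → a q ≡ b q) → ∀ i → app u a i ≡ app u b i
      app-cong u e i = Σ-cong n λ q q<n → cong (u i q *_) (e q q<n)

      app-self-adjoint : ∀ {u} → IsProjection u → ∀ a b → dot (app u a) b ≡ dot a (app u b)
      app-self-adjoint {u} P a b = begin
        Σ< n (λ i → Σ< n (λ j → u i j * a j) * b i)     ≡⟨ Σ-ext n (λ i → sym (Σ-*ʳ n (b i) _)) ⟩
        Σ< n (λ i → Σ< n (λ j → u i j * a j * b i))     ≡⟨ Σ-swap n n _ ⟩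
        Σ< n (λ j → Σ< n (λ i → u i j * a j * b i))     ≡⟨ Σ-ext n (λ j → trans (Σ-ext n (λ i → trans (cong (λ z → z * a j * b i) (symm P i j)) (solve 3 (λ u a b → u :* a :* b := a :* (u :* b)) refl (u j i) (a j) (b i)))) (Σ-*ˡ n (a j) _)) ⟩
        Σ< n (λ j → a j * Σ< n (λ i → u j i * b i))     ∎
        where open ≡-Reasoning

      app-idem : ∀ {u} → IsProjection u → ∀ a i → i ℕ.< n → app u (app u a) i ≡ app u a i
      app-idem {u} P a i i<n = begin
        Σ< n (λ k → u i k * Σ< n (λ j → u k j * a j))   ≡⟨ Σ-ext n (λ k → sym (Σ-*ˡ n (u i k) _)) ⟩
        Σ< n (λ k → Σ< n (λ j → u i k * (u k j * a j))) ≡⟨ Σ-swap n n _ ⟩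
        Σ< n (λ j → Σ< n (λ k → u i k * (u k j * a j))) ≡⟨ Σ-cong n (λ j j<n → trans (Σ-ext n (λ k → sym (*-assoc _ _ _))) (trans (Σ-*ʳ n (a j) _) (cong (_* a j) (idem P i j i<n j<n)))) ⟩
        Σ< n (λ j → u i j * a j)                        ∎
        where open ≡-Reasoning

      module Restrict (u : Matrix) (P : IsProjection u) (a : ℕ → ℝ) where
        v : ℕ → ℝ
        v = app u a
        s r : ℝ
        s = dot v v
        -- The factor `1#` comes from evaluating `div one`.
        r = 1# * s ⁻¹

        -- A projection is self-adjoint and idempotent, so ⟨u a, a⟩ = ⟨u a, u a⟩.
        s≡ : dot v a ≡ s
        s≡ = trans (app-self-adjoint P a a) (sym (trans (app-self-adjoint P a v) (Σ-cong n λ q q<n → cong (a q *_) (app-idem P a q q<n))))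

        -- All that the idempotence of `w` has to know about `r`, and true for `s = 0` as well
        -- because the inverse of 0 is 0.
        rsr : r * s * r ≡ r
        rsr with s <? 0# | 0# <? s
        ... | _ | yes p = trans (cong (_* r) (trans (cong (_* s) (*-identityˡ _)) (*-inverseˡ s (>⇒≢ p)))) (*-identityˡ r)
        ... | yes p | _ = trans (cong (_* r) (trans (cong (_* s) (*-identityˡ _)) (*-inverseˡ s λ e → irrefl e p))) (*-identityˡ r)
        ... | no ¬p | no ¬q = trans (cong (_* r) (cong (r *_) s0)) (trans (cong (_* r) (zeroʳ r)) (trans (zeroˡ r) (sym (trans (*-identityˡ _) (trans (cong _⁻¹ s0) 0⁻¹≡0)))))
          where
          s0 : s ≡ 0#
          s0 = ≤-antisym (≮⇒≥ ¬q) (≮⇒≥ ¬p)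

        -- This also holds for s = 0, because then v = 0.
        vrs : ∀ i → i ℕ.< n → v i * r * s ≡ v i
        vrs i i<n with <-or-≥ 0# s
        ... | inj₁ p = trans (*-assoc _ _ _) (trans (cong (v i *_) (trans (cong (_* s) (*-identityˡ _)) (*-inverseˡ s (>⇒≢ p)))) (*-identityʳ _))
        ... | inj₂ p = trans (cong (λ z → z * r * s) v0) (trans (cong (_* s) (zeroˡ r)) (trans (zeroˡ s) (sym v0)))
          where
          v0 : v i ≡ 0#
          v0 with 0# <? v i | v i <? 0#
          ... | no ¬p | no ¬q = ≤-antisym (≮⇒≥ ¬p) (≮⇒≥ ¬q)
          ... | yes q | _ = ⊥-elim (<⇒≱ (sq-pos (v i) (>⇒≢ q)) (≤-trans (term≤Σ n (λ j _ → sq-nonneg (v j)) i i<n) p))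
          ... | no _ | yes q = ⊥-elim (<⇒≱ (sq-pos (v i) (λ e → irrefl e q)) (≤-trans (term≤Σ n (λ j _ → sq-nonneg (v j)) i i<n) p))

        w : Matrix
        w = restrict u a

        app-w : ∀ b i → app w b i ≡ app u b i - v i * r * dot v b
        app-w b i = trans (Σ-ext n λ q → solve 5 (λ u vi vq r b → (u :- (vi :* vq) :* r) :* b := u :* b :- (vi :* r) :* (vq :* b)) refl (u i q) (v i) (v q) r (b q))
          (trans (Σ-- n _ _) (cong (λ z → app u b i - z) (Σ-*ˡ n (v i * r) _)))

        -- As `u` is self-adjoint, `u b = 0` makes `b` orthogonal to `v`, so the correction term
        -- vanishes on `b`.
        keeps-kills : ∀ b → Kills u b → Kills w b
        keeps-kills b k i i<n = trans (app-w b i) (trans (cong₂ (λ y z → y - v i * r * z) (k i i<n) vb) (solve 1 (λ y → :0 :- y :* :0 := :0) refl (v i * r)))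
          where
          vb : dot v b ≡ 0#
          vb = trans (app-self-adjoint P a b) (Σ-0 n λ q q<n → trans (cong (a q *_) (k q q<n)) (zeroʳ _))

        kills-new : Kills w a
        kills-new i i<n = trans (app-w a i) (trans (cong (λ z → v i - v i * r * z) s≡) (trans (cong (λ z → v i - z) (vrs i i<n)) (-‿inverseʳ _)))

        w-symm : ∀ i j → w i j ≡ w j i
        w-symm i j = cong₂ _-_ (symm P i j) (cong (_* r) (*-comm _ _))

        w-idem : ∀ i j → i ℕ.< n → j ℕ.< n → Σ< n (λ k → w i k * w k j) ≡ w i j
        w-idem i j i<n j<n = begin
          Σ< n (λ k → w i k * w k j)                                            ≡⟨ Σ-ext n (λ k → solve 6 (λ a b vi vj vk r → (a :- (vi :* vk) :* r) :* (b :- (vk :* vj) :* r) := (a :* b :- (vj :* r) :* (a :* vk)) :- ((vi :* r) :* (b :* vk) :- (vi :* vj :* r :* r) :* (vk :* vk))) refl (u i k) (u k j) (v i) (v j) (v k) r) ⟩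
          Σ< n (λ k → (u i k * u k j - (v j * r) * (u i k * v k)) - ((v i * r) * (u k j * v k) - (v i * v j * r * r) * (v k * v k))) ≡⟨ trans (Σ-- n _ _) (cong₂ _-_ (Σ-- n _ _) (Σ-- n _ _)) ⟩
          (Σ< n (λ k → u i k * u k j) - Σ< n (λ k → (v j * r) * (u i k * v k))) - (Σ< n (λ k → (v i * r) * (u k j * v k)) - Σ< n (λ k → (v i * v j * r * r) * (v k * v k)))
            ≡⟨ cong₂ _-_ (cong₂ _-_ (idem P i j i<n j<n) (trans (Σ-*ˡ n (v j * r) _) (cong ((v j * r) *_) (app-idem P a i i<n))))
                         (cong₂ _-_ (trans (Σ-*ˡ n (v i * r) _) (cong ((v i * r) *_) (trans (Σ-ext n (λ k → cong (_* v k) (symm P k j))) (app-idem P a j j<n)))) (Σ-*ˡ n (v i * v j * r * r) _)) ⟩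
          (u i j - (v j * r) * v i) - ((v i * r) * v j - (v i * v j * r * r) * s) ≡⟨ solve 5 (λ u vi vj r s → (u :- (vj :* r) :* vi) :- ((vi :* r) :* vj :- (vi :* vj :* r :* r) :* s) := u :- vi :* vj :* (r :+ r :- r :* s :* r)) refl (u i j) (v i) (v j) r s ⟩
          u i j - v i * v j * (r + r - r * s * r)                               ≡⟨ cong (λ z → u i j - v i * v j * (r + r - z)) rsr ⟩
          u i j - v i * v j * (r + r - r)                                       ≡⟨ cong (λ z → u i j - v i * v j * z) (solve 1 (λ r → r :+ r :- r := r) refl r) ⟩
          w i j ∎
          where open ≡-Reasoning

        isProjection : IsProjection w
        isProjection = record { symm = w-symm ; idem = w-idem }

        trace-w : trace w ≡ trace u - s * s ⁻¹
        trace-w = trans (Σ-- n _ _) (cong (λ z → trace u - z) (trans (Σ-*ʳ n r _) (cong (s *_) (*-identityˡ _))))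

        trace-drop : trace u - 1# ≤ trace w
        trace-drop = ≤-by (≤⇒0≤ (x*x⁻¹≤1 s)) (trans (cong (_- (trace u - 1#)) trace-w) (solve 2 (λ t y → (t :- y) :- (t :- :1) := :1 :- y) refl (trace u) (s * s ⁻¹)))

        trace-keep : (∀ q → q ℕ.< n → a q ≡ 0#) → trace u ≤ trace w
        trace-keep a0 = ≡⇒≤ (sym (trans trace-w (trans (cong (λ z → trace u - z * s ⁻¹) s0) (solve 2 (λ t y → t :- :0 :* y := t) refl (trace u) (s ⁻¹)))))
          where
          s0 : s ≡ 0#
          s0 = Σ-0 n λ q _ → trans (cong (_* v q) (Σ-0 n λ j j<n → trans (cong (u q j *_) (a0 j j<n)) (zeroʳ _))) (zeroˡ _)

        -- By symmetry row `j` of `u` vanishes too, hence so does the entry of `v` at `j`. Weights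
        -- that are already 0 or 1 start with a zero column and are therefore never moved.
        support : ∀ j → (∀ i → u i j ≡ 0#) → ∀ i → w i j ≡ 0#
        support j z i = trans (cong₂ (λ x y → x - (v i * y) * r) (z i) (Σ-0 n λ q _ → trans (cong (_* a q) (trans (symm P j q) (z q))) (zeroˡ _))) (solve 2 (λ x r → :0 :- (x :* :0) :* r := :0) refl (v i) r)

      -- Kronecker's delta built from `<`, the only index test of the programs; `eqE` evaluates to
      -- it.
      eq01 : ℕ → ℕ → ℝ
      eq01 i j = (1# - (if i ℕ.<ᵇ j then 1# else 0#)) * (1# - (if j ℕ.<ᵇ i then 1# else 0#))

      diagonal : (ℕ → ℝ) → Matrix
      diagonal f i j = eq01 i j * f j

      1-0 : 1# - 0# ≡ 1#
      1-0 = solve 0 (:1 :- :0 := :1) refl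

      eq01-≡ : ∀ i → eq01 i i ≡ 1#
      eq01-≡ i with i ℕ.<ᵇ i | ℕP.<ᵇ⇒< i i
      ... | true  | p = ⊥-elim (ℕP.<-irrefl refl (p _))
      ... | false | _ = trans (cong₂ _*_ 1-0 1-0) (*-identityʳ 1#)

      eq01-≢ : ∀ {i j} → i ≢ j → eq01 i j ≡ 0#
      eq01-≢ {i} {j} i≢j with i ℕ.<ᵇ j | ℕP.<⇒<ᵇ {i} {j} | j ℕ.<ᵇ i | ℕP.<⇒<ᵇ {j} {i}
      ... | true  | _ | w    | _ = trans (cong (_* (1# - (if w then 1# else 0#))) (-‿inverseʳ 1#)) (zeroˡ _)
      ... | false | _ | true | _ = trans (cong ((1# - 0#) *_) (-‿inverseʳ 1#)) (zeroʳ _)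
      ... | false | p | false | q = ⊥-elim (i≢j (ℕP.≤-antisym (ℕP.≮⇒≥ λ z → q z) (ℕP.≮⇒≥ λ z → p z)))

      Σ-eq01 : ∀ {m} (g : ℕ → ℝ) i → i ℕ.< m → Σ< m (λ k → eq01 i k * g k) ≡ g i
      Σ-eq01 {suc m} g i i<1+m with i ℕ.≟ m
      ... | yes refl = trans (cong₂ _+_ (Σ-0 m λ k k<m → trans (cong (_* g k) (eq01-≢ λ e → ℕP.<-irrefl (sym e) k<m)) (zeroˡ _)) (trans (cong (_* g i) (eq01-≡ i)) (*-identityˡ _))) (+-identityˡ _)
      ... | no i≢m = trans (cong₂ _+_ (Σ-eq01 g i (ℕP.≤∧≢⇒< (ℕ.s≤s⁻¹ i<1+m) i≢m)) (trans (cong (_* g m) (eq01-≢ i≢m)) (zeroˡ _))) (+-identityʳ _)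

      diagonal-projection : ∀ f → (∀ i → f i * f i ≡ f i) → IsProjection (diagonal f)
      symm (diagonal-projection f h) i j with i ℕ.≟ j
      ... | yes refl = refl
      ... | no i≢j = trans (trans (cong (_* f j) (eq01-≢ i≢j)) (zeroˡ _)) (sym (trans (cong (_* f i) (eq01-≢ λ e → i≢j (sym e))) (zeroˡ _)))
      idem (diagonal-projection f h) i j i<n j<n = trans (Σ-ext n λ k → *-assoc _ _ _) (trans (Σ-eq01 (λ k → f k * diagonal f k j) i i<n) last)
        where
        last : f i * diagonal f i j ≡ diagonal f i j
        last with i ℕ.≟ j
        ... | yes refl = trans (cong (f i *_) (trans (cong (_* f i) (eq01-≡ i)) (*-identityˡ _))) (trans (h i) (sym (trans (cong (_* f i) (eq01-≡ i)) (*-identityˡ _))))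
        ... | no i≢j = trans (cong (f i *_) z) (trans (zeroʳ _) (sym z))
          where
          z : diagonal f i j ≡ 0#
          z = trans (cong (_* f j) (eq01-≢ i≢j)) (zeroˡ _)

      diagonal-trace : ∀ f → trace (diagonal f) ≡ Σ< n f
      diagonal-trace f = Σ-ext n λ i → trans (cong (_* f i) (eq01-≡ i)) (*-identityˡ _)

  -- One move of the fractional weights.

  module Rounding where

    open Reals
    open Sums
    open Analysis using (half; 0<half; half+half)
    open Projection

    Σ-mono-+ : ∀ n {f g : ℕ → ℝ} → (∀ i → i ℕ.< n → f i ≤ g i) → ∀ i c → i ℕ.< n → f i + c ≤ g i → Σ< n f + c ≤ Σ< n g
    Σ-mono-+ (suc n) {f} {g} p i c i<1+n q with i ℕ.≟ n
    ... | yes refl = ≤-respˡ (sym (+-assoc _ _ c)) (+-mono-≤ (Σ-mono-≤ n λ j j<n → p j (ℕP.m<n⇒m<1+n j<n)) q)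
    ... | no i≢n = ≤-respˡ (solve 3 (λ a b c → (a :+ c) :+ b := (a :+ b) :+ c) refl (Σ< n f) (f n) c)
      (+-mono-≤ (Σ-mono-+ n (λ j j<n → p j (ℕP.m<n⇒m<1+n j<n)) i c (ℕP.≤∧≢⇒< (ℕ.s≤s⁻¹ i<1+n) i≢n) q) (p n ℕP.≤-refl))

    -- `fl` stands for floating: a weight that is not yet rounded.
    fl : (ℕ → ℝ) → ℕ → ℝ
    fl x p = lt01 0# (x p) * lt01 (x p) 1#

    fl-cases : ∀ x p → (0# < x p × x p < 1# × fl x p ≡ 1#) ⊎ fl x p ≡ 0#
    fl-cases x p with lt01-cases 0# (x p) | lt01-cases (x p) 1#
    ... | inj₁ (a , e) | inj₁ (b , f) = inj₁ (a , b , trans (cong₂ _*_ e f) (*-identityʳ 1#))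
    ... | inj₂ (_ , e) | _ = inj₂ (trans (cong (_* lt01 (x p) 1#) e) (zeroˡ _))
    ... | inj₁ _ | inj₂ (_ , f) = inj₂ (trans (cong (lt01 0# (x p) *_) f) (zeroʳ _))

    fl-nonneg : ∀ x p → 0# ≤ fl x p
    fl-nonneg x p = *-nonneg (lt01-nonneg _ _) (lt01-nonneg _ _)

    fl-≤1 : ∀ x p → fl x p ≤ 1#
    fl-≤1 x p with fl-cases x p
    ... | inj₁ (_ , _ , e) = ≡⇒≤ e
    ... | inj₂ e = ≤-respˡ (sym e) 0≤1

    fl-idem : ∀ x p → fl x p * fl x p ≡ fl x p
    fl-idem x p with fl-cases x p
    ... | inj₁ (_ , _ , e) = trans (cong₂ _*_ e e) (trans (*-identityʳ 1#) (sym e))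
    ... | inj₂ e = trans (cong (_* fl x p) e) (trans (zeroˡ _) (sym e))

    fl-true : ∀ {x p} → 0# < x p → x p < 1# → fl x p ≡ 1#
    fl-true a b = trans (cong₂ _*_ (lt01-true a) (lt01-true b)) (*-identityʳ 1#)

    fl-cong : ∀ {x y p} → x p ≡ y p → fl x p ≡ fl y p
    fl-cong e = cong (λ z → lt01 0# z * lt01 z 1#) e

    fl-0 : ∀ {x p} → x p ≡ 0# → fl x p ≡ 0#
    fl-0 {x} {p} e = trans (cong (_* lt01 (x p) 1#) (lt01-false (≡⇒≤ e))) (zeroˡ _)

    fl-1 : ∀ {x p} → x p ≡ 1# → fl x p ≡ 0#
    fl-1 {x} {p} e = trans (cong (lt01 0# (x p) *_) (lt01-false (≡⇒≤ (sym e)))) (zeroʳ _)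

    module Moves (n : ℕ) where

      Range : (ℕ → ℝ) → Set
      Range x = ∀ p → p ℕ.< n → 0# ≤ x p × x p ≤ 1#

      -- A conditional in arithmetic form: row `p` replaces `D` if its diagonal entry is positive,
      -- so the last such row survives. That row is nonzero, as the diagonal entry is its `p`-th
      -- entry.
      dirStep : (ℕ → ℕ → ℝ) → (ℕ → ℝ) → ℕ → ℕ → ℝ
      dirStep u D p i = lt01 0# (u p p) * u p i + (1# - lt01 0# (u p p)) * D i

      DirInv : (ℕ → ℕ → ℝ) → ℕ → (ℕ → ℝ) → Set
      DirInv u q D = ((∀ p → p ℕ.< q → u p p ≤ 0#) × (∀ i → D i ≡ 0#)) ⊎ (∃[ p ] p ℕ.< n × 0# < u p p × (∀ i → D i ≡ u p i))

      dirStep-inv : ∀ u q D → q ℕ.< n → DirInv u q D → DirInv u (suc q) (dirStep u D q)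
      dirStep-inv u q D q<n inv with lt01-cases 0# (u q q)
      ... | inj₁ (pos , e) = inj₂ (q , q<n , pos , λ i → trans (cong (λ z → z * u q i + (1# - z) * D i) e) (solve 2 (λ a b → :1 :* a :+ (:1 :- :1) :* b := a) refl (u q i) (D i)))
      ... | inj₂ (npos , e) = go inv
        where
        same : ∀ i → dirStep u D q i ≡ D i
        same i = trans (cong (λ z → z * u q i + (1# - z) * D i) e) (solve 2 (λ a b → :0 :* a :+ (:1 :- :0) :* b := b) refl (u q i) (D i))
        go : DirInv u q D → DirInv u (suc q) (dirStep u D q)
        go (inj₁ (f , z)) = inj₁ ((λ p p<1+q → bound p p<1+q) , λ i → trans (same i) (z i))
          where
          bound : ∀ p → p ℕ.< suc q → u p p ≤ 0#
          bound p p<1+q with p ℕ.≟ q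
          ... | yes refl = npos
          ... | no p≢q = f p (ℕP.≤∧≢⇒< (ℕ.s≤s⁻¹ p<1+q) p≢q)
        go (inj₂ (p , p<n , pos , h)) = inj₂ (p , p<n , pos , λ i → trans (same i) (h i))

      dir-nonzero : ∀ u D → DirInv u n D → 0# < Σ< n (λ i → u i i) → ∃[ p ] p ℕ.< n × D p ≢ 0#
      dir-nonzero u D (inj₂ (p , p<n , u>0 , h)) _ = p , p<n , λ z → irrefl (sym (trans (sym (h p)) z)) u>0
      dir-nonzero u D (inj₁ (u≤0 , _)) tr>0 with Σ-pos⇒∃ n tr>0
      ... | p , p<n , u>0 = ⊥-elim (<⇒≱ u>0 (u≤0 p p<n))

      -- The trace is the dimension of the space of admissible directions; `0# + 1#` is the cost of
      -- the total, `s` that of the moments.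
      remaining-pos : ∀ F s tr → 1# + s < F → F - ((0# + 1#) + s) ≤ tr → 0# < tr
      remaining-pos F s tr few le = <-≤-trans (<-by (<⇒0< few) (solve 2 (λ F s → (F :- ((:0 :+ :1) :+ s)) :- :0 := F :- (:1 :+ s)) refl F s)) le

      -- Exceeds every candidate step; zero entries of D contribute 0 because 0⁻¹ = 0.
      start : (ℕ → ℝ) → ℝ
      start D = 1# + Σ< n (λ q → (1# * D q ⁻¹) * (1# * D q ⁻¹))

      -- The step at which weight `p` arrives at 1 or at 0, according to the sign of `D p`.
      cand : (ℕ → ℝ) → (ℕ → ℝ) → ℕ → ℝ
      cand x D p = (lt01 0# (D p) * (1# - x p) + lt01 (D p) 0# * (0# - x p)) * D p ⁻¹

      -- A running minimum in arithmetic form. The factor `lt01 0# (D p) + lt01 (D p) 0#` masks the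
      -- weights with `D p = 0`, whose candidate is 0 and would stop the move.
      minStep : (ℕ → ℝ) → (ℕ → ℝ) → ℝ → ℕ → ℝ
      minStep x D t p = lt01 (cand x D p) t * (lt01 0# (D p) + lt01 (D p) 0#) * cand x D p + (1# - lt01 (cand x D p) t * (lt01 0# (D p) + lt01 (D p) 0#)) * t

      cand-pos : ∀ x D p → 0# < D p → cand x D p * D p ≡ 1# - x p
      cand-pos x D p q = trans (cong (λ z → z * D p ⁻¹ * D p) (trans (cong₂ (λ a b → a * (1# - x p) + b * (0# - x p)) (lt01-true q) (lt01-false (<⇒≤ q))) (solve 1 (λ x → :1 :* (:1 :- x) :+ :0 :* (:0 :- x) := :1 :- x) refl (x p))))
        (trans (*-assoc _ _ _) (trans (cong ((1# - x p) *_) (*-inverseˡ _ (>⇒≢ q))) (*-identityʳ _)))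

      cand-neg : ∀ x D p → D p < 0# → cand x D p * D p ≡ - x p
      cand-neg x D p q = trans (cong (λ z → z * D p ⁻¹ * D p) (trans (cong₂ (λ a b → a * (1# - x p) + b * (0# - x p)) (lt01-false (<⇒≤ q)) (lt01-true q)) (solve 1 (λ x → :0 :* (:1 :- x) :+ :1 :* (:0 :- x) := :- x) refl (x p))))
        (trans (*-assoc _ _ _) (trans (cong (- x p *_) (*-inverseˡ _ (λ e → irrefl e q))) (*-identityʳ _)))

      scale-pos : ∀ {t c D} → 0# < D → t ≤ c → t * D ≤ c * D
      scale-pos p q = *-monoʳ-≤ (<⇒≤ p) q

      scale-neg : ∀ {t c D} → D < 0# → t ≤ c → c * D ≤ t * D
      scale-neg {t} {c} {D} p q = ≤-by (*-nonneg (neg-nonneg (<⇒≤ p)) (≤⇒0≤ q)) (solve 3 (λ t c d → t :* d :- c :* d := (:- d) :* (c :- t)) refl t c D)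

      cand-nonneg : ∀ x D p → 0# ≤ x p → x p ≤ 1# → D p ≢ 0# → 0# ≤ cand x D p
      cand-nonneg x D p 0≤x x≤1 D≢0 with sign (D p)
      ... | is0 e = ⊥-elim (D≢0 e)
      ... | is+ q _ = *-cancelˡ-≤ q (subst₂ _≤_ (sym (zeroʳ _)) (trans (sym (cand-pos x D p q)) (*-comm _ _)) (≤⇒0≤ x≤1))
      ... | is- q _ with <-or-≥ (cand x D p) 0#
      ... | inj₂ r = r
      ... | inj₁ r = ⊥-elim (<⇒≱ (*-pos (neg-pos r) (neg-pos q)) (≤-respˡ (trans (sym (cand-neg x D p q)) (solve 2 (λ c d → c :* d := (:- c) :* (:- d)) refl (cand x D p) (D p))) (neg-nonpos 0≤x)))

      -- The candidate is at most |1 / D p| because `x p` lies in [0,1], and y < 1 + y² for every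
      -- real y: the difference is 3/4 plus a square.
      cand<start : ∀ x D p → p ℕ.< n → 0# ≤ x p → x p ≤ 1# → D p ≢ 0# → cand x D p < start D
      cand<start x D p p<n 0≤x x≤1 D≢0 = <-≤-trans below (+-mono-≤ ≤-refl (term≤Σ n (λ q _ → sq-nonneg (1# * D q ⁻¹)) p p<n))
        where
        i = D p ⁻¹
        c≤ : cand x D p ≤ abs i
        c≤ with sign (D p)
        ... | is0 e = ⊥-elim (D≢0 e)
        ... | is+ q _ = ≤-trans (*-cancelˡ-≤ q (≤-by 0≤x (trans (cong₂ _-_ (*-inverse _ D≢0) (trans (*-comm _ _) (cand-pos x D p q))) (solve 1 (λ x → :1 :- (:1 :- x) := x) refl (x p))))) (x≤abs i)
        ... | is- q _ = ≤-trans (*-cancelˡ-≤ (neg-pos q) (≤-by (≤⇒0≤ x≤1) (trans (solve 3 (λ d i c → (:- d) :* (:- i) :- (:- d) :* c := d :* i :+ c :* d) refl (D p) i (cand x D p)) (cong₂ _+_ (*-inverse _ D≢0) (cand-neg x D p q))))) (-x≤abs i)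
        below : cand x D p < 1# + (1# * i) * (1# * i)
        below = ≤-<-trans c≤ (<-by (+-pos-nonneg positive (sq-nonneg (h - abs i))) eq)
          where
          h = half
          h<1 : h < 1#
          h<1 = <-by 0<half (trans (cong (_- h) (sym half+half)) (solve 1 (λ h → (h :+ h) :- h := h) refl h))
          positive : 0# < 1# - h * h
          positive = <⇒0< (<-trans (<-respʳ (*-identityʳ h) (*-monoˡ-< 0<half h<1)) h<1)
          eq : (1# + (1# * i) * (1# * i)) - abs i ≡ (1# - h * h) + (h - abs i) * (h - abs i)
          eq = trans (cong (λ z → (1# + (1# * i) * (1# * i)) - z) (sym (*-identityˡ (abs i)))) (trans (cong₂ (λ y z → (1# + y) - z * abs i) (trans (cong₂ _*_ (*-identityˡ i) (*-identityˡ i)) (trans (sym (abs-≥0 (sq-nonneg i))) (abs-* i i))) (sym half+half)) eq')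
            where
            eq' : (1# + abs i * abs i) - (h + h) * abs i ≡ (1# - h * h) + (h - abs i) * (h - abs i)
            eq' = solve 2 (λ h a → (:1 :+ a :* a) :- (h :+ h) :* a := (:1 :- h :* h) :+ (h :- a) :* (h :- a)) refl h (abs i)

      -- The last alternative remembers a weight at which the minimum is attained: that weight
      -- becomes 0 or 1 in the move.
      MinInv : (ℕ → ℝ) → (ℕ → ℝ) → ℕ → ℝ → Set
      MinInv x D q t = (∀ p → p ℕ.< q → D p ≢ 0# → t ≤ cand x D p) × 0# ≤ t × (t ≡ start D ⊎ (∃[ p ] p ℕ.< n × D p ≢ 0# × t ≡ cand x D p))

      start-inv : ∀ x D → MinInv x D 0 (start D)
      start-inv x D = (λ p ()) , +-nonneg 0≤1 (Σ-nonneg n λ q _ → sq-nonneg (1# * D q ⁻¹)) , inj₁ refl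

      minStep-inv : ∀ x D q t → Range x → q ℕ.< n → MinInv x D q t → MinInv x D (suc q) (minStep x D t q)
      minStep-inv x D q t rg q<n (le , 0≤t , from) = go (sign (D q))
        where
        c = cand x D q
        nz = lt01 0# (D q) + lt01 (D q) 0#
        keep : minStep x D t q ≡ t → (D q ≢ 0# → t ≤ c) → MinInv x D (suc q) (minStep x D t q)
        keep e h = subst (MinInv x D (suc q)) (sym e) (extend , 0≤t , from)
          where
          extend : ∀ p → p ℕ.< suc q → D p ≢ 0# → t ≤ cand x D p
          extend p p<1+q with p ℕ.≟ q
          ... | yes refl = h
          ... | no p≢q = le p (ℕP.≤∧≢⇒< (ℕ.s≤s⁻¹ p<1+q) p≢q)
        nonzero : D q ≢ 0# → nz ≡ 1# → MinInv x D (suc q) (minStep x D t q)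
        nonzero D≢0 e with lt01-cases c t
        ... | inj₂ (t≤c , f) = keep (trans (cong₂ (λ a b → a * b * c + (1# - a * b) * t) f e) (solve 2 (λ c t → :0 :* :1 :* c :+ (:1 :- :0 :* :1) :* t := t) refl c t)) (λ _ → t≤c)
        ... | inj₁ (c<t , f) = subst (MinInv x D (suc q)) (sym e') (extend , cand-nonneg x D q (proj₁ (rg q q<n)) (proj₂ (rg q q<n)) D≢0 , inj₂ (q , q<n , D≢0 , refl))
          where
          e' : minStep x D t q ≡ c
          e' = trans (cong₂ (λ a b → a * b * c + (1# - a * b) * t) f e) (solve 2 (λ c t → :1 :* :1 :* c :+ (:1 :- :1 :* :1) :* t := c) refl c t)
          extend : ∀ p → p ℕ.< suc q → D p ≢ 0# → c ≤ cand x D p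
          extend p p<1+q h with p ℕ.≟ q
          ... | yes refl = ≤-refl
          ... | no p≢q = ≤-trans (<⇒≤ c<t) (le p (ℕP.≤∧≢⇒< (ℕ.s≤s⁻¹ p<1+q) p≢q) h)
        go : Sign (D q) → MinInv x D (suc q) (minStep x D t q)
        go (is- a b) = nonzero b (trans (cong₂ _+_ (lt01-false (<⇒≤ a)) (lt01-true a)) (+-identityˡ 1#))
        go (is+ a b) = nonzero b (trans (cong₂ _+_ (lt01-true a) (lt01-false (<⇒≤ a))) (+-identityʳ 1#))
        go (is0 b) = keep (trans (cong (λ z → lt01 c t * z * c + (1# - lt01 c t * z) * t) (trans (cong₂ _+_ (lt01-false (≡⇒≤ b)) (lt01-false (≡⇒≤ (sym b)))) (+-identityˡ 0#)))
          (solve 3 (λ l c t → l :* :0 :* c :+ (:1 :- l :* :0) :* t := t) refl (lt01 c t) c t)) (λ h → ⊥-elim (h b))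

      shift-dot : ∀ (x x' D b : ℕ → ℝ) t → (∀ p → x' p ≡ x p + t * D p) → Σ< n (λ p → D p * b p) ≡ 0# → Σ< n (λ p → (x' p - x p) * b p) ≡ 0#
      shift-dot x x' D b t e z = trans (Σ-ext n λ p → trans (cong (λ y → (y - x p) * b p) (e p)) (solve 4 (λ x t D b → ((x :+ t :* D) :- x) :* b := t :* (D :* b)) refl (x p) t (D p) (b p)))
        (trans (Σ-*ˡ n t (λ p → D p * b p)) (trans (cong (t *_) z) (zeroʳ t)))

      shift-total : ∀ (x x' : ℕ → ℝ) → Σ< n (λ p → (x' p - x p) * 1#) ≡ 0# → Σ< n x' ≡ Σ< n x
      shift-total x x' z = trans (solve 2 (λ a b → a := b :+ (a :- b)) refl (Σ< n x') (Σ< n x)) (trans (cong (Σ< n x +_) (trans (sym (Σ-- n x' x)) (trans (Σ-ext n λ p → sym (*-identityʳ _)) z))) (+-identityʳ _))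

      drop-factor : ∀ (f b : ℕ → ℝ) {e} → e ≡ 1# → Σ< n (λ p → f p * (e * b p)) ≡ 0# → Σ< n (λ p → f p * b p) ≡ 0#
      drop-factor f b refl z = trans (Σ-ext n λ p → cong (f p *_) (sym (*-identityˡ (b p)))) z

      module Move (x D : ℕ → ℝ) (t : ℝ) (rg : Range x) (supp : ∀ p → fl x p ≡ 0# → D p ≡ 0#) (inv : MinInv x D n t) where

        x' : ℕ → ℝ
        x' p = x p + t * D p

        le : ∀ p → p ℕ.< n → D p ≢ 0# → t ≤ cand x D p
        le = proj₁ inv
        0≤t : 0# ≤ t
        0≤t = proj₁ (proj₂ inv)

        still : ∀ p → D p ≡ 0# → x' p ≡ x p
        still p e = trans (cong (λ z → x p + t * z) e) (solve 2 (λ x t → x :+ t :* :0 := x) refl (x p) t)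

        frozen : ∀ p → fl x p ≡ 0# → x' p ≡ x p
        frozen p e = still p (supp p e)

        range : Range x'
        range p p<n with sign (D p)
        ... | is0 e = subst (λ z → 0# ≤ z × z ≤ 1#) (sym (still p e)) (rg p p<n)
        ... | is+ q b = +-nonneg (proj₁ (rg p p<n)) (*-nonneg 0≤t (<⇒≤ q)) ,
          ≤-by (≤⇒0≤ (scale-pos q (le p p<n b))) (trans (solve 2 (λ x y → :1 :- (x :+ y) := (:1 :- x) :- y) refl (x p) (t * D p)) (cong (_- t * D p) (sym (cand-pos x D p q))))
        ... | is- q b = ≤-by (≤⇒0≤ (scale-neg q (le p p<n b))) (trans (solve 2 (λ x y → (x :+ y) :- :0 := y :- (:- x)) refl (x p) (t * D p)) (cong (λ z → t * D p - z) (sym (cand-neg x D p q)))) ,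
          ≤-by (+-nonneg (≤⇒0≤ (proj₂ (rg p p<n))) (*-nonneg 0≤t (neg-nonneg (<⇒≤ q)))) (solve 3 (λ x t d → :1 :- (x :+ t :* d) := (:1 :- x) :+ t :* (:- d)) refl (x p) t (D p))

        fl-dec : ∀ p → p ℕ.< n → fl x' p ≤ fl x p
        fl-dec p p<n with fl-cases x p
        ... | inj₁ (_ , _ , e) = ≤-respʳ (sym e) (fl-≤1 x' p)
        ... | inj₂ e = ≡⇒≤ (fl-cong {x'} {x} (frozen p e))

        hit : ∀ p → D p ≢ 0# → t ≡ cand x D p → fl x' p ≡ 0#
        hit p D≢0 e with sign (D p)
        ... | is0 z = ⊥-elim (D≢0 z)
        ... | is+ q _ = fl-1 {x'} (trans (cong (λ z → x p + z) (trans (cong (_* D p) e) (cand-pos x D p q))) (solve 1 (λ x → x :+ (:1 :- x) := :1) refl (x p)))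
        ... | is- q _ = fl-0 {x'} (trans (cong (λ z → x p + z) (trans (cong (_* D p) e) (cand-neg x D p q))) (-‿inverseʳ (x p)))

        fl≡1 : ∀ p → D p ≢ 0# → fl x p ≡ 1#
        fl≡1 p D≢0 with fl-cases x p
        ... | inj₁ (_ , _ , e) = e
        ... | inj₂ e = ⊥-elim (D≢0 (supp p e))

        -- A nonzero entry of `D` rules out `t ≡ start D`, so `t` is the candidate of some weight
        -- with `D p ≢ 0#`; that weight was fractional and stops being so, and no other weight
        -- becomes fractional.
        progress : (∃[ p ] p ℕ.< n × D p ≢ 0#) → Σ< n (fl x') + 1# ≤ Σ< n (fl x)
        progress (p₀ , p₀<n , D≢0) with proj₂ (proj₂ inv)
        ... | inj₁ e = ⊥-elim (<⇒≱ (cand<start x D p₀ p₀<n (proj₁ (rg p₀ p₀<n)) (proj₂ (rg p₀ p₀<n)) D≢0) (≤-respˡ e (le p₀ p₀<n D≢0)))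
        ... | inj₂ (p , p<n , Dp≢0 , e) = Σ-mono-+ n fl-dec p 1# p<n (≡⇒≤ (trans (cong (_+ 1#) (hit p Dp≢0 e)) (trans (+-identityˡ 1#) (sym (fl≡1 p Dp≢0)))))

  -- Running code on the machine, with time bounds.

  module Machine where

    open RealNumbers 𝓡 using (ℝ)
    open RealRAM 𝓡
    open import Data.List using (List; []; _∷_; _++_; length)
    import Data.List.Properties as ListP
    open import Data.Maybe using (just; nothing)
    open import Data.Nat as ℕ using (ℕ; zero; suc; _≡ᵇ_; _<ᵇ_; _≤_; _<_; _+_; _*_; s≤s; z≤n)
    open import Data.Nat.Properties
    open import Data.Unit using (⊤; tt)

    upd-same : ∀ {A : Set} (f : ℕ → A) a v → (f [ a ≔ v ]) a ≡ v
    upd-same f a v with a ≡ᵇ a | ≡⇒≡ᵇ a a refl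
    ... | true | _ = refl

    upd-other : ∀ {A : Set} (f : ℕ → A) a v {b} → b ≢ a → (f [ a ≔ v ]) b ≡ f b
    upd-other f a v {b} b≢a with b ≡ᵇ a | ≡ᵇ⇒≡ b a
    ... | true  | p = ⊥-elim (b≢a (p tt))
    ... | false | _ = refl

    <ᵇ-true : ∀ {a b} → a < b → (a <ᵇ b) ≡ true
    <ᵇ-true {a} {b} p with a <ᵇ b | <⇒<ᵇ p
    ... | true | _ = refl

    <ᵇ-false : ∀ {a b} → ¬ (a < b) → (a <ᵇ b) ≡ false
    <ᵇ-false {a} {b} p with a <ᵇ b | <ᵇ⇒< a b
    ... | true  | q = ⊥-elim (p (q tt))
    ... | false | _ = refl

    -- Code depends on the address where it is placed, since jump targets are absolute.
    Code : Set
    Code = ℕ → List Instr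

    At : Program → ℕ → List Instr → Set
    At prog p []       = ⊤
    At prog p (i ∷ is) = nth prog p ≡ just i × At prog (suc p) is

    At-++ : ∀ prog p xs {ys} → At prog p (xs ++ ys) → At prog p xs × At prog (p + length xs) ys
    At-++ prog p []       {ys} h = tt , subst (λ q → At prog q ys) (sym (+-identityʳ p)) h
    At-++ prog p (x ∷ xs) {ys} (e , h) = let (a , b) = At-++ prog (suc p) xs h in (e , a) , subst (λ q → At prog q ys) (sym (+-suc p (length xs))) b

    nth-++ : ∀ {A : Set} (xs : List A) {y ys} → nth (xs ++ y ∷ ys) (length xs) ≡ just y
    nth-++ []       = refl
    nth-++ (x ∷ xs) = nth-++ xs

    nth-length : ∀ {A : Set} (xs : List A) → nth xs (length xs) ≡ nothing
    nth-length []       = refl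
    nth-length (x ∷ xs) = nth-length xs

    At-suffix : ∀ pre code → At (pre ++ code) (length pre) code
    At-suffix pre []       = tt
    At-suffix pre (x ∷ xs) = nth-++ pre , subst (λ l → At (pre ++ x ∷ xs) l xs) (trans (ListP.length-++ pre) (trans (+-comm (length pre) 1) refl))
      (subst (λ prog → At prog (length (pre ++ x ∷ [])) xs) (ListP.++-assoc pre (x ∷ []) xs) (At-suffix (pre ++ x ∷ []) xs))

    infix 4 _⊢_⇒[_]_
    -- A step must have the same result for both values of the random bit, so one derivation
    -- describes every run.
    data _⊢_⇒[_]_ (prog : Program) : State → ℕ → State → Set where
      done : ∀ {s} → prog ⊢ s ⇒[ 0 ] s
      next : ∀ {s s₁ s₂ t i} → nth prog (pc s) ≡ just i → (∀ bit → exec i bit s ≡ s₁) → prog ⊢ s₁ ⇒[ t ] s₂ → prog ⊢ s ⇒[ suc t ] s₂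

    ⇒-trans : ∀ {prog s₁ s₂ s₃ t u} → prog ⊢ s₁ ⇒[ t ] s₂ → prog ⊢ s₂ ⇒[ u ] s₃ → prog ⊢ s₁ ⇒[ t + u ] s₃
    ⇒-trans done           r = r
    ⇒-trans (next e f q) r = next e f (⇒-trans q r)

    step-just : ∀ prog bit s {i} → nth prog (pc s) ≡ just i → step prog bit s ≡ exec i bit s
    step-just prog bit s e with nth prog (pc s) | e
    ... | just i | refl = refl

    step-nothing : ∀ prog bit s → Halted prog s → step prog bit s ≡ s
    step-nothing prog bit s e with nth prog (pc s) | e
    ... | nothing | refl = refl

    run-halted : ∀ {T} prog (ω : Vec Bool T) s → Halted prog s → run prog ω s ≡ s
    run-halted prog []        s h = refl
    run-halted prog (bit ∷ ω) s h = trans (cong (run prog ω) (step-nothing prog bit s h)) (run-halted prog ω s h)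

    run-⇒ : ∀ {prog s s' t} → prog ⊢ s ⇒[ t ] s' → Halted prog s' → ∀ {T} → t ≤ T → (ω : Vec Bool T) → run prog ω s ≡ s'
    run-⇒ done h _ ω = run-halted _ ω _ h
    run-⇒ {prog} {s} (next e f r) h (s≤s t≤T) (bit ∷ ω) = trans (cong (run prog ω) (trans (step-just prog bit s e) (f bit))) (run-⇒ r h t≤T ω)

    -- A Hoare triple for total correctness with the time bound `b`, from one fixed initial memory;
    -- preconditions become hypotheses about `I` and `R`. Quantifying over all programs that contain
    -- the code makes triples composable.
    record Spec (c : Code) (I : ℕ → ℕ) (R : ℕ → ℝ) (b : ℕ) (Q : (ℕ → ℕ) → (ℕ → ℝ) → Set) : Set where
      constructor spec
      field
        exe : ∀ prog p → At prog p (c p) → ∃[ t ] ∃[ I' ] ∃[ R' ] (t ≤ b × prog ⊢ ⟨ p , I , R ⟩ ⇒[ t ] ⟨ p + length (c p) , I' , R' ⟩ × Q I' R')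
    open Spec public

    infixr 5 _⨾_
    _⨾_ : Code → Code → Code
    (a ⨾ b) p = a p ++ b (p + length (a p))

    ins : Instr → Code
    ins i _ = i ∷ []

    repeat : ℕ → Instr → Code
    repeat zero    i _ = []
    repeat (suc k) i   = ins i ⨾ repeat k i

    -- The operands `1` and `0` are registers, holding the constant 1 and `n`. The test comes after
    -- the body, so a loop runs at least once and `1 ≤ n` is required.
    back : ℕ → Code → Code
    back r body p = body p ++ (iadd r r 1 ∷ ijumplt r 0 p ∷ [])

    loop : ℕ → Code → Code
    loop r body = ins (iconst r 0) ⨾ back r body

    spec-seq : ∀ {a b I R s t Q Q'} → Spec a I R s Q → (∀ I' R' → Q I' R' → Spec b I' R' t Q') → Spec (a ⨾ b) I R (s + t) Q'
    exe (spec-seq {a} {b} {I} {R} {s} {t} x y) prog p at with At-++ prog p (a p) at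
    ... | ata , atb with exe x prog p ata
    ... | t₁ , I₁ , R₁ , t₁≤ , run₁ , q₁ with exe (y I₁ R₁ q₁) prog (p + length (a p)) atb
    ... | t₂ , I₂ , R₂ , t₂≤ , run₂ , q₂ = t₁ + t₂ , I₂ , R₂ , +-mono-≤ t₁≤ t₂≤ ,
      subst (λ z → prog ⊢ ⟨ p , I , R ⟩ ⇒[ t₁ + t₂ ] ⟨ z , I₂ , R₂ ⟩) (trans (+-assoc p _ _) (cong (p +_) (sym (ListP.length-++ (a p))))) (⇒-trans run₁ run₂) , q₂

    spec-mono : ∀ {c I R s Q Q'} → Spec c I R s Q → (∀ I' R' → Q I' R' → Q' I' R') → Spec c I R s Q'
    exe (spec-mono x f) prog p at with exe x prog p at
    ... | t , I' , R' , t≤ , r , q = t , I' , R' , t≤ , r , f I' R' q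

    spec-bound : ∀ {c I R s s' Q} → s ≤ s' → Spec c I R s Q → Spec c I R s' Q
    exe (spec-bound le x) prog p at with exe x prog p at
    ... | t , I' , R' , t≤ , r , q = t , I' , R' , ≤-trans t≤ le , r , q

    spec-ins : ∀ {i I R I' R' Q} → (∀ bit p → exec i bit ⟨ p , I , R ⟩ ≡ ⟨ suc p , I' , R' ⟩) → Q I' R' → Spec (ins i) I R 1 Q
    exe (spec-ins {i} {I} {R} {I'} {R'} f q) prog p (e , _) = 1 , I' , R' , ≤-refl ,
      next e (λ bit → trans (f bit p) (cong (λ z → ⟨ z , I' , R' ⟩) (+-comm 1 p))) done , q

    spec-repeat : ∀ k {i I R} (P : ℕ → (ℕ → ℕ) → Set) → P 0 I →
      (∀ j I → P j I → Spec (ins i) I R 1 (λ I' R' → P (suc j) I' × R' ≡ R)) →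
      Spec (repeat k i) I R k (λ I' R' → P k I' × R' ≡ R)
    exe (spec-repeat zero {I = I} {R} P p0 f) prog p at = 0 , I , R , z≤n , subst (λ z → prog ⊢ ⟨ p , I , R ⟩ ⇒[ 0 ] ⟨ z , I , R ⟩) (sym (+-identityʳ p)) done , p0 , refl
    spec-repeat (suc k) P p0 f = spec-seq (f 0 _ p0) λ { I' R' (p1 , refl) → spec-repeat k (λ j → P (suc j)) p1 (λ j → f (suc j)) }

    module Loops (n : ℕ) (1≤n : 1 ≤ n) where

      -- The invariant is demanded with the counter already incremented, because `back` increments
      -- it between body and test.
      LoopPost : ℕ → (ℕ → (ℕ → ℕ) → (ℕ → ℝ) → Set) → ℕ → (ℕ → ℕ) → (ℕ → ℝ) → Set
      LoopPost r Inv q I R = I r ≡ q × I 0 ≡ n × I 1 ≡ 1 × Inv (suc q) (I [ r ≔ suc q ]) R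

      spec-back : ∀ {body r b} (Inv : ℕ → (ℕ → ℕ) → (ℕ → ℝ) → Set) → r ≢ 0 → 
        (∀ q I R → q < n → I r ≡ q → Inv q I R → Spec body I R b (LoopPost r Inv q)) →
        ∀ rem q I R → q + suc rem ≡ n → I r ≡ q → Inv q I R → Spec (back r body) I R (suc rem * (b + 2)) (Inv n)
      exe (spec-back {body} {r} {b} Inv r≢0 f rem q I R e Ir inv) prog p at with At-++ prog p (body p) at
      ... | atb , ate with exe (f q I R (subst (q <_) e (m<m+n q (s≤s z≤n))) Ir inv) prog p atb
      ... | t₁ , I₁ , R₁ , t₁≤ , run₁ , (Ir₁ , I0₁ , I1₁ , inv₁) = finish rem e
        where
        e₁ = p + length (body p)
        I₂ = I₁ [ r ≔ I₁ r + I₁ 1 ]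
        I₂≡ : I₂ r ≡ suc q
        I₂≡ = trans (upd-same I₁ r _) (trans (cong₂ _+_ Ir₁ I1₁) (+-comm q 1))
        inv₂ : Inv (suc q) I₂ R₁
        inv₂ = subst (λ z → Inv (suc q) (I₁ [ r ≔ z ]) R₁) (sym (trans (cong₂ _+_ Ir₁ I1₁) (+-comm q 1))) inv₁
        I₂0 : I₂ 0 ≡ n
        I₂0 = trans (upd-other I₁ r _ (λ z → r≢0 (sym z))) I0₁
        run-inc : ∀ {p' t s'} → (if I₂ r <ᵇ I₂ 0 then p else suc (suc e₁)) ≡ p' → prog ⊢ ⟨ p' , I₂ , R₁ ⟩ ⇒[ t ] s' → prog ⊢ ⟨ p , I , R ⟩ ⇒[ t₁ + (2 + t) ] s'
        run-inc refl rest = ⇒-trans run₁ (next (proj₁ ate) (λ _ → refl) (next (proj₁ (proj₂ ate)) (λ _ → refl) rest))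
        finish : ∀ rem → q + suc rem ≡ n → ∃[ t ] ∃[ I' ] ∃[ R' ] (t ≤ suc rem * (b + 2) × prog ⊢ ⟨ p , I , R ⟩ ⇒[ t ] ⟨ p + length (back r body p) , I' , R' ⟩ × Inv n I' R')
        finish zero e = t₁ + 2 , I₂ , R₁ , ≤-trans (+-monoˡ-≤ 2 t₁≤) (≤-reflexive (sym (+-identityʳ _))) ,
          run-inc (trans (cong (if_then p else suc (suc e₁)) (<ᵇ-false (λ lt → <-irrefl refl (subst (suc q <_) (trans (sym e) (+-comm q 1)) (subst (_< n) I₂≡ (subst (I₂ r <_) I₂0 lt))))))
            (sym (trans (cong (p +_) (ListP.length-++ (body p))) (trans (sym (+-assoc p _ 2)) (+-comm e₁ 2))))) done ,
          subst (λ z → Inv z I₂ R₁) (trans (+-comm 1 q) e) inv₂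
        finish (suc rem) e with exe (spec-back Inv r≢0 f rem (suc q) I₂ R₁ (trans (sym (+-suc q (suc rem))) e) I₂≡ inv₂) prog p at
        ... | t , I' , R' , t≤ , run₂ , inv' = t₁ + (2 + t) , I' , R' ,
          ≤-trans (≤-reflexive (sym (+-assoc t₁ 2 t))) (+-mono-≤ (+-monoˡ-≤ 2 t₁≤) t≤) ,
          run-inc (cong (if_then p else suc (suc e₁)) (<ᵇ-true (subst (I₂ r <_) (sym I₂0) (subst (_< n) (sym I₂≡) (subst (suc q <_) (trans (sym (+-suc q (suc rem))) e) (m<m+n (suc q) (s≤s z≤n))))))) run₂ , inv'

      spec-loop : ∀ {body r b I R} (Inv : ℕ → (ℕ → ℕ) → (ℕ → ℝ) → Set) → r ≢ 0 → Inv 0 (I [ r ≔ 0 ]) R →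
        (∀ q I R → q < n → I r ≡ q → Inv q I R → Spec body I R b (LoopPost r Inv q)) →
        Spec (loop r body) I R (1 + n * (b + 2)) (Inv n)
      spec-loop {body} {r} {b} {I} {R} Inv r≢0 inv0 f = spec-seq {Q = λ I' R' → I' ≡ I [ r ≔ 0 ] × R' ≡ R} (spec-ins (λ _ _ → refl) (refl , refl)) λ { _ _ (refl , refl) →
        spec-bound (≤-reflexive (cong (_* (b + 2)) e)) (spec-back Inv r≢0 f (ℕ.pred n) 0 _ _ e (upd-same I r 0) inv0) }
        where
        e : suc (ℕ.pred n) ≡ n
        e = suc-pred n {{ℕ.>-nonZero 1≤n}}

  -- An array language, its compiler, and the correctness of the compiler.

  module Compiler where

    open Machine
    open RealNumbers 𝓡 using (ℝ; 0#; 1#; _⁻¹; exp; isCommutativeRing) renaming (_<?_ to _<?ᵣ_; _+_ to _+ᵣ_; _*_ to _*ᵣ_; _-_ to _-ᵣ_)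
    open Sums using (Σ<; Π<)
    open RealRAM 𝓡
    open import Algebra.Structures using (IsCommutativeRing)
    open import Data.List using ([]; _∷_)
    open import Data.Nat as ℕ using (ℕ; zero; suc; _≡ᵇ_; _<ᵇ_; _≤_; _<_; _+_; _*_; _^_; s≤s; z≤n)
    open import Data.Nat.Properties
    open import Data.Nat.Solver using (module +-*-Solver)
    open import Data.Unit using (tt)

    private
      x-x≡0 : ∀ x → x -ᵣ x ≡ 0#
      x-x≡0 = IsCommutativeRing.-‿inverseʳ isCommutativeRing

    module Language (d : ℕ) where

      -- `m` is the number of enclosing loop variables. In `inp` the coefficients are constants of
      -- the program, so `a * i` costs `a` additions; their bound `d` keeps the address inside the
      -- input area of `suc d * n` cells, which contains the d n + 1 input reals.
      data Expr (m : ℕ) : Set where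
        nil one     : Expr m
        arr         : (k : ℕ) (i j : Fin m) → Expr m
        inp         : (a : ℕ) (i : Fin m) (b : ℕ) → a ≤ d → b ≤ d → Expr m
        add sub mul div lt : Expr m → Expr m → Expr m
        expE        : Expr m → Expr m
        ltI         : (i j : Fin m) → Expr m
        sumE prodE  : Expr (suc m) → Expr m

      infixr 3 _⟫_
      -- `tab` assigns all n² entries at once from the old store. There are neither conditionals nor
      -- while loops: every `for` runs exactly `n` times, so the time bound of a command depends on
      -- `n` alone.
      data Cmd (m : ℕ) : Set where
        tab : (k : ℕ) → Expr (suc (suc m)) → Cmd m
        _⟫_ : Cmd m → Cmd m → Cmd m
        for : Cmd (suc m) → Cmd m

      Store : Set
      Store = ℕ → ℕ → ℕ → ℝ

      module Semantics (n : ℕ) (low : ℕ → ℝ) where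

        eval : ∀ {m} → Expr m → Vec ℕ m → Store → ℝ
        eval nil               ρ σ = 0#
        eval one               ρ σ = 1#
        eval (arr k i j)       ρ σ = σ k (lookup ρ i) (lookup ρ j)
        eval (inp a i b _ _)   ρ σ = low (a * lookup ρ i + b)
        eval (add e f)         ρ σ = eval e ρ σ +ᵣ eval f ρ σ
        eval (sub e f)         ρ σ = eval e ρ σ -ᵣ eval f ρ σ
        eval (mul e f)         ρ σ = eval e ρ σ *ᵣ eval f ρ σ
        eval (div e f)         ρ σ = eval e ρ σ *ᵣ eval f ρ σ ⁻¹
        eval (lt e f)          ρ σ = if does (eval e ρ σ <?ᵣ eval f ρ σ) then 1# else 0#
        eval (expE e)          ρ σ = exp (eval e ρ σ)
        eval (ltI i j)         ρ σ = if lookup ρ i <ᵇ lookup ρ j then 1# else 0#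
        eval (sumE e)          ρ σ = Σ< n (λ i → eval e (i ∷ ρ) σ)
        eval (prodE e)         ρ σ = Π< n (λ i → eval e (i ∷ ρ) σ)

        iterate : ℕ → (ℕ → Store → Store) → Store → Store
        iterate zero    f σ = σ
        iterate (suc q) f σ = f q (iterate q f σ)

        effect : ∀ {m} → Cmd m → Vec ℕ m → Store → Store
        effect (tab k e) ρ σ k' i j = if k' ≡ᵇ k then eval e (i ∷ j ∷ ρ) σ else σ k' i j
        effect (c ⟫ c')  ρ σ = effect c' ρ (effect c ρ σ)
        effect (for c)   ρ σ = iterate n (λ i → effect c (i ∷ ρ)) σ

      -- Registers: 0 holds n, 1 and 2 hold the constants 1 and 0, 3 holds the
      -- offset of the array area, 4 and 8 serve the address computation, 5 and 6
      -- hold operand addresses, and 9 + l holds the l-th enclosing loop counter.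
      reg : ∀ {m} → Fin m → ℕ
      reg {suc m} zero    = 9 + m
      reg {suc m} (suc v) = reg v

      -- Without index multiplication, `k` additions of `n` build k n, and the loop adds k n + i
      -- another `n` times; this yields `addr k i j`.
      address : (k ri rj ra : ℕ) → Code
      address k ri rj ra = ins (iconst 4 0) ⨾ repeat k (iadd 4 4 0) ⨾ ins (iadd 4 4 ri) ⨾ ins (iadd ra 3 rj) ⨾ loop 8 (ins (iadd ra ra 4))

      -- Program arrays get the even names and temporaries the odd ones, so the
      -- number of either need not be known.
      tmpName arrName : ℕ → ℕ
      tmpName s = suc (s + s)
      arrName k = k + k

      addrT : ℕ → ℕ → Code
      addrT s ra = address (tmpName s) 2 2 ra

      -- The 0 is produced as x - x, since 1 is the only real constant that an instruction writes.
      select01 : (ℕ → Instr) → Code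
      select01 test p = test (3 + p) ∷ rsub 5 5 5 ∷ jump (4 + p) ∷ rone 5 ∷ []

      binary : ℕ → Code → Code
      binary s op = addrT (suc s) 6 ⨾ addrT s 5 ⨾ op

      -- A stack discipline: the value goes to temporary `s`, and the temporaries below `s` survive.
      compE : ∀ {m} → Expr m → ℕ → Code
      compE nil s = addrT s 5 ⨾ ins (rsub 5 5 5)
      compE one s = addrT s 5 ⨾ ins (rone 5)
      compE (arr k i j) s = address (arrName k) (reg i) (reg j) 6 ⨾ addrT s 5 ⨾ ins (rcopy 5 6)
      compE (inp a i b _ _) s = ins (iconst 6 b) ⨾ repeat a (iadd 6 6 (reg i)) ⨾ addrT s 5 ⨾ ins (rcopy 5 6)
      compE (add e f) s = compE e s ⨾ compE f (suc s) ⨾ binary s (ins (radd 5 5 6))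
      compE (sub e f) s = compE e s ⨾ compE f (suc s) ⨾ binary s (ins (rsub 5 5 6))
      compE (mul e f) s = compE e s ⨾ compE f (suc s) ⨾ binary s (ins (rmul 5 5 6))
      compE (div e f) s = compE e s ⨾ compE f (suc s) ⨾ binary s (ins (rdiv 5 5 6))
      compE (lt e f) s = compE e s ⨾ compE f (suc s) ⨾ binary s (select01 (rjumplt 5 6))
      compE (expE e) s = compE e s ⨾ addrT s 5 ⨾ ins (rexp 5 5)
      compE (ltI i j) s = addrT s 5 ⨾ select01 (ijumplt (reg i) (reg j))
      compE {m} (sumE e) s = addrT s 5 ⨾ ins (rone 5) ⨾ ins (rsub 5 5 5) ⨾ loop (9 + m) (compE e (suc s) ⨾ binary s (ins (radd 5 5 6)))
      compE {m} (prodE e) s = addrT s 5 ⨾ ins (rone 5) ⨾ loop (9 + m) (compE e (suc s) ⨾ binary s (ins (rmul 5 5 6)))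

      -- The new entries are first collected in the array of temporary 0, so that
      -- e is evaluated in the old store throughout.
      compC : ∀ {m} → Cmd m → Code
      compC {m} (tab k e) =
        loop (9 + m) (loop (10 + m) (compE e 1 ⨾ addrT 1 6 ⨾ address (tmpName 0) (10 + m) (9 + m) 5 ⨾ ins (rcopy 5 6))) ⨾
        loop (9 + m) (loop (10 + m) (address (tmpName 0) (10 + m) (9 + m) 6 ⨾ address (arrName k) (10 + m) (9 + m) 5 ⨾ ins (rcopy 5 6)))
      compC (c ⟫ c') = compC c ⨾ compC c'
      compC {m} (for c) = loop (9 + m) (compC c)

      -- The prologue sets up registers 1 to 3, with the array area starting at `suc d * n`. The
      -- epilogue copies the diagonal of array `k` to the cells 0 to n - 1, where the output is
      -- read.
      compile : Cmd 0 → ℕ → Program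
      compile c k = (ins (iconst 1 1) ⨾ ins (iconst 2 0) ⨾ ins (iconst 3 0) ⨾ repeat (suc d) (iadd 3 3 0) ⨾ compC c ⨾
        loop 9 (address (arrName k) 9 9 6 ⨾ ins (rcopy 9 6))) 0

      module Time (n : ℕ) where
        loopTime : ℕ → ℕ
        loopTime b = 1 + n * (b + 2)
        addressTime : ℕ → ℕ
        addressTime k = 1 + (k + (1 + (1 + loopTime 1)))
        binaryTime : ℕ → ℕ
        binaryTime s = addressTime (tmpName (suc s)) + (addressTime (tmpName s) + 3)
        timeE : ∀ {m} → Expr m → ℕ → ℕ
        timeE nil s = addressTime (tmpName s) + 1
        timeE one s = addressTime (tmpName s) + 1
        timeE (arr k i j) s = addressTime (arrName k) + (addressTime (tmpName s) + 1)
        timeE (inp a i b _ _) s = 1 + (a + (addressTime (tmpName s) + 1))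
        timeE (add e f) s = timeE e s + (timeE f (suc s) + binaryTime s)
        timeE (sub e f) s = timeE e s + (timeE f (suc s) + binaryTime s)
        timeE (mul e f) s = timeE e s + (timeE f (suc s) + binaryTime s)
        timeE (div e f) s = timeE e s + (timeE f (suc s) + binaryTime s)
        timeE (lt e f) s = timeE e s + (timeE f (suc s) + binaryTime s)
        timeE (expE e) s = timeE e s + (addressTime (tmpName s) + 1)
        timeE (ltI i j) s = addressTime (tmpName s) + 3
        timeE (sumE e) s = addressTime (tmpName s) + (1 + (1 + loopTime (timeE e (suc s) + binaryTime s)))
        timeE (prodE e) s = addressTime (tmpName s) + (1 + loopTime (timeE e (suc s) + binaryTime s))
        timeC : ∀ {m} → Cmd m → ℕ
        timeC (tab k e) = loopTime (loopTime (timeE e 1 + (addressTime (tmpName 1) + (addressTime (tmpName 0) + 1)))) + loopTime (loopTime (addressTime (tmpName 0) + (addressTime (arrName k) + 1)))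
        timeC (c ⟫ c') = timeC c + timeC c'
        timeC (for c) = loopTime (timeC c)
        time : Cmd 0 → ℕ → ℕ
        time c k = 1 + (1 + (1 + (suc d + (timeC c + loopTime (addressTime (arrName k) + 1)))))

      open Time

      PolyBounded : (ℕ → ℕ) → Set
      PolyBounded f = ∃[ C ] ∃[ k ] (∀ n → 1 ≤ n → f n ≤ C * n ^ k)

      poly-const : ∀ c → PolyBounded (λ _ → c)
      poly-const c = c , 0 , λ n _ → ≤-reflexive (sym (*-identityʳ c))

      -- The sum of the exponents serves as a common exponent, which dominates both since `1 ≤ n`.
      poly-+ : ∀ {f g} → PolyBounded f → PolyBounded g → PolyBounded (λ n → f n + g n)
      poly-+ {f} {g} (C , k , p) (D , l , q) = C + D , k + l , λ n 1≤n → begin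
        f n + g n                               ≤⟨ +-mono-≤ (p n 1≤n) (q n 1≤n) ⟩
        C * n ^ k + D * n ^ l                   ≤⟨ +-mono-≤ (*-monoʳ-≤ C (^-monoʳ-≤ n {{ℕ.>-nonZero 1≤n}} (m≤m+n k l))) (*-monoʳ-≤ D (^-monoʳ-≤ n {{ℕ.>-nonZero 1≤n}} (m≤n+m l k))) ⟩
        C * n ^ (k + l) + D * n ^ (k + l)       ≡⟨ sym (*-distribʳ-+ (n ^ (k + l)) C D) ⟩
        (C + D) * n ^ (k + l)                   ∎
        where open ≤-Reasoning

      poly-n* : ∀ {f} → PolyBounded f → PolyBounded (λ n → n * f n)
      poly-n* {f} (C , k , p) = C , suc k , λ n 1≤n → ≤-trans (*-monoʳ-≤ n (p n 1≤n)) (≤-reflexive (+-*-Solver.solve 3 (λ n c x → n :* (c :* x) := c :* (n :* x)) refl n C (n ^ k)))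
        where open +-*-Solver using (_:*_; _:=_)

      poly-loop : ∀ {f} → PolyBounded f → PolyBounded (λ n → loopTime n (f n))
      poly-loop p = poly-+ (poly-const 1) (poly-n* (poly-+ p (poly-const 2)))

      poly-address : ∀ k → PolyBounded (λ n → addressTime n k)
      poly-address k = poly-+ (poly-const 1) (poly-+ (poly-const k) (poly-+ (poly-const 1) (poly-+ (poly-const 1) (poly-loop (poly-const 1)))))

      poly-binary : ∀ s → PolyBounded (λ n → binaryTime n s)
      poly-binary s = poly-+ (poly-address (tmpName (suc s))) (poly-+ (poly-address (tmpName s)) (poly-const 3))

      poly-E : ∀ {m} (e : Expr m) s → PolyBounded (λ n → timeE n e s)
      poly-E nil s = poly-+ (poly-address (tmpName s)) (poly-const 1)
      poly-E one s = poly-+ (poly-address (tmpName s)) (poly-const 1)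
      poly-E (arr k i j) s = poly-+ (poly-address (arrName k)) (poly-+ (poly-address (tmpName s)) (poly-const 1))
      poly-E (inp a i b _ _) s = poly-+ (poly-const 1) (poly-+ (poly-const a) (poly-+ (poly-address (tmpName s)) (poly-const 1)))
      poly-E (add e f) s = poly-+ (poly-E e s) (poly-+ (poly-E f (suc s)) (poly-binary s))
      poly-E (sub e f) s = poly-+ (poly-E e s) (poly-+ (poly-E f (suc s)) (poly-binary s))
      poly-E (mul e f) s = poly-+ (poly-E e s) (poly-+ (poly-E f (suc s)) (poly-binary s))
      poly-E (div e f) s = poly-+ (poly-E e s) (poly-+ (poly-E f (suc s)) (poly-binary s))
      poly-E (lt e f) s = poly-+ (poly-E e s) (poly-+ (poly-E f (suc s)) (poly-binary s))
      poly-E (expE e) s = poly-+ (poly-E e s) (poly-+ (poly-address (tmpName s)) (poly-const 1))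
      poly-E (ltI i j) s = poly-+ (poly-address (tmpName s)) (poly-const 3)
      poly-E (sumE e) s = poly-+ (poly-address (tmpName s)) (poly-+ (poly-const 1) (poly-+ (poly-const 1) (poly-loop (poly-+ (poly-E e (suc s)) (poly-binary s)))))
      poly-E (prodE e) s = poly-+ (poly-address (tmpName s)) (poly-+ (poly-const 1) (poly-loop (poly-+ (poly-E e (suc s)) (poly-binary s))))

      poly-C : ∀ {m} (c : Cmd m) → PolyBounded (λ n → timeC n c)
      poly-C (tab k e) = poly-+ (poly-loop (poly-loop (poly-+ (poly-E e 1) (poly-+ (poly-address (tmpName 1)) (poly-+ (poly-address (tmpName 0)) (poly-const 1))))))
        (poly-loop (poly-loop (poly-+ (poly-address (tmpName 0)) (poly-+ (poly-address (arrName k)) (poly-const 1)))))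
      poly-C (c ⟫ c') = poly-+ (poly-C c) (poly-C c')
      poly-C (for c) = poly-loop (poly-C c)

      poly-time : ∀ c k → PolyBounded (λ n → time n c k)
      poly-time c k = poly-+ (poly-const 1) (poly-+ (poly-const 1) (poly-+ (poly-const 1) (poly-+ (poly-const (suc d)) (poly-+ (poly-C c) (poly-loop (poly-+ (poly-address (arrName k)) (poly-const 1)))))))

      module Correctness (n : ℕ) (1≤n : 1 ≤ n) (low : ℕ → ℝ) where
        open Loops n 1≤n
        open Semantics n low

        O : ℕ
        O = suc d * n

        -- Beyond the offset, `j`, `i` and `k` are digits in base `n`, the leading one `k` being
        -- unbounded; hence the injectivity for `i` and `j` below `n`.
        addr : ℕ → ℕ → ℕ → ℕ
        addr k i j = (O + j) + n * (k * n + i)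

        tmp : ℕ → ℕ
        tmp s = addr (tmpName s) 0 0

        -- Uniqueness of the last digit in base `n`, by induction on the leading parts instead of
        -- division.
        radix : ∀ {j j'} x x' → j < n → j' < n → j + n * x ≡ j' + n * x' → j ≡ j' × x ≡ x'
        radix {j} {j'} zero zero _ _ e = trans (sym (trans (cong (j +_) (*-zeroʳ n)) (+-identityʳ j))) (trans e (trans (cong (j' +_) (*-zeroʳ n)) (+-identityʳ j'))) , refl
        radix {j} {j'} zero (suc x') p _ e = ⊥-elim (<⇒≱ p (subst (n ≤_) (sym (trans (sym (trans (cong (j +_) (*-zeroʳ n)) (+-identityʳ j))) e))
          (≤-trans (≤-trans (m≤m+n n (n * x')) (≤-reflexive (sym (*-suc n x')))) (m≤n+m _ j'))))
        radix {j} {j'} (suc x) zero p q e = let (a , b) = radix zero (suc x) q p (sym e) in sym a , sym b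
        radix {j} {j'} (suc x) (suc x') p q e = let (a , b) = radix x x' p q (+-cancelˡ-≡ n _ _ (trans (lem j x) (trans e (sym (lem j' x'))))) in a , cong suc b
          where
          open +-*-Solver
          lem : ∀ j x → n + (j + n * x) ≡ j + n * suc x
          lem j x = solve 3 (λ n j x → n :+ (j :+ n :* x) := j :+ n :* (con 1 :+ x)) refl n j x

        addr-inj : ∀ {k k' i i' j j'} → i < n → i' < n → j < n → j' < n → addr k i j ≡ addr k' i' j' → k ≡ k' × i ≡ i' × j ≡ j'
        addr-inj {k} {k'} {i} {i'} {j} {j'} i< i'< j< j'< e with radix (k * n + i) (k' * n + i') j< j'< (+-cancelˡ-≡ O _ _ (trans (sym (+-assoc O j _)) (trans e (+-assoc O j' _))))
        ... | ej , e' with radix k k' i< i'< (trans (trans (+-comm i _) (cong (_+ i) (*-comm n k))) (trans e' (trans (cong (_+ i') (*-comm k' n)) (+-comm _ i'))))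
        ... | ei , ek = ek , ei , ej

        low≢addr : ∀ {a} k i j → a < O → a ≢ addr k i j
        low≢addr k i j p refl = <⇒≱ p (≤-trans (m≤m+n O j) (m≤m+n _ _))

        arrName≢tmpName : ∀ k s → arrName k ≢ tmpName s
        arrName≢tmpName zero s ()
        arrName≢tmpName (suc k) zero e with trans (sym (+-suc k k)) (suc-injective e)
        ... | ()
        arrName≢tmpName (suc k) (suc s) e = arrName≢tmpName k s (suc-injective (trans (sym (+-suc k k)) (trans (suc-injective e) (cong suc (+-suc s s)))))

        double-inj : ∀ k k' → k + k ≡ k' + k' → k ≡ k'
        double-inj zero zero e = refl
        double-inj (suc k) (suc k') e = cong suc (double-inj k k' (suc-injective (trans (sym (+-suc k k)) (trans (suc-injective e) (+-suc k' k')))))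

        arr≢tmp : ∀ k s {i j i' j'} → i < n → j < n → i' < n → j' < n → addr (arrName k) i j ≢ addr (tmpName s) i' j'
        arr≢tmp k s i< j< i'< j'< e = arrName≢tmpName k s (proj₁ (addr-inj {arrName k} {tmpName s} i< i'< j< j'< e))

        tmp-inj : ∀ s s' {i j i' j'} → i < n → j < n → i' < n → j' < n → addr (tmpName s) i j ≡ addr (tmpName s') i' j' → s ≡ s'
        tmp-inj s s' i< j< i'< j'< e = double-inj s s' (suc-injective (proj₁ (addr-inj {tmpName s} {tmpName s'} i< i'< j< j'< e)))

        record Regs (m : ℕ) (ρ : Vec ℕ m) (I : ℕ → ℕ) : Set where
          constructor regs
          field
            r0 : I 0 ≡ n
            r1 : I 1 ≡ 1
            r2 : I 2 ≡ 0
            r3 : I 3 ≡ O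
            rv : ∀ v → I (reg v) ≡ lookup ρ v
            bd : ∀ v → lookup ρ v < n
        open Regs

        -- What compiled code in the scope of `m` variables must preserve: the fixed registers 0 to
        -- 3 and the counters of the enclosing loops.
        Stable : ℕ → ℕ → Set
        Stable m r = r < 4 ⊎ (9 ≤ r × r < 9 + m)

        Stab : ℕ → (ℕ → ℕ) → (ℕ → ℕ) → Set
        Stab m I I' = ∀ r → Stable m r → I' r ≡ I r

        reg-≥ : ∀ {m} (v : Fin m) → 9 ≤ reg v
        reg-≥ {suc m} zero = m≤m+n 9 m
        reg-≥ {suc m} (suc v) = reg-≥ v

        reg-< : ∀ {m} (v : Fin m) → reg v < 9 + m
        reg-< {suc m} zero = ≤-reflexive (sym (+-suc 9 m))
        reg-< {suc m} (suc v) = ≤-trans (reg-< v) (≤-trans (n≤1+n _) (≤-reflexive (sym (+-suc 9 m))))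

        Stab-Regs : ∀ {m ρ I I'} → Stab m I I' → Regs m ρ I → Regs m ρ I'
        Stab-Regs st (regs a b c e v l) = regs (trans (st 0 (inj₁ (s≤s z≤n))) a) (trans (st 1 (inj₁ (s≤s (s≤s z≤n)))) b) (trans (st 2 (inj₁ (s≤s (s≤s (s≤s z≤n))))) c)
          (trans (st 3 (inj₁ (s≤s (s≤s (s≤s (s≤s z≤n)))))) e) (λ x → trans (st (reg x) (inj₂ (reg-≥ x , reg-< x))) (v x)) l

        Stab-trans : ∀ {m I I' I''} → Stab m I I' → Stab m I' I'' → Stab m I I''
        Stab-trans a b r s = trans (b r s) (a r s)

        Stab-suc : ∀ {m I I'} → Stab (suc m) I I' → Stab m I I'
        Stab-suc {m} st r (inj₁ p) = st r (inj₁ p)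
        Stab-suc {m} st r (inj₂ (p , q)) = st r (inj₂ (p , ≤-trans q (≤-trans (n≤1+n _) (≤-reflexive (sym (+-suc 9 m))))))

        Stab-upd : ∀ {m I v} → Stab m I (I [ 9 + m ≔ v ])
        Stab-upd {m} {I} {v} r s = upd-other I (9 + m) v (ne s)
          where
          ne : Stable m r → r ≢ 9 + m
          ne (inj₁ p) refl = <⇒≱ p (≤-trans (s≤s (s≤s (s≤s (s≤s z≤n)))) (m≤m+n 9 m))
          ne (inj₂ (_ , p)) refl = <-irrefl refl p

        data Target : ℕ → Set where
          five : Target 5
          six  : Target 6

        Keep : ℕ → (ℕ → ℕ) → (ℕ → ℕ) → Set
        Keep ra I I' = ∀ r → r ≢ 4 → r ≢ 8 → r ≢ ra → I' r ≡ I r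

        Stable-≢ : ∀ {m r a} → Stable m r → 4 ≤ a → a < 9 → r ≢ a
        Stable-≢ (inj₁ p) q _ refl = <⇒≱ p q
        Stable-≢ (inj₂ (p , _)) _ q refl = <⇒≱ q p

        4≤4+ : ∀ {a} → 4 ≤ 4 + a
        4≤4+ = s≤s (s≤s (s≤s (s≤s z≤n)))

        Keep-Stab : ∀ {m ra I I'} → Target ra → Keep ra I I' → Stab m I I'
        Keep-Stab {m} t k r s = k r (Stable-≢ s 4≤4+ (s≤s 4≤4+)) (Stable-≢ s 4≤4+ ≤-refl) (tgt t)
          where
          tgt : ∀ {ra} → Target ra → r ≢ ra
          tgt five = Stable-≢ s 4≤4+ (s≤s (s≤s 4≤4+))
          tgt six  = Stable-≢ s 4≤4+ (s≤s (s≤s (s≤s 4≤4+)))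

        spec-address : ∀ k ri rj {ra I R} → Target ra → ri ≢ 4 → rj ≢ 4 → I 0 ≡ n → I 1 ≡ 1 → I 3 ≡ O →
          Spec (address k ri rj ra) I R (addressTime n k) (λ I' R' → R' ≡ R × I' ra ≡ addr k (I ri) (I rj) × Keep ra I I')
        spec-address k ri rj {ra} {I} {R} t ri≢4 rj≢4 I0 I1 I3 =
          spec-seq {Q = λ I' R' → (I' 4 ≡ 0 × Keep4 I') × R' ≡ R} (spec-ins (λ _ _ → refl) ((upd-same I 4 0 , λ r p → upd-other I 4 0 p) , refl))
          λ { I₁ _ ((z , keep₁) , refl) →
          spec-seq (spec-repeat k (λ j I' → I' 4 ≡ j * n × Keep4 I') (z , keep₁) (λ j I' (e , keep) → spec-ins (λ _ _ → refl)
            ((trans (upd-same I' 4 _) (trans (cong₂ _+_ e (trans (keep 0 (λ ())) I0)) (+-comm (j * n) n)) , λ r p → trans (upd-other I' 4 _ p) (keep r p)) , refl)))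
          λ { I₂ _ ((e₂ , keep₂) , refl) →
          spec-seq {Q = λ I' R' → (I' 4 ≡ row × Keep4 I') × R' ≡ R} (spec-ins (λ _ _ → refl)
            ((trans (upd-same I₂ 4 _) (cong₂ _+_ e₂ (keep₂ ri ri≢4)) , λ r p → trans (upd-other I₂ 4 _ p) (keep₂ r p)) , refl))
          λ { I₃ _ ((e₃ , keep₃) , refl) →
          spec-seq {Q = λ I' R' → (I' ra ≡ O + I rj × I' 4 ≡ row × Keep ra I I') × R' ≡ R} (spec-ins (λ _ _ → refl)
            ((trans (upd-same I₃ ra _) (cong₂ _+_ (trans (keep₃ 3 (λ ())) I3) (keep₃ rj rj≢4)) , trans (upd-other I₃ ra _ (4≢ t)) e₃ , λ r p _ q → trans (upd-other I₃ ra _ q) (keep₃ r p)) , refl))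
          λ { I₄ _ ((e₄ , f₄ , keep₄) , refl) →
          spec-mono (spec-loop (λ q I' R' → R' ≡ R × I' ra ≡ (O + I rj) + q * row × I' 4 ≡ row × Keep ra I I') (λ ())
            (refl , trans (upd-other I₄ 8 0 (≢8 t)) (trans e₄ (sym (+-identityʳ _))) , trans (upd-other I₄ 8 0 {4} (λ ())) f₄ , λ r p q s → trans (upd-other I₄ 8 0 q) (keep₄ r p q s))
            λ { q I' _ q<n I8 (refl , e , f , keep) → spec-ins (λ _ _ → refl)
              ( trans (upd-other I' ra _ (λ z → ≢8 t (sym z))) I8
              , trans (upd-other I' ra _ (0≢ t)) (trans (keep 0 (λ ()) (λ ()) (0≢ t)) I0)
              , trans (upd-other I' ra _ (1≢ t)) (trans (keep 1 (λ ()) (λ ()) (1≢ t)) I1)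
              , refl
              , trans (upd-other (I' [ ra ≔ _ ]) 8 _ (≢8 t)) (trans (upd-same I' ra _) (trans (cong₂ _+_ e f) (trans (+-assoc (O + I rj) (q * row) row) (cong ((O + I rj) +_) (+-comm (q * row) row)))))
              , trans (upd-other (I' [ ra ≔ I' ra + I' 4 ]) 8 (suc q) {4} (λ ())) (trans (upd-other I' ra _ (4≢ t)) f)
              , λ r p u s → trans (upd-other (I' [ ra ≔ _ ]) 8 _ u) (trans (upd-other I' ra _ s) (keep r p u s))) })
          λ { I₅ R₅ (a , b , _ , c) → a , b , c } } } } }
          where
          row = k * n + I ri
          Keep4 : (ℕ → ℕ) → Set
          Keep4 I' = ∀ r → r ≢ 4 → I' r ≡ I r
          0≢ : ∀ {ra} → Target ra → 0 ≢ ra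
          0≢ five ()
          0≢ six ()
          1≢ : ∀ {ra} → Target ra → 1 ≢ ra
          1≢ five ()
          1≢ six ()
          4≢ : ∀ {ra} → Target ra → 4 ≢ ra
          4≢ five ()
          4≢ six ()
          ≢8 : ∀ {ra} → Target ra → ra ≢ 8
          ≢8 five ()
          ≢8 six ()

        -- The frame condition of the stack discipline at height `s`.
        Frame : ℕ → (ℕ → ℝ) → (ℕ → ℝ) → Set
        Frame s R R' = ∀ a → (∀ s' → s ≤ s' → a ≢ tmp s') → R' a ≡ R a

        Frame-suc : ∀ {s R R'} → Frame (suc s) R R' → Frame s R R'
        Frame-suc {s} f a h = f a λ s' le → h s' (≤-trans (n≤1+n s) le)

        Frame-trans : ∀ {s R R' R''} → Frame s R R' → Frame s R' R'' → Frame s R R''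
        Frame-trans f g a h = trans (g a h) (f a h)

        Frame-upd : ∀ {s R v} → Frame s R (R [ tmp s ≔ v ])
        Frame-upd {s} {R} {v} a h = upd-other R (tmp s) v (h s ≤-refl)

        tmp-kept : ∀ {s R R'} → Frame (suc s) R R' → R' (tmp s) ≡ R (tmp s)
        tmp-kept {s} f = f (tmp s) λ s' le e → <-irrefl (tmp-inj s s' 1≤n 1≤n 1≤n 1≤n e) le

        Sim : Store → (ℕ → ℝ) → Set
        Sim σ R = (∀ k i j → i < n → j < n → R (addr (arrName k) i j) ≡ σ k i j) × (∀ a → a < O → R a ≡ low a)

        Frame-Sim : ∀ {s σ R R'} → Frame s R R' → Sim σ R → Sim σ R'
        Frame-Sim f (sim , lo) = (λ k i j p q → trans (f _ λ s' _ → arr≢tmp k s' p q 1≤n 1≤n) (sim k i j p q)) , λ a p → trans (f a λ s' _ → low≢addr (tmpName s') 0 0 p) (lo a p)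

        -- `J` speaks of real memory only: the bookkeeping of registers is done here once and for
        -- all, and the loop counter becomes variable `zero` of the body.
        ctx-loop : ∀ {m ρ I R body b} (J : ℕ → (ℕ → ℝ) → Set) → Regs m ρ I → J 0 R →
          (∀ q I' R' → q < n → Regs (suc m) (q ∷ ρ) I' → J q R' → Spec body I' R' b (λ I'' R'' → Stab (suc m) I' I'' × J (suc q) R'')) →
          Spec (loop (9 + m) body) I R (loopTime n b) (λ I' R' → Stab m I I' × J n R')
        ctx-loop {m} {ρ} {I} J g j0 f = spec-loop (λ q I' R' → Stab m I I' × J q R') (λ ()) (Stab-upd , j0)
          λ q I' R' q<n e (st , j) → spec-mono (f q I' R' q<n (extend q I' q<n e (Stab-Regs st g)) j)
            λ I'' R'' (st' , j') → trans (st' (9 + m) (inj₂ (m≤m+n 9 m , ≤-reflexive (sym (+-suc 9 m))))) e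
              , r0 (Stab-Regs (Stab-suc st') (Stab-Regs st g)) , r1 (Stab-Regs (Stab-suc st') (Stab-Regs st g))
              , Stab-trans (Stab-trans st (Stab-suc st')) Stab-upd , j'
          where
          extend : ∀ q I' → q < n → I' (9 + m) ≡ q → Regs m ρ I' → Regs (suc m) (q ∷ ρ) I'
          extend q I' q<n e (regs a b c d v l) = regs a b c d (λ { zero → e ; (suc x) → v x }) (λ { zero → q<n ; (suc x) → l x })

        reg≢4 : ∀ {m} (v : Fin m) → reg v ≢ 4
        reg≢4 v e = <⇒≱ (≤-trans (s≤s 4≤4+) (reg-≥ v)) (≤-reflexive e)

        spec-addrT : ∀ {m ρ I R ra} s → Target ra → Regs m ρ I →
          Spec (addrT s ra) I R (addressTime n (tmpName s)) (λ I' R' → R' ≡ R × I' ra ≡ tmp s × Keep ra I I')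
        spec-addrT {I = I} s t g = spec-mono (spec-address (tmpName s) 2 2 t (λ ()) (λ ()) (r0 g) (r1 g) (r3 g))
          λ _ _ (a , b , c) → a , trans b (cong₂ (addr (tmpName s)) (r2 g) (r2 g)) , c

        spec-addrA : ∀ {m ρ I R ra} k (i j : Fin m) → Target ra → Regs m ρ I →
          Spec (address k (reg i) (reg j) ra) I R (addressTime n k) (λ I' R' → R' ≡ R × I' ra ≡ addr k (lookup ρ i) (lookup ρ j) × Keep ra I I')
        spec-addrA k i j t g = spec-mono (spec-address k (reg i) (reg j) t (reg≢4 i) (reg≢4 j) (r0 g) (r1 g) (r3 g))
          λ _ _ (a , b , c) → a , trans b (cong₂ (addr k) (rv g i) (rv g j)) , c

        OpSpec : Code → (ℝ → ℝ → ℝ) → Set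
        OpSpec op f = ∀ I R → Spec op I R 3 (λ I' R' → I' ≡ I × R' ≡ R [ I 5 ≔ f (R (I 5)) (R (I 6)) ])

        op-ins : ∀ {i f} → (∀ bit p I R → exec i bit ⟨ p , I , R ⟩ ≡ ⟨ suc p , I , R [ I 5 ≔ f (R (I 5)) (R (I 6)) ] ⟩) → OpSpec (ins i) f
        op-ins h I R = spec-bound (s≤s z≤n) (spec-ins (λ bit p → h bit p I R) (refl , refl))

        spec-select01 : ∀ {test I R} (b : Bool) → (∀ bit p l → exec (test l) bit ⟨ p , I , R ⟩ ≡ ⟨ (if b then l else suc p) , I , R ⟩) →
          Spec (select01 test) I R 3 (λ I' R' → I' ≡ I × R' ≡ R [ I 5 ≔ (if b then 1# else 0#) ])
        exe (spec-select01 {test} {I} {R} true h) prog p (e₁ , e₂ , e₃ , e₄ , _) = 2 , I , _ , s≤s (s≤s z≤n) ,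
          next e₁ (λ bit → h bit p _) (next e₄ (λ _ → cong (λ z → ⟨ z , I , R [ I 5 ≔ 1# ] ⟩) (+-comm 4 p)) done) , refl , refl
        exe (spec-select01 {test} {I} {R} false h) prog p (e₁ , e₂ , e₃ , e₄ , _) = 3 , I , _ , ≤-refl ,
          next e₁ (λ bit → h bit p _) (next e₂ (λ _ → refl) (next e₃ (λ _ → cong (λ z → ⟨ z , I , R [ I 5 ≔ R (I 5) -ᵣ R (I 5) ] ⟩) (+-comm 4 p)) done)) , refl , cong (R [ I 5 ≔_]) (x-x≡0 (R (I 5)))

        op-add : OpSpec (ins (radd 5 5 6)) _+ᵣ_
        op-add = op-ins {f = _+ᵣ_} λ _ _ _ _ → refl

        op-sub : OpSpec (ins (rsub 5 5 6)) _-ᵣ_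
        op-sub = op-ins {f = _-ᵣ_} λ _ _ _ _ → refl

        op-mul : OpSpec (ins (rmul 5 5 6)) _*ᵣ_
        op-mul = op-ins {f = _*ᵣ_} λ _ _ _ _ → refl

        op-div : OpSpec (ins (rdiv 5 5 6)) (λ x y → x *ᵣ y ⁻¹)
        op-div = op-ins {f = λ x y → x *ᵣ y ⁻¹} λ _ _ _ _ → refl

        op-lt : OpSpec (select01 (rjumplt 5 6)) (λ x y → if does (x <?ᵣ y) then 1# else 0#)
        op-lt I R = spec-select01 {test = rjumplt 5 6} (does (R (I 5) <?ᵣ R (I 6))) (λ _ _ _ → refl)

        spec-binary : ∀ {m ρ I R op f} s → OpSpec op f → Regs m ρ I → Spec (binary s op) I R (binaryTime n s)
          (λ I' R' → Stab m I I' × R' (tmp s) ≡ f (R (tmp s)) (R (tmp (suc s))) × Frame s R R')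
        spec-binary {m} {ρ} {I} {R} {op} {f} s ops g =
          spec-seq (spec-addrT (suc s) six g) λ { I₁ _ (refl , e₁ , k₁) →
          spec-seq (spec-addrT s five (Stab-Regs (Keep-Stab six k₁) g)) λ { I₂ _ (refl , e₂ , k₂) →
          spec-mono (ops I₂ R) λ { _ _ (refl , refl) → Stab-trans (Keep-Stab six k₁) (Keep-Stab five k₂) ,
            subst (λ z → (R [ z ≔ f (R z) (R (I₂ 6)) ]) (tmp s) ≡ f (R (tmp s)) (R (tmp (suc s)))) (sym e₂)
              (trans (upd-same R (tmp s) _) (cong (λ z → f (R (tmp s)) (R z)) (trans (k₂ 6 (λ ()) (λ ()) (λ ())) e₁))) ,
            subst (λ z → Frame s R (R [ z ≔ f (R z) (R (I₂ 6)) ])) (sym e₂) Frame-upd } } }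

        EPost : ∀ {m} → Expr m → ℕ → Vec ℕ m → Store → (ℕ → ℕ) → (ℕ → ℝ) → (ℕ → ℕ) → (ℕ → ℝ) → Set
        EPost {m} e s ρ σ I R I' R' = Stab m I I' × R' (tmp s) ≡ eval e ρ σ × Frame s R R'

        spec-2 : ∀ {m ρ σ I R op f} (e e' : Expr m) s → OpSpec op f → Regs m ρ I → Sim σ R → 
          Spec (compE e s) I R (timeE n e s) (EPost e s ρ σ I R) →
          (∀ I₁ R₁ → Regs m ρ I₁ → Sim σ R₁ → Spec (compE e' (suc s)) I₁ R₁ (timeE n e' (suc s)) (EPost e' (suc s) ρ σ I₁ R₁)) →
          Spec (compE e s ⨾ compE e' (suc s) ⨾ binary s op) I R (timeE n e s + (timeE n e' (suc s) + binaryTime n s))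
            (λ I' R' → Stab m I I' × R' (tmp s) ≡ f (eval e ρ σ) (eval e' ρ σ) × Frame s R R')
        spec-2 {f = f} e e' s ops g sim sp sp' =
          spec-seq sp λ { I₁ R₁ (st₁ , v₁ , f₁) →
          spec-seq (sp' I₁ R₁ (Stab-Regs st₁ g) (Frame-Sim f₁ sim)) λ { I₂ R₂ (st₂ , v₂ , f₂) →
          spec-mono (spec-binary {f = f} s ops (Stab-Regs st₂ (Stab-Regs st₁ g))) λ { I₃ R₃ (st₃ , v₃ , f₃) →
            Stab-trans st₁ (Stab-trans st₂ st₃) , trans v₃ (cong₂ f (trans (tmp-kept f₂) v₁) v₂) , Frame-trans f₁ (Frame-trans (Frame-suc f₂) f₃) } } }

        inp-bound : ∀ a b i → a ≤ d → b ≤ d → i < n → a * i + b < O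
        inp-bound a b i a≤ b≤ i<n = ≤-trans (s≤s (≤-trans (+-mono-≤ (*-monoˡ-≤ i a≤) b≤) (≤-trans (≤-reflexive (trans (+-comm (d * i) d) (sym (*-suc d i)))) (*-monoʳ-≤ d i<n)))) (+-monoˡ-≤ (d * n) 1≤n)

        spec-tmp : ∀ {m ρ I R i b v} s → (∀ I' → I' 5 ≡ tmp s → Keep 5 I I' → Spec i I' R b (λ I'' R'' → I'' ≡ I' × R'' ≡ R [ I' 5 ≔ v ])) → Regs m ρ I →
          Spec (addrT s 5 ⨾ i) I R (addressTime n (tmpName s) + b) (λ I' R' → Stab m I I' × R' (tmp s) ≡ v × Frame s R R')
        spec-tmp {R = R} {v = v} s h g = spec-seq (spec-addrT s five g) λ { I₁ _ (refl , e , k) → spec-mono (h I₁ e k) λ { _ _ (refl , refl) →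
          Keep-Stab five k , trans (cong (λ z → (R [ z ≔ v ]) (tmp s)) e) (upd-same R (tmp s) v) , subst (λ z → Frame s R (R [ z ≔ v ])) (sym e) Frame-upd } }

        -- One argument for sums and products: `F` is `Σ<` or `Π<`, and `f` its step operation.
        spec-acc : ∀ {m ρ σ I R op f} (F : ℕ → (ℕ → ℝ) → ℝ) (e : Expr (suc m)) s → OpSpec op f → (∀ q g → F (suc q) g ≡ f (F q g) (g q)) →
          Regs m ρ I → Sim σ R → R (tmp s) ≡ F 0 (λ i → eval e (i ∷ ρ) σ) →
          (∀ q I₁ R₁ → Regs (suc m) (q ∷ ρ) I₁ → Sim σ R₁ → Spec (compE e (suc s)) I₁ R₁ (timeE n e (suc s)) (EPost e (suc s) (q ∷ ρ) σ I₁ R₁)) →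
          Spec (loop (9 + m) (compE e (suc s) ⨾ binary s op)) I R (loopTime n (timeE n e (suc s) + binaryTime n s))
            (λ I' R' → Stab m I I' × (R' (tmp s) ≡ F n (λ i → eval e (i ∷ ρ) σ) × Frame s R R'))
        spec-acc {m} {ρ} {σ} {I} {R} {op} {f} F e s ops F-suc g sim z sp =
          ctx-loop (λ q R' → R' (tmp s) ≡ F q (λ i → eval e (i ∷ ρ) σ) × Frame s R R') g (z , λ _ _ → refl)
          λ { q I₁ R₁ q<n g₁ (v₁ , f₁) →
            spec-seq (sp q I₁ R₁ g₁ (Frame-Sim f₁ sim)) λ { I₂ R₂ (st₂ , v₂ , f₂) →
            spec-mono (spec-binary {f = f} s ops (Stab-Regs st₂ g₁)) λ { I₃ R₃ (st₃ , v₃ , f₃) →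
              Stab-trans st₂ st₃ , trans v₃ (trans (cong₂ f (trans (tmp-kept f₂) v₁) v₂) (sym (F-suc q _))) , Frame-trans f₁ (Frame-trans (Frame-suc f₂) f₃) } } }

        spec-E : ∀ {m ρ σ I R} (e : Expr m) s → Regs m ρ I → Sim σ R → Spec (compE e s) I R (timeE n e s) (EPost e s ρ σ I R)
        spec-E {R = R} nil s g sim = spec-tmp s (λ I' _ _ → spec-ins (λ _ _ → refl) (refl , cong (R [ I' 5 ≔_]) (x-x≡0 (R (I' 5))))) g
        spec-E one s g sim = spec-tmp s (λ _ _ _ → spec-ins (λ _ _ → refl) (refl , refl)) g
        spec-E {ρ = ρ} {σ} {I} {R} (arr k i j) s g (sim , lo) =
          spec-seq (spec-addrA (arrName k) i j six g) λ { I₁ _ (refl , e₁ , k₁) →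
          spec-mono (spec-tmp {v = σ k (lookup ρ i) (lookup ρ j)} s (λ I' e k → spec-ins (λ _ _ → refl)
            (refl , cong (R [ I' 5 ≔_]) (trans (cong R (trans (k 6 (λ ()) (λ ()) (λ ())) e₁)) (sim _ _ _ (bd g i) (bd g j))))) (Stab-Regs (Keep-Stab six k₁) g))
            λ I' R' (st , v , f) → Stab-trans (Keep-Stab six k₁) st , v , f }
        spec-E {m} {ρ} {σ} {I} {R} (inp a i b a≤ b≤) s g (sim , lo) =
          spec-seq {Q = λ I' R' → (I' 6 ≡ 0 * lookup ρ i + b × Keep 6 I I') × R' ≡ R} (spec-ins (λ _ _ → refl) ((upd-same I 6 b , λ r _ _ p → upd-other I 6 b p) , refl))
          λ { I₀ _ (p₀ , refl) →
          spec-seq (spec-repeat a (λ c I' → I' 6 ≡ c * lookup ρ i + b × Keep 6 I I') p₀ (λ c I' (e , kp) → spec-ins (λ _ _ → refl)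
            ((trans (upd-same I' 6 _) (trans (cong₂ _+_ e (trans (Keep-Stab six kp (reg i) (inj₂ (reg-≥ i , reg-< i))) (rv g i))) (trans (+-comm _ (lookup ρ i)) (sym (+-assoc (lookup ρ i) _ b))))
              , λ r p q u → trans (upd-other I' 6 _ u) (kp r p q u)) , refl)))
          λ { I₁ _ ((e₁ , k₁) , refl) →
          spec-mono (spec-tmp {v = low (a * lookup ρ i + b)} s (λ I' e k → spec-ins (λ _ _ → refl)
            (refl , cong (R [ I' 5 ≔_]) (trans (cong R (trans (k 6 (λ ()) (λ ()) (λ ())) e₁)) (lo _ (inp-bound a b _ a≤ b≤ (bd g i)))))) (Stab-Regs (Keep-Stab six k₁) g))
            λ I' R' (st , v , f) → Stab-trans (Keep-Stab six k₁) st , v , f } }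
        spec-E (add e e') s g sim = spec-2 {f = _+ᵣ_} e e' s op-add g sim (spec-E e s g sim) (λ _ _ → spec-E e' (suc s))
        spec-E (sub e e') s g sim = spec-2 {f = _-ᵣ_} e e' s op-sub g sim (spec-E e s g sim) (λ _ _ → spec-E e' (suc s))
        spec-E (mul e e') s g sim = spec-2 {f = _*ᵣ_} e e' s op-mul g sim (spec-E e s g sim) (λ _ _ → spec-E e' (suc s))
        spec-E (div e e') s g sim = spec-2 {f = λ x y → x *ᵣ y ⁻¹} e e' s op-div g sim (spec-E e s g sim) (λ _ _ → spec-E e' (suc s))
        spec-E (lt e e') s g sim = spec-2 {f = λ x y → if does (x <?ᵣ y) then 1# else 0#} e e' s op-lt g sim (spec-E e s g sim) (λ _ _ → spec-E e' (suc s))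
        spec-E {ρ = ρ} {σ} (expE e) s g sim =
          spec-seq (spec-E e s g sim) λ { I₁ R₁ (st₁ , v₁ , f₁) →
          spec-mono (spec-tmp {v = exp (eval e ρ σ)} s (λ I' e₅ k → spec-ins (λ _ _ → refl) (refl , cong (λ z → R₁ [ I' 5 ≔ exp z ]) (trans (cong R₁ e₅) v₁))) (Stab-Regs st₁ g))
            λ I' R' (st , v , f) → Stab-trans st₁ st , v , Frame-trans f₁ f }
        spec-E {ρ = ρ} (ltI i j) s g sim = spec-tmp {i = select01 (ijumplt (reg i) (reg j))} s (λ I' e k → spec-select01 {test = ijumplt (reg i) (reg j)} (lookup ρ i <ᵇ lookup ρ j)
          λ _ p l → cong₂ (λ x y → ⟨ (if x <ᵇ y then l else suc p) , I' , _ ⟩) (look I' k i) (look I' k j)) g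
          where
          look : ∀ I' → Keep 5 _ I' → ∀ v → I' (reg v) ≡ lookup ρ v
          look I' k v = trans (Keep-Stab five k (reg v) (inj₂ (reg-≥ v , reg-< v))) (rv g v)
        spec-E {m} {ρ} {σ} {I} {R} (sumE e) s g sim =
          spec-seq (spec-addrT s five g) λ { I₁ _ (refl , e₁ , k₁) →
          spec-seq {Q = λ I' R' → I' ≡ I₁ × R' ≡ R [ I₁ 5 ≔ 1# ]} (spec-ins (λ _ _ → refl) (refl , refl)) λ { _ R₂ (refl , refl) →
          spec-seq {Q = λ I' R' → I' ≡ I₁ × R' (tmp s) ≡ 0# × Frame s R R'} (spec-ins (λ _ _ → refl) (refl ,
              trans (cong (λ z → (R₂ [ z ≔ R₂ z -ᵣ R₂ z ]) (tmp s)) e₁) (trans (upd-same R₂ (tmp s) _) (x-x≡0 _)) ,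
              λ a h → trans (upd-other R₂ (I₁ 5) _ (subst (a ≢_) (sym e₁) (h s ≤-refl))) (upd-other R (I₁ 5) 1# (subst (a ≢_) (sym e₁) (h s ≤-refl)))))
          λ { _ R₃ (refl , z₃ , f₃) →
          spec-mono (spec-acc {f = _+ᵣ_} Σ< e s op-add (λ _ _ → refl) (Stab-Regs (Keep-Stab five k₁) g) (Frame-Sim f₃ sim) z₃ (λ _ _ _ → spec-E e (suc s)))
            λ I' R' (st , v , f) → Stab-trans (Keep-Stab five k₁) st , v , Frame-trans f₃ f } } }
        spec-E {m} {ρ} {σ} {I} {R} (prodE e) s g sim =
          spec-seq (spec-addrT s five g) λ { I₁ _ (refl , e₁ , k₁) →
          spec-seq {Q = λ I' R' → I' ≡ I₁ × R' (tmp s) ≡ 1# × Frame s R R'} (spec-ins (λ _ _ → refl) (refl ,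
              trans (cong (λ z → (R [ z ≔ 1# ]) (tmp s)) e₁) (upd-same R (tmp s) _) ,
              λ a h → upd-other R (I₁ 5) 1# (subst (a ≢_) (sym e₁) (h s ≤-refl))))
          λ { _ R₃ (refl , z₃ , f₃) →
          spec-mono (spec-acc {f = _*ᵣ_} Π< e s op-mul (λ _ _ → refl) (Stab-Regs (Keep-Stab five k₁) g) (Frame-Sim f₃ sim) z₃ (λ _ _ _ → spec-E e (suc s)))
            λ I' R' (st , v , f) → Stab-trans (Keep-Stab five k₁) st , v , Frame-trans f₃ f } }

        upd-cases : ∀ (R : ℕ → ℝ) a v b {x} → (b ≡ a → v ≡ x) → R b ≡ x → (R [ a ≔ v ]) b ≡ x
        upd-cases R a v b same other with b ℕ.≟ a
        ... | yes refl = trans (upd-same R a v) (same refl)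
        ... | no b≢a = trans (upd-other R a v b≢a) other

        spec-copy : ∀ {m ρ I R} k (src : Code) b (x : ℕ) (i j : Fin m) → Regs m ρ I →
          Spec src I R b (λ I' R' → R' ≡ R × I' 6 ≡ x × Keep 6 I I') →
          Spec (src ⨾ address k (reg i) (reg j) 5 ⨾ ins (rcopy 5 6)) I R (b + (addressTime n k + 1))
            (λ I' R' → Stab m I I' × R' ≡ R [ addr k (lookup ρ i) (lookup ρ j) ≔ R x ])
        spec-copy {R = R} k src b x i j g sp =
          spec-seq sp λ { I₁ _ (refl , e₁ , k₁) →
          spec-seq (spec-addrA k i j five (Stab-Regs (Keep-Stab six k₁) g)) λ { I₂ _ (refl , e₂ , k₂) →
          spec-ins (λ _ _ → refl) (Stab-trans (Keep-Stab six k₁) (Keep-Stab five k₂) ,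
            cong₂ (λ y z → R [ y ≔ R z ]) e₂ (trans (k₂ 6 (λ ()) (λ ()) (λ ())) e₁)) } }

        module Tab {m : ℕ} (ρ : Vec ℕ m) (σ : Store) (k : ℕ) (e : Expr (suc (suc m))) where
          val : ℕ → ℕ → ℝ
          val i j = eval e (i ∷ j ∷ ρ) σ

          scratch : ℕ → ℕ → ℕ
          scratch = addr (tmpName 0)

          target : ℕ → ℕ → ℕ
          target = addr (arrName k)

          Filled : (ℕ → ℕ → ℕ) → ℕ → (ℕ → ℝ) → Set
          Filled loc q R = ∀ i j → i < n → j < q → R (loc i j) ≡ val i j

          FilledRow : (ℕ → ℕ → ℕ) → ℕ → ℕ → (ℕ → ℝ) → Set
          FilledRow loc j q R = ∀ i → i < q → R (loc i j) ≡ val i j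

          Others : (ℕ → ℝ) → Set
          Others R = (∀ k' i j → k' ≢ k → i < n → j < n → R (addr (arrName k') i j) ≡ σ k' i j) × (∀ a → a < O → R a ≡ low a)

          fill-upd : ∀ k₀ R {q i j v} → i < n → j < n → q ≤ n → v ≡ val i j → Filled (addr k₀) q R → Filled (addr k₀) q (R [ addr k₀ i j ≔ v ])
          fill-upd k₀ R {q} {i} {j} {v} i<n j<n q≤n ev f i' j' i'<n j'<q = upd-cases R _ v _ (λ eq → same (addr-inj {k₀} {k₀} i'<n i<n (≤-trans j'<q q≤n) j<n eq)) (f i' j' i'<n j'<q)
            where
            same : k₀ ≡ k₀ × i' ≡ i × j' ≡ j → v ≡ val i' j'
            same (_ , refl , refl) = ev

          row-upd : ∀ k₀ R {q j v} → q < n → j < n → v ≡ val q j → FilledRow (addr k₀) j q R → FilledRow (addr k₀) j (suc q) (R [ addr k₀ q j ≔ v ])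
          row-upd k₀ R {q} {j} {v} q<n j<n ev f i i<1+q with i ℕ.≟ q
          ... | yes refl = trans (upd-same R _ v) ev
          ... | no i≢q = upd-cases R _ v _ (λ eq → ⊥-elim (i≢q (proj₁ (proj₂ (addr-inj {k₀} {k₀} (≤-trans i<1+q q<n) q<n j<n j<n eq))))) (f i (≤∧≢⇒< (ℕ.s≤s⁻¹ i<1+q) i≢q))

          close-row : ∀ loc R {q} → Filled loc q R × FilledRow loc q n R → Filled loc (suc q) R
          close-row loc R {q} (f , r) i j i<n j<1+q with j ℕ.≟ q
          ... | yes refl = r i i<n
          ... | no j≢q = f i j i<n (≤∧≢⇒< (ℕ.s≤s⁻¹ j<1+q) j≢q)

          fill-frame : ∀ R R' {q} → q ≤ n → Frame 1 R R' → Filled scratch q R → Filled scratch q R'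
          fill-frame R R' q≤n f h i j i<n j<q = trans (f _ λ s' 1≤s' eq → <⇒≱ 1≤s' (≤-reflexive (sym (tmp-inj 0 s' i<n (≤-trans j<q q≤n) 1≤n 1≤n eq)))) (h i j i<n j<q)

          row-frame : ∀ R R' {q j} → q ≤ n → j < n → Frame 1 R R' → FilledRow scratch j q R → FilledRow scratch j q R'
          row-frame R R' q≤n j<n f h i i<q = trans (f _ λ s' 1≤s' eq → <⇒≱ 1≤s' (≤-reflexive (sym (tmp-inj 0 s' (≤-trans i<q q≤n) j<n 1≤n 1≤n eq)))) (h i i<q)

          sim-upd : ∀ {R i j v} → i < n → j < n → Sim σ R → Sim σ (R [ scratch i j ≔ v ])
          sim-upd {R} {i} {j} {v} i<n j<n (sim , lo) = (λ k' i' j' p q → trans (upd-other R _ v (arr≢tmp k' 0 p q i<n j<n)) (sim k' i' j' p q)) ,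
            λ a p → trans (upd-other R _ v (low≢addr (tmpName 0) i j p)) (lo a p)

          others-upd : ∀ {R i j v} → i < n → j < n → Others R → Others (R [ target i j ≔ v ])
          others-upd {R} {i} {j} {v} i<n j<n (sim , lo) = (λ k' i' j' ne p q → trans (upd-other R _ v λ eq → ne (double-inj k' k (proj₁ (addr-inj {arrName k'} {arrName k} p i<n q j<n eq)))) (sim k' i' j' ne p q)) ,
            λ a p → trans (upd-other R _ v (low≢addr (arrName k) i j p)) (lo a p)

          scratch-upd : ∀ R {i j v} → i < n → j < n → Filled scratch n R → Filled scratch n (R [ target i j ≔ v ])
          scratch-upd R i<n j<n f i' j' p q = trans (upd-other R _ _ λ eq → arr≢tmp k 0 i<n j<n p q (sym eq)) (f i' j' p q)

          fillBody copyBody : Code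
          fillBody = compE e 1 ⨾ addrT 1 6 ⨾ address (tmpName 0) (10 + m) (9 + m) 5 ⨾ ins (rcopy 5 6)
          copyBody = address (tmpName 0) (10 + m) (9 + m) 6 ⨾ address (arrName k) (10 + m) (9 + m) 5 ⨾ ins (rcopy 5 6)

          -- Evaluating `e` at height 1 keeps the scratch array, which belongs to temporary 0, and
          -- filling that array keeps the program's arrays and the input; so every entry is
          -- evaluated in the store `σ`.
          fillScratch : ∀ {I R} → Regs m ρ I → Sim σ R →
            Spec (loop (9 + m) (loop (10 + m) fillBody)) I R
              (loopTime n (loopTime n (timeE n e 1 + (addressTime n (tmpName 1) + (addressTime n (tmpName 0) + 1)))))
              (λ I' R' → Stab m I I' × Sim σ R' × Filled scratch n R')
          fillScratch {I} {R} g sim = ctx-loop {body = loop (10 + m) fillBody} (λ q R' → Sim σ R' × Filled scratch q R') g (sim , λ i j _ ()) λ { j I₁ R₁ j<n g₁ (sim₁ , f₁) →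
            spec-mono (ctx-loop {body = fillBody} (λ q R' → Sim σ R' × Filled scratch j R' × FilledRow scratch j q R') g₁ (sim₁ , f₁ , λ i ()) λ { i I₂ R₂ i<n g₂ (sim₂ , f₂ , r₂) →
              spec-seq {b = addrT 1 6 ⨾ address (tmpName 0) (10 + m) (9 + m) 5 ⨾ ins (rcopy 5 6)} (spec-E e 1 g₂ sim₂) λ { I₃ R₃ (st₃ , v₃ , fr₃) →
              spec-mono (spec-copy (tmpName 0) (addrT 1 6) (addressTime n (tmpName 1)) (tmp 1) zero (suc zero) (Stab-Regs st₃ g₂) (spec-addrT 1 six (Stab-Regs st₃ g₂))) λ { I₄ _ (st₄ , refl) →
                Stab-trans st₃ st₄ , sim-upd i<n j<n (Frame-Sim fr₃ sim₂) , fill-upd (tmpName 0) R₃ i<n j<n (<⇒≤ j<n) v₃ (fill-frame R₂ R₃ (<⇒≤ j<n) fr₃ f₂) , row-upd (tmpName 0) R₃ i<n j<n v₃ (row-frame R₂ R₃ (<⇒≤ i<n) j<n fr₃ r₂) } } })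
            λ I' R' (st , s' , f' , r') → st , s' , close-row scratch R' (f' , r') }

          -- While array `k` is partly overwritten, the simulation is claimed only for the `Others`.
          copyBack : ∀ {I R} → Regs m ρ I → Sim σ R → Filled scratch n R →
            Spec (loop (9 + m) (loop (10 + m) copyBody)) I R
              (loopTime n (loopTime n (addressTime n (tmpName 0) + (addressTime n (arrName k) + 1))))
              (λ I' R' → Stab m I I' × Others R' × Filled scratch n R' × Filled target n R')
          copyBack {I} {R} g (sim , lo) fs = ctx-loop {body = loop (10 + m) copyBody} (λ q R' → Others R' × Filled scratch n R' × Filled target q R') g (((λ k' i j _ → sim k' i j) , lo) , fs , λ i j _ ()) λ { j I₁ R₁ j<n g₁ (o₁ , s₁ , f₁) →
            spec-mono (ctx-loop {body = copyBody} (λ q R' → Others R' × Filled scratch n R' × Filled target j R' × FilledRow target j q R') g₁ (o₁ , s₁ , f₁ , λ i ()) λ { i I₂ R₂ i<n g₂ (o₂ , s₂ , f₂ , r₂) →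
              spec-mono (spec-copy (arrName k) (address (tmpName 0) (10 + m) (9 + m) 6) (addressTime n (tmpName 0)) (scratch i j) zero (suc zero) g₂ (spec-addrA (tmpName 0) zero (suc zero) six g₂)) λ { I₄ _ (st₄ , refl) →
                st₄ , others-upd {R₂} i<n j<n o₂ , scratch-upd R₂ i<n j<n s₂ , fill-upd (arrName k) R₂ i<n j<n (<⇒≤ j<n) (s₂ i j i<n j<n) f₂ , row-upd (arrName k) R₂ i<n j<n (s₂ i j i<n j<n) r₂ } })
            λ I' R' (st , o' , s' , f' , r') → st , o' , s' , close-row target R' (f' , r') }

          finish : ∀ {R} → Others R → Filled target n R → Sim (effect (tab k e) ρ σ) R
          finish {R} (o , lo) f = entries , lo
            where
            entries : ∀ k' i j → i < n → j < n → R (addr (arrName k') i j) ≡ (if k' ≡ᵇ k then val i j else σ k' i j)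
            entries k' i j p q with k' ≡ᵇ k | ≡ᵇ⇒≡ k' k | ≡⇒≡ᵇ k' k
            ... | true  | eq | _  = trans (cong (λ z → R (addr (arrName z) i j)) (eq tt)) (f i j p q)
            ... | false | _  | ne = o k' i j (λ z → ne z) p q

        spec-C : ∀ {m ρ σ I R} (c : Cmd m) → Regs m ρ I → Sim σ R → Spec (compC c) I R (timeC n c) (λ I' R' → Stab m I I' × Sim (effect c ρ σ) R')
        spec-C {m} {ρ} {σ} (tab k e) g sim =
          spec-seq (T.fillScratch g sim) λ { I₁ R₁ (st₁ , sim₁ , f₁) →
          spec-mono (T.copyBack (Stab-Regs st₁ g) sim₁ f₁) λ { I₂ R₂ (st₂ , o₂ , _ , f₂) → Stab-trans st₁ st₂ , T.finish o₂ f₂ } }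
          where module T = Tab ρ σ k e
        spec-C (c ⟫ c') g sim = spec-seq (spec-C c g sim) λ { I₁ R₁ (st₁ , sim₁) →
          spec-mono (spec-C c' (Stab-Regs st₁ g) sim₁) λ { I₂ R₂ (st₂ , sim₂) → Stab-trans st₁ st₂ , sim₂ } }
        spec-C {m} {ρ} {σ} (for c) g sim = ctx-loop (λ q R' → Sim (iterate q (λ i → effect c (i ∷ ρ)) σ) R') g sim
          λ q I' R' q<n g' sim' → spec-C c g' sim'

        -- The initial store is whatever the array area contains; nothing is assumed about it. The
        -- final state is the same for all `ω` and for all `T` above the time bound.
        compile-correct : ∀ c k I₀ R₀ → I₀ 0 ≡ n → (∀ a → a < O → R₀ a ≡ low a) → let σ₀ = λ k i j → R₀ (addr (arrName k) i j) in
          ∃[ s ] Halted (compile c k) s × (∀ p → p < n → R s p ≡ effect c [] σ₀ k p p) × (∀ {T} → time n c k ≤ T → (ω : Vec Bool T) → run (compile c k) ω ⟨ 0 , I₀ , R₀ ⟩ ≡ s)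
        compile-correct c k I₀ R₀ I0 lo with exe whole (compile c k) 0 (At-suffix [] (compile c k))
          where
          σ₀ : Store
          σ₀ k i j = R₀ (addr (arrName k) i j)
          whole : Spec _ I₀ R₀ (time n c k) (λ I' R' → ∀ p → p < n → R' p ≡ effect c [] σ₀ k p p)
          whole =
            spec-seq {Q = λ I' R' → (I' 0 ≡ n × I' 1 ≡ 1) × R' ≡ R₀} (spec-ins (λ _ _ → refl) ((I0 , refl) , refl)) λ { I₁ _ ((a₁ , b₁) , refl) →
            spec-seq {Q = λ I' R' → (I' 0 ≡ n × I' 1 ≡ 1 × I' 2 ≡ 0) × R' ≡ R₀} (spec-ins (λ _ _ → refl) ((a₁ , b₁ , refl) , refl)) λ { I₂ _ ((a₂ , b₂ , c₂) , refl) →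
            spec-seq {Q = λ I' R' → (I' 0 ≡ n × I' 1 ≡ 1 × I' 2 ≡ 0 × I' 3 ≡ 0) × R' ≡ R₀} (spec-ins (λ _ _ → refl) ((a₂ , b₂ , c₂ , refl) , refl)) λ { I₃ _ (p₃ , refl) →
            spec-seq (spec-repeat (suc d) (λ j I' → I' 0 ≡ n × I' 1 ≡ 1 × I' 2 ≡ 0 × I' 3 ≡ j * n) p₃ (λ j I' (a , b , c , e) → spec-ins (λ _ _ → refl)
              ((a , b , c , trans (cong₂ _+_ e a) (+-comm (j * n) n)) , refl))) λ { I₄ _ ((a , b , c₄ , e) , refl) →
            let g = regs a b c₄ e (λ ()) (λ ()) in
            spec-seq (spec-C {ρ = []} {σ₀} c g ((λ _ _ _ _ _ → refl) , lo)) λ { I₅ R₅ (st₅ , (sim₅ , _)) →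
            spec-mono (ctx-loop (λ q R' → (∀ p → p < q → R' p ≡ effect c [] σ₀ k p p) × (∀ i → i < n → R' (addr (arrName k) i i) ≡ effect c [] σ₀ k i i)) (Stab-Regs st₅ g)
              ((λ p ()) , λ i i<n → sim₅ k i i i<n i<n) λ { q I₆ R₆ q<n g₆ (out , src) →
              spec-seq (spec-addrA (arrName k) zero zero six g₆) λ { I₇ _ (refl , e₇ , k₇) →
              spec-ins (λ _ _ → refl) (Keep-Stab six k₇ ,
                subst (λ z → (∀ p → p < suc q → (R₆ [ z ≔ R₆ (I₇ 6) ]) p ≡ effect c [] σ₀ k p p) × (∀ i → i < n → (R₆ [ z ≔ R₆ (I₇ 6) ]) (addr (arrName k) i i) ≡ effect c [] σ₀ k i i))
                  (sym (trans (Keep-Stab six k₇ 9 (inj₂ (≤-refl , ≤-refl))) (rv g₆ zero)))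
                  ((λ p p<1+q → write p p<1+q (trans (cong R₆ e₇) (src q q<n)) out) ,
                   -- Cell `q` lies in the input area, below all arrays, so the entries still to be
                   -- copied survive.
                   λ i i<n → trans (upd-other R₆ q _ (λ eq → low≢addr (arrName k) i i (≤-trans q<n (m≤m+n n (d * n))) (sym eq))) (src i i<n))) } })
            λ I' R' (_ , out , _) → out } } } } }
            where
            write : ∀ {q v R₆} p → p < suc q → v ≡ effect c [] σ₀ k q q → (∀ p → p < q → R₆ p ≡ effect c [] σ₀ k p p) → (R₆ [ q ≔ v ]) p ≡ effect c [] σ₀ k p p
            write {q} {v} {R₆} p p<1+q ev out with p ℕ.≟ q
            ... | yes refl = trans (upd-same R₆ p v) ev
            ... | no p≢q = trans (upd-other R₆ q v p≢q) (out p (≤∧≢⇒< (ℕ.s≤s⁻¹ p<1+q) p≢q))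
        ... | t , I' , R' , t≤ , r , out = ⟨ _ , I' , R' ⟩ , nth-length (compile c k) , out , λ le ω → run-⇒ r (nth-length (compile c k)) (≤-trans t≤ le) ω

  -- The rounding round as a program, and its effect.

  module Algorithms where

    open Reals
    open Sums
    open Projection
    open Rounding
    open Compiler
    open import Data.Fin using (_↑ˡ_; _↑ʳ_)
    import Data.Fin.Properties as FinP
    open import Data.Nat using (_<ᵇ_; z≤n)
    open import Data.Unit using (tt)
    open import Data.Vec using (_++_)
    import Data.Vec.Properties as VecP

    module Algorithm (d : ℕ) where
      open Language d public

      -- Weights, points already assigned to a centre, cluster membership (centre, point),
      -- projection, constraint and its image, direction, step length, and m.
      aX aAsg aOwn aU aA aV aDir aT aM : ℕ
      aX = 0
      aAsg = 1
      aOwn = 2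
      aU = 3
      aA = 4
      aV = 5
      aDir = 6
      aT = 7
      aM = 8

      notE : ∀ {m} → Expr m → Expr m
      notE e = sub one e

      numE : ∀ {m} → ℕ → Expr m
      numE zero    = nil
      numE (suc k) = add one (numE k)

      prodF : ∀ {m d'} → (Fin d' → Expr m) → Expr m
      prodF {d' = zero}  f = one
      prodF {d' = suc _} f = mul (f zero) (prodF (λ k → f (suc k)))

      -- The `suc` skips cell 0, which holds `ε`.
      coordE : ∀ {m} → Fin d → Fin m → Expr m
      coordE k p = inp d p (suc (toℕ k)) ℕP.≤-refl (FinP.toℕ<n k)

      -- The factor 0 cancels the loop variable that `inp` asks for.
      epsE : ∀ {m} → Fin m → Expr m
      epsE p = inp 0 p 0 z≤n z≤n

      diffE : ∀ {m} → Fin d → Fin m → Fin m → Expr m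
      diffE k q c = sub (coordE k q) (coordE k c)

      nearE : ∀ {m} → Fin m → Fin m → Expr m
      nearE c q = prodF (λ k → notE (lt one (mul (diffE k q c) (diffE k q c))))

      -- The exponent is a loop variable: among the `n` factors those with number below `v` equal
      -- `e`, the others 1.
      powE : ∀ {m} → Expr (suc m) → Fin m → Expr m
      powE e v = prodE (add (mul (ltI zero (suc v)) e) (notE (ltI zero (suc v))))

      natE : ∀ {m} → Fin m → Expr m
      natE v = sumE (ltI zero (suc v))

      powd : ∀ {m} → Expr m → ℕ → Expr m
      powd e zero    = one
      powd e (suc k) = mul e (powd e k)

      flE : ∀ {m} → Fin m → Expr m
      flE p = mul (lt nil (arr aX p p)) (lt (arr aX p p) one)

      fcE : ∀ {m} → Fin m → Expr m
      fcE c = sumE (mul (arr aOwn (suc c) zero) (flE zero))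

      enfFactor : ∀ {m} → Fin m → (Fin d → Fin m) → Fin d → Expr m
      enfFactor c α k = lt (add (powd (add (natE (α k)) one) d) one) (fcE c)

      enfE : ∀ {m} → Fin m → (Fin d → Fin m) → Expr m
      enfE c α = prodF (enfFactor c α)

      monoFactor : ∀ {m} → Fin m → (Fin d → Fin m) → Fin m → Fin d → Expr m
      monoFactor c α q k = mul (expE (sub nil (mul (diffE k q c) (diffE k q c)))) (powE (diffE k (suc q) (suc c)) (α k))

      monoE : ∀ {m} → Fin m → (Fin d → Fin m) → Fin m → Expr m
      monoE c α q = prodF (monoFactor c α q)

      -- A moment that is not enforced becomes the zero vector, on which `restrict` does nothing. So
      -- a loop over all moments takes the place of a selection.
      conE : ∀ {m} → Fin m → (Fin d → Fin m) → Fin m → Expr m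
      conE c α q = mul (enfE c α) (mul (arr aOwn c q) (monoE c α q))

      -- A moment has `d` exponents, so the depth of nesting depends on `d`; the added variables
      -- form the initial segment of the environment `α ++ ρ`.
      nest : ∀ {m} d' → Cmd (d' ℕ.+ m) → Cmd m
      nest zero     c = c
      nest (suc d') c = nest d' (for c)

      -- Vectors live on the diagonals of arrays. The two tables compute `app u a` and
      -- `restrict u a` for the vector `a` held in `aA`.
      elimC : ∀ {m} → Cmd m
      elimC = tab aV (sumE (mul (arr aU (suc zero) zero) (arr aA zero zero))) ⟫
        tab aU (sub (arr aU zero (suc zero)) (mul (mul (arr aV zero zero) (arr aV (suc zero) (suc zero))) (div one (sumE (mul (arr aV zero zero) (arr aV zero zero))))))

      constrainC : ∀ {m} → Expr (suc (suc m)) → Cmd m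
      constrainC e = tab aA e ⟫ elimC

      centreV : ∀ {m} → Fin (suc (suc (d ℕ.+ suc m)))
      centreV = suc (suc (d ↑ʳ zero))

      exponentV : ∀ {m} → Fin d → Fin (suc (suc (d ℕ.+ suc m)))
      exponentV {m} k = suc (suc (k ↑ˡ suc m))

      momentsC : ∀ {m} → Cmd (suc m)
      momentsC {m} = nest d (constrainC (conE (centreV {m}) exponentV zero))

      candE : ∀ {m} → Fin m → Expr m
      candE p = div (add (mul (lt nil (arr aDir p p)) (sub one (arr aX p p))) (mul (lt (arr aDir p p) nil) (sub nil (arr aX p p)))) (arr aDir p p)

      improveE : ∀ {m} → Fin m → Expr m → Expr m
      improveE p t = mul (lt (candE p) t) (add (lt nil (arr aDir p p)) (lt (arr aDir p p) nil))

      moveC : ∀ {m} → Cmd m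
      moveC = tab aDir nil ⟫
        for (tab aDir (add (mul (lt nil (arr aU p p)) (arr aU p zero)) (mul (notE (lt nil (arr aU p p))) (arr aDir zero zero)))) ⟫
        tab aT (add one (sumE (mul (div one (arr aDir zero zero)) (div one (arr aDir zero zero))))) ⟫
        for (tab aT (add (mul (improveE p (arr aT zero (suc zero))) (candE p)) (mul (notE (improveE p (arr aT zero (suc zero)))) (arr aT zero (suc zero))))) ⟫
        tab aX (add (arr aX zero zero) (mul (arr aT zero (suc zero)) (arr aDir zero zero)))
        where
        p : ∀ {m} → Fin (suc (suc (suc m)))
        p = suc (suc zero)

      roundC : ∀ {m} → Cmd m
      roundC = tab aU (mul (mul (notE (ltI zero (suc zero))) (notE (ltI (suc zero) zero))) (flE (suc zero))) ⟫
        constrainC one ⟫ for momentsC ⟫ moveC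

      module Run (n : ℕ) (low : ℕ → ℝ) where
        open Semantics n low public
        open Projections n public
        open Moves n public

        co : ℕ → Fin d → ℝ
        co p k = low (d ℕ.* p ℕ.+ suc (toℕ k))

        y : ℕ → ℕ → Fin d → ℝ
        y q c k = co q k - co c k

        eval-prodF : ∀ {m d'} (f : Fin d' → Expr m) ρ σ → eval (prodF f) ρ σ ≡ ΠF (λ k → eval (f k) ρ σ)
        eval-prodF {d' = zero}  f ρ σ = refl
        eval-prodF {d' = suc _} f ρ σ = cong (eval (f zero) ρ σ *_) (eval-prodF (λ k → f (suc k)) ρ σ)

        eval-num : ∀ {m} k (ρ : Vec ℕ m) σ → eval (numE k) ρ σ ≡ fromℕ k
        eval-num zero    ρ σ = refl
        eval-num (suc k) ρ σ = cong (1# +_) (eval-num k ρ σ)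

        eval-powd : ∀ {m} (e : Expr m) k ρ σ → eval (powd e k) ρ σ ≡ eval e ρ σ ^ k
        eval-powd e zero    ρ σ = refl
        eval-powd e (suc k) ρ σ = cong (eval e ρ σ *_) (eval-powd e k ρ σ)

        below : ℕ → ℕ → ℝ
        below r a = if r <ᵇ a then 1# else 0#

        below-true : ∀ {r a} → r ℕ.< a → below r a ≡ 1#
        below-true {r} {a} p with r <ᵇ a | ℕP.<⇒<ᵇ p
        ... | true | _ = refl

        below-false : ∀ {r a} → a ℕ.≤ r → below r a ≡ 0#
        below-false {r} {a} p with r <ᵇ a | ℕP.<ᵇ⇒< r a
        ... | true  | q = ⊥-elim (ℕP.<⇒≱ (q tt) p)
        ... | false | _ = refl

        Σ-below : ∀ m a → Σ< m (λ r → below r a) ≡ fromℕ (m ℕ.⊓ a)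
        Σ-below zero    a = refl
        Σ-below (suc m) a with m ℕ.<? a
        ... | yes p = trans (cong₂ _+_ (Σ-below m a) (below-true p)) (trans (cong (λ z → fromℕ z + 1#) (ℕP.m≤n⇒m⊓n≡m (ℕP.<⇒≤ p))) (trans (+-comm _ _) (cong fromℕ (sym (ℕP.m≤n⇒m⊓n≡m p)))))
        ... | no ¬p = trans (cong₂ _+_ (Σ-below m a) (below-false (ℕP.≮⇒≥ ¬p))) (trans (+-identityʳ _) (cong fromℕ (trans (ℕP.m≥n⇒m⊓n≡n (ℕP.≮⇒≥ ¬p)) (sym (ℕP.m≥n⇒m⊓n≡n (ℕP.≤-trans (ℕP.≮⇒≥ ¬p) (ℕP.n≤1+n m)))))))

        Π-below : ∀ m a z → Π< m (λ r → below r a * z + (1# - below r a)) ≡ z ^ (m ℕ.⊓ a)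
        Π-below zero    a z = refl
        Π-below (suc m) a z with m ℕ.<? a
        ... | yes p = trans (cong₂ _*_ (Π-below m a z) (trans (cong (λ b → b * z + (1# - b)) (below-true p)) (solve 1 (λ z → :1 :* z :+ (:1 :- :1) := z) refl z)))
          (trans (cong (λ u → z ^ u * z) (ℕP.m≤n⇒m⊓n≡m (ℕP.<⇒≤ p))) (trans (*-comm _ _) (cong (z ^_) (sym (ℕP.m≤n⇒m⊓n≡m p)))))
        ... | no ¬p = trans (cong₂ _*_ (Π-below m a z) (trans (cong (λ b → b * z + (1# - b)) (below-false (ℕP.≮⇒≥ ¬p))) (solve 1 (λ z → :0 :* z :+ (:1 :- :0) := :1) refl z)))
          (trans (*-identityʳ _) (cong (z ^_) (trans (ℕP.m≥n⇒m⊓n≡n (ℕP.≮⇒≥ ¬p)) (sym (ℕP.m≥n⇒m⊓n≡n (ℕP.≤-trans (ℕP.≮⇒≥ ¬p) (ℕP.n≤1+n m)))))))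

        eval-pow : ∀ {m} (e : Expr (suc m)) v ρ σ z → lookup ρ v ℕ.≤ n → (∀ r → eval e (r ∷ ρ) σ ≡ z) → eval (powE e v) ρ σ ≡ z ^ lookup ρ v
        eval-pow e v ρ σ z le h = trans (Π-ext n λ r → cong (λ u → below r (lookup ρ v) * u + (1# - below r (lookup ρ v))) (h r)) (trans (Π-below n (lookup ρ v) z) (cong (z ^_) (ℕP.m≥n⇒m⊓n≡n le)))
          where
          Π-ext : ∀ m {f g : ℕ → ℝ} → (∀ r → f r ≡ g r) → Π< m f ≡ Π< m g
          Π-ext zero    p = refl
          Π-ext (suc m) p = cong₂ _*_ (Π-ext m p) (p m)

        iterate-inv : (P : ℕ → Store → Set) → ∀ {f σ} m → P 0 σ → (∀ i σ → i ℕ.< m → P i σ → P (suc i) (f i σ)) → P m (iterate m f σ)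
        iterate-inv P zero    p h = p
        iterate-inv P (suc m) p h = h m _ ℕP.≤-refl (iterate-inv P m p λ i σ i<m → h i σ (ℕP.m<n⇒m<1+n i<m))

        module Round (own X : ℕ → ℕ → ℝ) where

          x : ℕ → ℝ
          x i = X i i

          fc : ℕ → ℝ
          fc c = Σ< n (λ p → own c p * fl x p)

          -- The exponent d makes the s^d multi-indices with entries below s fewer than
          -- the fractional weights whenever all of them are enforced.
          threshold : ℕ → ℝ
          threshold a = (fromℕ a + 1#) ^ d + 1#

          enf : ℕ → Vec ℕ d → ℝ
          enf c α = ΠF (λ k → lt01 (threshold (lookup α k)) (fc c))

          mono : ℕ → Vec ℕ d → ℕ → ℝ
          mono c α q = ΠF (λ k → exp (- (y q c k * y q c k)) * y q c k ^ lookup α k)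

          cst : ℕ → Vec ℕ d → ℕ → ℝ
          cst c α q = enf c α * (own c q * mono c α q)

          -- `t` bounds the trace spent so far: an enforced constraint costs 1, a vanishing one 0.
          record Inv (σ : Store) (t : ℝ) : Set where
            field
              ix : σ aX ≡ X
              io : σ aOwn ≡ own
              pr : IsProjection (σ aU)
              su : ∀ j → fl x j ≡ 0# → ∀ i → σ aU i j ≡ 0#
              tr : Σ< n (fl x) - t ≤ trace (σ aU)
          open Inv

          -- What a command achieves that imposes the vectors in `S` at the cost `w`: earlier
          -- constraints stay satisfied.
          Adv : ((ℕ → ℝ) → Set) → ℝ → Store → Store → Set
          Adv S w σ σ' = ∀ t → Inv σ t → Inv σ' (t + w) × (∀ b → Kills (σ aU) b → Kills (σ' aU) b) × (∀ b → S b → Kills (σ' aU) b)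

          constrain-adv : ∀ {m} (e : Expr (suc (suc m))) (ρ : Vec ℕ m) (a : ℕ → ℝ) (w : ℝ) → (w ≡ 1# ⊎ (w ≡ 0# × (∀ q → q ℕ.< n → a q ≡ 0#))) →
            (∀ σ t → Inv σ t → ∀ q → q ℕ.< n → eval e (q ∷ q ∷ ρ) σ ≡ a q) →
            ∀ σ → Adv (λ b → ∀ q → q ℕ.< n → b q ≡ a q) w σ (effect (constrainC e) ρ σ)
          constrain-adv e ρ a w wa he σ t inv = record
              { ix = ix inv ; io = io inv ; pr = Re.isProjection ; su = λ j z i → Re.support j (su inv j z) i ; tr = trace-ok wa }
            , Re.keeps-kills , λ b h i i<n → trans (app-cong (restrict (σ aU) a') (λ q q<n → trans (h q q<n) (sym (he σ t inv q q<n))) i) (Re.kills-new i i<n)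
            where
            a' : ℕ → ℝ
            a' q = eval e (q ∷ q ∷ ρ) σ
            module Re = Restrict (σ aU) (pr inv) a'
            trace-ok : (w ≡ 1# ⊎ (w ≡ 0# × (∀ q → q ℕ.< n → a q ≡ 0#))) → Σ< n (fl x) - (t + w) ≤ trace (restrict (σ aU) a')
            trace-ok (inj₁ refl) = ≤-trans (≤-by (≤⇒0≤ (tr inv)) (solve 3 (λ T F t → (T :- :1) :- (F :- (t :+ :1)) := T :- (F :- t)) refl (trace (σ aU)) (Σ< n (fl x)) t)) Re.trace-drop
            trace-ok (inj₂ (refl , z)) = ≤-trans (≤-respˡ (cong (λ u → Σ< n (fl x) - u) (sym (+-identityʳ t))) (tr inv)) (Re.trace-keep λ q q<n → trans (he σ t inv q q<n) (z q q<n))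

          iterate-adv : ∀ m {f : ℕ → Store → Store} {S : ℕ → (ℕ → ℝ) → Set} {w : ℕ → ℝ} {σ} → (∀ i σ → i ℕ.< m → Adv (S i) (w i) σ (f i σ)) → Adv (λ b → ∃[ i ] i ℕ.< m × S i b) (Σ< m w) σ (iterate m f σ)
          iterate-adv zero h t inv = subst (Inv _) (sym (+-identityʳ t)) inv , (λ _ k → k) , λ { b (_ , () , _) }
          iterate-adv (suc m) {f} {S} {w} {σ} h t inv with iterate-adv m {f} {S} {w} {σ} (λ i σ i<m → h i σ (ℕP.m<n⇒m<1+n i<m)) t inv
          ... | inv₁ , keep₁ , new₁ with h m (iterate m f σ) ℕP.≤-refl (t + Σ< m w) inv₁
          ... | inv₂ , keep₂ , new₂ = subst (Inv _) (+-assoc _ _ _) inv₂ , (λ b k → keep₂ b (keep₁ b k)) , new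
            where
            new : ∀ b → ∃[ i ] i ℕ.< suc m × S i b → Kills (iterate (suc m) f σ aU) b
            new b (i , i<1+m , s) with i ℕ.≟ m
            ... | yes refl = new₂ b s
            ... | no i≢m = keep₂ b (new₁ b (i , ℕP.≤∧≢⇒< (ℕ.s≤s⁻¹ i<1+m) i≢m , s))

          Bounded : ∀ {d'} → Vec ℕ d' → Set
          Bounded α = ∀ k → lookup α k ℕ.< n

          ΣV : ∀ d' → (Vec ℕ d' → ℝ) → ℝ
          ΣV zero     w = w []
          ΣV (suc d') w = ΣV d' (λ α → Σ< n (λ k → w (k ∷ α)))

          -- The innermost loop is absorbed by `iterate-adv`, so the induction hypothesis applies to
          -- `for c`, with one exponent less.
          nest-adv : ∀ {m} d' (c : Cmd (d' ℕ.+ m)) (ρ : Vec ℕ m) {S : Vec ℕ d' → (ℕ → ℝ) → Set} {w : Vec ℕ d' → ℝ} → (∀ α → Bounded α → ∀ σ → Adv (S α) (w α) σ (effect c (α ++ ρ) σ)) →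
            ∀ σ → Adv (λ b → ∃[ α ] Bounded α × S α b) (ΣV d' w) σ (effect (nest d' c) ρ σ)
          nest-adv zero c ρ h σ t inv with h [] (λ ()) σ t inv
          ... | inv' , keep , new = inv' , keep , λ { b ([] , _ , s) → new b s }
          nest-adv (suc d') c ρ {S} {w} h σ t inv with nest-adv d' (for c) ρ {λ α b → ∃[ k ] k ℕ.< n × S (k ∷ α) b} {λ α → Σ< n (λ k → w (k ∷ α))}
              (λ α bd σ → iterate-adv n (λ i σ i<n → h (i ∷ α) (λ { zero → i<n ; (suc k) → bd k }) σ)) σ t inv
          ... | inv' , keep , new = inv' , keep , λ { b ((k ∷ α) , bd , s) → new b (α , (λ j → bd (suc j)) , k , bd zero , s) }

          ΠF-01 : ∀ {d'} {f : Fin d' → ℝ} → (∀ k → f k ≡ 1# ⊎ f k ≡ 0#) → ΠF f ≡ 1# ⊎ ΠF f ≡ 0#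
          ΠF-01 {zero} h = inj₁ refl
          ΠF-01 {suc d'} {f} h with h zero | ΠF-01 {f = λ k → f (suc k)} (λ k → h (suc k))
          ... | inj₁ e | inj₁ e' = inj₁ (trans (cong₂ _*_ e e') (*-identityʳ 1#))
          ... | inj₂ e | _ = inj₂ (trans (cong (_* ΠF (λ k → f (suc k))) e) (zeroˡ _))
          ... | _ | inj₂ e = inj₂ (trans (cong (f zero *_) e) (zeroʳ _))

          enf-01 : ∀ c α → enf c α ≡ 1# ⊎ enf c α ≡ 0#
          enf-01 c α = ΠF-01 λ k → decide (lt01-cases (threshold (lookup α k)) (fc c))
            where
            decide : ∀ {A B : Set} {z : ℝ} → (A × z ≡ 1#) ⊎ (B × z ≡ 0#) → z ≡ 1# ⊎ z ≡ 0#
            decide (inj₁ (_ , e)) = inj₁ e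
            decide (inj₂ (_ , e)) = inj₂ e

          -- `Bounded α` matters since `natE` and `powE` count only up to `n`: from an exponent a
          -- they see min(n, a).
          eval-con : ∀ {m} c (α : Vec ℕ d) → Bounded α → (ρ : Vec ℕ m) → ∀ σ t → Inv σ t → ∀ q →
            eval (conE (centreV {m}) exponentV zero) (q ∷ q ∷ (α ++ c ∷ ρ)) σ ≡ cst c α q
          eval-con {m} c α bd ρ σ t inv q = cong₂ _*_ (trans (eval-prodF (enfFactor (centreV {m}) exponentV) η σ) (ΠF-cong enf-k))
              (cong₂ _*_ (trans (cong (λ z → σ aOwn z q) c≡) (cong (λ f → f c q) (io inv))) (trans (eval-prodF (monoFactor (centreV {m}) exponentV zero) η σ) (ΠF-cong mono-k)))
            where
            η = q ∷ q ∷ (α ++ c ∷ ρ)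
            c≡ : lookup (α ++ c ∷ ρ) (d ↑ʳ zero) ≡ c
            c≡ = VecP.lookup-++ʳ α (c ∷ ρ) zero
            α≡ : ∀ k → lookup (α ++ c ∷ ρ) (k ↑ˡ suc m) ≡ lookup α k
            α≡ k = VecP.lookup-++ˡ α (c ∷ ρ) k
            fc≡ : eval (fcE (centreV {m})) η σ ≡ fc c
            fc≡ = Σ-ext n λ p → cong₂ _*_ (trans (cong (λ z → σ aOwn z p) c≡) (cong (λ f → f c p) (io inv))) (cong (λ z → lt01 0# z * lt01 z 1#) (cong (λ f → f p p) (ix inv)))
            enf-k : ∀ k → eval (enfFactor (centreV {m}) exponentV k) η σ ≡ lt01 (threshold (lookup α k)) (fc c)
            enf-k k = cong₂ lt01 (cong (_+ 1#) (trans (eval-powd (add (natE (exponentV {m} k)) one) d η σ) (cong (λ z → (z + 1#) ^ d) (trans (cong (λ a → Σ< n (λ r → below r a)) (α≡ k)) (trans (Σ-below n (lookup α k)) (cong fromℕ (ℕP.m≥n⇒m⊓n≡n (ℕP.<⇒≤ (bd k))))))))) fc≡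
            mono-k : ∀ k → eval (monoFactor (centreV {m}) exponentV zero k) η σ
              ≡ exp (- (y q c k * y q c k)) * y q c k ^ lookup α k
            mono-k k = cong₂ _*_ (cong exp (trans (+-identityˡ _) (cong (λ z → - ((co q k - co z k) * (co q k - co z k))) c≡)))
              (trans (eval-pow (diffE k (suc zero) (suc (centreV {m}))) (exponentV k) η σ (y q c k) (ℕP.<⇒≤ (subst (ℕ._< n) (sym (α≡ k)) (bd k))) (λ r → cong (λ z → co q k - co z k) c≡)) (cong (y q c k ^_) (α≡ k)))

          moments-adv : ∀ {m} c (ρ : Vec ℕ m) σ → Adv (λ b → ∃[ α ] Bounded α × (∀ q → q ℕ.< n → b q ≡ cst c α q)) (ΣV d (enf c)) σ (effect momentsC (c ∷ ρ) σ)
          moments-adv {m} c ρ = nest-adv d (constrainC (conE (centreV {m}) exponentV zero)) (c ∷ ρ) {λ α b → ∀ q → q ℕ.< n → b q ≡ cst c α q} {enf c} λ α bd → constrain-adv (conE (centreV {m}) exponentV zero) (α ++ c ∷ ρ) (cst c α) (enf c α) (weight α) λ σ t inv q _ → eval-con c α bd ρ σ t inv q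
            where
            weight : ∀ α → enf c α ≡ 1# ⊎ (enf c α ≡ 0# × (∀ q → q ℕ.< n → cst c α q ≡ 0#))
            weight α with enf-01 c α
            ... | inj₁ e = inj₁ e
            ... | inj₂ e = inj₂ (e , λ q _ → trans (cong (_* (own c q * mono c α q)) e) (zeroˡ _))

          -- Distributivity. With `g` the indicator of the degrees that pass the threshold test, it
          -- counts the enforced moments of a cluster as s^d.
          ΣV-product : ∀ d' (g : ℕ → ℝ) → ΣV d' (λ α → ΠF (λ k → g (lookup α k))) ≡ Σ< n g ^ d'
          ΣV-product zero     g = refl
          ΣV-product (suc d') g = trans (ΣV-ext d' λ α → Σ-*ʳ n _ g) (trans (ΣV-*ˡ d' (Σ< n g) _) (cong (Σ< n g *_) (ΣV-product d' g)))
            where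
            ΣV-ext : ∀ d' {f g : Vec ℕ d' → ℝ} → (∀ α → f α ≡ g α) → ΣV d' f ≡ ΣV d' g
            ΣV-ext zero     h = h []
            ΣV-ext (suc d') h = ΣV-ext d' λ α → Σ-ext n λ k → h (k ∷ α)
            ΣV-*ˡ : ∀ d' c f → ΣV d' (λ α → c * f α) ≡ c * ΣV d' f
            ΣV-*ˡ zero     c f = refl
            ΣV-*ˡ (suc d') c f = trans (ΣV-ext d' λ α → Σ-*ˡ n c _) (ΣV-*ˡ d' c _)

          sumEnf : ℝ
          sumEnf = Σ< n (λ c → ΣV d (enf c))

          -- The number of rounds is fixed to `n`, so rounds also run when no direction is left.
          -- Only `progress` is therefore conditional.
          record RoundResult (x' : ℕ → ℝ) : Set where
            field
              range    : Range x'
              frozen   : ∀ p → fl x p ≡ 0# → x' p ≡ x p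
              total    : Σ< n x' ≡ Σ< n x
              moment   : ∀ c → c ℕ.< n → ∀ α → Bounded α → enf c α ≡ 1# → Σ< n (λ p → (x' p - x p) * (own c p * mono c α p)) ≡ 0#
              progress : 1# + sumEnf < Σ< n (fl x) → Σ< n (fl x') + 1# ≤ Σ< n (fl x)

        module RoundAt {m : ℕ} (ρ : Vec ℕ m) (σ : Store) where
          open Round (σ aOwn) (σ aX) public
          open Inv

          σ₁ σ₂ σ₃ : Store
          σ₁ = effect (tab aU (mul (mul (notE (ltI zero (suc zero))) (notE (ltI (suc zero) zero))) (flE (suc zero)))) ρ σ
          σ₂ = effect (constrainC one) ρ σ₁
          σ₃ = effect (for momentsC) ρ σ₂

          -- The start is the coordinate projection onto the fractional weights; its trace is their
          -- number, and no constraint has been charged yet.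
          inv₁ : Inv σ₁ 0#
          inv₁ = record { ix = refl ; io = refl ; pr = diagonal-projection (fl x) (fl-idem x)
            ; su = λ j z i → trans (cong (eq01 i j *_) z) (zeroʳ _)
            ; tr = ≡⇒≤ (trans (solve 1 (λ F → F :- :0 := F) refl (Σ< n (fl x))) (sym (diagonal-trace (fl x)))) }

          adv₂ : Adv (λ b → ∀ q → q ℕ.< n → b q ≡ 1#) 1# σ₁ σ₂
          adv₂ = constrain-adv one ρ (λ _ → 1#) 1# (inj₁ refl) (λ _ _ _ _ _ → refl) σ₁

          adv₃ : Adv (λ b → ∃[ c ] c ℕ.< n × (∃[ α ] Bounded α × (∀ q → q ℕ.< n → b q ≡ cst c α q))) sumEnf σ₂ σ₃
          adv₃ = iterate-adv n {λ c → effect momentsC (c ∷ ρ)} {λ c b → ∃[ α ] Bounded α × (∀ q → q ℕ.< n → b q ≡ cst c α q)} {λ c → ΣV d (enf c)} {σ₂} λ c σ _ → moments-adv c ρ σ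

          step₂ = adv₂ 0# inv₁
          step₃ = adv₃ (0# + 1#) (proj₁ step₂)

          inv₃ : Inv σ₃ ((0# + 1#) + sumEnf)
          inv₃ = proj₁ step₃

          u : ℕ → ℕ → ℝ
          u = σ₃ aU

          kills-one : Kills u (λ _ → 1#)
          kills-one = proj₁ (proj₂ step₃) _ (proj₂ (proj₂ step₂) _ λ _ _ → refl)

          kills-moment : ∀ c → c ℕ.< n → ∀ α → Bounded α → Kills u (cst c α)
          kills-moment c c<n α bd = proj₂ (proj₂ step₃) _ (c , c<n , α , bd , λ _ _ → refl)

          DirState : ℕ → Store → Set
          DirState q σ' = σ' aU ≡ u × σ' aX ≡ σ₃ aX × σ' aOwn ≡ σ₃ aOwn × DirInv u q (λ i → σ' aDir i i)

          dirC : Cmd (suc m)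
          dirC = tab aDir (add (mul (lt nil (arr aU (suc (suc zero)) (suc (suc zero)))) (arr aU (suc (suc zero)) zero)) (mul (notE (lt nil (arr aU (suc (suc zero)) (suc (suc zero))))) (arr aDir zero zero)))

          stepC : Cmd (suc m)
          stepC = tab aT (add (mul (improveE (suc (suc zero)) (arr aT zero (suc zero))) (candE (suc (suc zero)))) (mul (notE (improveE (suc (suc zero)) (arr aT zero (suc zero)))) (arr aT zero (suc zero))))

          σ₄ σ₅ σ₆ σ₇ : Store
          σ₄ = effect (tab aDir nil ⟫ for dirC) ρ σ₃
          σ₅ = effect (tab aT (add one (sumE (mul (div one (arr aDir zero zero)) (div one (arr aDir zero zero)))))) ρ σ₄
          σ₆ = effect (for stepC) ρ σ₅
          σ₇ = effect roundC ρ σ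

          dir : DirState n σ₄
          dir = iterate-inv DirState n (refl , refl , refl , inj₁ ((λ p ()) , λ i → refl))
            λ { q σ' q<n (eU , eX , eO , inv) → eU , eX , eO , subst (λ w → DirInv u (suc q) (dirStep w (λ i → σ' aDir i i) q)) (sym eU) (dirStep-inv u q _ q<n inv) }

          D : ℕ → ℝ
          D i = σ₄ aDir i i

          X₄≡ : σ₄ aX ≡ σ aX
          X₄≡ = trans (proj₁ (proj₂ dir)) (ix inv₃)

          dirInv : DirInv u n D
          dirInv = proj₂ (proj₂ (proj₂ dir))

          supp : ∀ p → fl x p ≡ 0# → D p ≡ 0#
          supp p z with dirInv
          ... | inj₁ (_ , h) = h p
          ... | inj₂ (p₀ , _ , _ , h) = trans (h p) (su inv₃ p z p₀)

          module _ (rg : Range x) where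

            MinState : ℕ → Store → Set
            MinState q σ' = σ' aX ≡ σ aX × σ' aDir ≡ σ₄ aDir × σ' aOwn ≡ σ₄ aOwn × (∃[ t ] (∀ i j → σ' aT i j ≡ t) × MinInv x D q t)

            minState : MinState n σ₆
            minState = iterate-inv MinState n (X₄≡ , refl , refl , start D , (λ i j → refl) , start-inv x D)
              λ { q σ' q<n (eX , eD , eO , t , eT , inv) → eX , eD , eO , minStep x D t q ,
                (λ i j → trans (cong₂ (λ f g → minStep (λ p → f p p) (λ p → g p p) (σ' aT i j) q) eX eD) (cong (λ z → minStep x D z q) (eT i j))) , minStep-inv x D q t rg q<n inv }

            t : ℝ
            t = proj₁ (proj₂ (proj₂ (proj₂ minState)))

            module M = Move x D t rg supp (proj₂ (proj₂ (proj₂ (proj₂ (proj₂ minState)))))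

            x₇ : ℕ → ℝ
            x₇ i = σ₇ aX i i

            x₇≡ : ∀ i → x₇ i ≡ M.x' i
            x₇≡ i = cong₂ _+_ (cong (λ f → f i i) (proj₁ minState)) (cong₂ _*_ (proj₁ (proj₂ (proj₂ (proj₂ (proj₂ minState)))) i i) (cong (λ f → f i i) (proj₁ (proj₂ minState))))

            fl₇≡ : ∀ i → fl x₇ i ≡ fl M.x' i
            fl₇≡ i = fl-cong {x₇} {M.x'} (x₇≡ i)

            -- `D` is 0 or a row of `u`, and the entries of `u b` are the products of the rows with
            -- `b`.
            dot-D : ∀ b → Kills u b → Σ< n (λ q → D q * b q) ≡ 0#
            dot-D b k with dirInv
            ... | inj₁ (_ , h) = Σ-0 n λ q _ → trans (cong (_* b q) (h q)) (zeroˡ _)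
            ... | inj₂ (p , p<n , _ , h) = trans (Σ-ext n λ q → cong (_* b q) (h q)) (k p p<n)

            own₇ : σ₇ aOwn ≡ σ aOwn
            own₇ = trans (proj₁ (proj₂ (proj₂ minState))) (trans (proj₁ (proj₂ (proj₂ dir))) (io inv₃))

            total₇ : Σ< n x₇ ≡ Σ< n x
            total₇ = shift-total x x₇ (shift-dot x x₇ D (λ _ → 1#) t x₇≡ (dot-D (λ _ → 1#) kills-one))

            moment₇ : ∀ c → c ℕ.< n → ∀ α → Bounded α → enf c α ≡ 1# → Σ< n (λ p → (x₇ p - x p) * (σ aOwn c p * mono c α p)) ≡ 0#
            moment₇ c c<n α bd e = drop-factor (λ p → x₇ p - x p) (λ p → σ aOwn c p * mono c α p) e
              (shift-dot x x₇ D (cst c α) t x₇≡ (dot-D (cst c α) (kills-moment c c<n α bd)))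

            progress₇ : 1# + sumEnf < Σ< n (fl x) → Σ< n (fl x₇) + 1# ≤ Σ< n (fl x)
            progress₇ few = ≤-respˡ (cong (_+ 1#) (sym (Σ-ext n fl₇≡)))
              (M.progress (dir-nonzero u D dirInv (remaining-pos (Σ< n (fl x)) sumEnf (trace u) few (tr inv₃))))

            result : RoundResult x₇
            result = record
              { range = λ p p<n → subst (λ z → 0# ≤ z × z ≤ 1#) (sym (x₇≡ p)) (M.range p p<n)
              ; frozen = λ p z → trans (x₇≡ p) (M.frozen p z)
              ; total = total₇ ; moment = moment₇ ; progress = progress₇ }

  -- Counting the constraints and bounding the discrepancy.

  module Discrepancies where

    open Reals
    open Sums
    open Analysis
    open Geometry
    open Projection
    open Rounding
    open Algorithms

    Fin-all-or-some : ∀ {d} {P Q : Fin d → Set} → (∀ k → P k ⊎ Q k) → (∀ k → P k) ⊎ ∃ Q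
    Fin-all-or-some {zero} h = inj₁ λ ()
    Fin-all-or-some {suc d} {P} {Q} h with h zero | Fin-all-or-some {d} {λ k → P (suc k)} {λ k → Q (suc k)} (λ k → h (suc k))
    ... | inj₂ q | _ = inj₂ (zero , q)
    ... | inj₁ p | inj₂ (k , q) = inj₂ (suc k , q)
    ... | inj₁ p | inj₁ ps = inj₁ λ { zero → p ; (suc k) → ps k }

    suc≤2^ : ∀ a → fromℕ a + 1# ≤ (1# + 1#) ^ a
    suc≤2^ zero    = ≡⇒≤ (+-identityˡ 1#)
    suc≤2^ (suc a) = ≤-trans (≤-by (fromℕ-nonneg a) (solve 1 (λ a → (:1 :+ :1) :* (a :+ :1) :- ((:1 :+ a) :+ :1) := a) refl (fromℕ a)))
      (*-monoˡ-≤ (<⇒≤ 0<2) (suc≤2^ a))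

    1^ : ∀ n → 1# ^ n ≡ 1#
    1^ zero    = refl
    1^ (suc n) = trans (*-identityˡ _) (1^ n)

    ^-swap : ∀ x m n → (x ^ m) ^ n ≡ (x ^ n) ^ m
    ^-swap x zero    n = 1^ n
    ^-swap x (suc m) n = trans (*-^ x (x ^ m) n) (cong (x ^ n *_) (^-swap x m n))

    1≤2 : 1# ≤ 1# + 1#
    1≤2 = x≤x+y 0≤1

    self≤^ : ∀ {x} d → 1 ℕ.≤ d → 1# ≤ x → x ≤ x ^ d
    self≤^ {x} (suc d) _ p = ≤-respˡ (*-identityʳ x) (*-monoˡ-≤ (≤-trans 0≤1 p) (1≤^ d p))

    0^ : ∀ d → 1 ℕ.≤ d → 0# ^ d ≡ 0#
    0^ (suc d) _ = zeroˡ _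

    module Constants (d : ℕ) where
      -- `B` absorbs the thresholds, (a+1)^d ≤ (2^d)^a. `B'` doubles it because of the factor 2 in
      -- the mixed term 2(x-c)(p-c). `E` is the constant of `gauss-tail` for one coordinate. In `K`
      -- the factor 2 comes from `L` and 4^d from `packing`.
      B B' E K : ℝ
      B = (1# + 1#) ^ d
      B' = (1# + 1#) * B
      E = exp ((B' + 1#) * (B' + 1#))
      K = (1# + 1#) * (E ^ d * fromℕ 4 ^ d)

    module Discrepancy (d : ℕ) (1≤d : 1 ℕ.≤ d) (n : ℕ) (low : ℕ → ℝ) where
      open Algorithm d hiding (module Run)
      open Algorithm.Run d n low

      open Constants d

      1≤B : 1# ≤ B
      1≤B = 1≤^ d 1≤2

      L : Vec ℕ d → ℝ
      L α = (1# + 1#) * ΠF (λ k → B ^ lookup α k)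

      record Clusters (own : ℕ → ℕ → ℝ) (S : ℕ → Set) : Set where
        field
          own-cases : ∀ c p → own c p ≡ 0# ⊎ (own c p ≡ 1# × S c × (∀ k → abs (y p c k) ≤ 1#))
          partition : ∀ p → p ℕ.< n → Σ< n (λ c → own c p) ≡ 1#
          separated : Separated S co

      module WithClusters {own : ℕ → ℕ → ℝ} {S : ℕ → Set} (cl : Clusters own S) where
        open Clusters cl

        own-nonneg : ∀ c p → 0# ≤ own c p
        own-nonneg c p with own-cases c p
        ... | inj₁ e = ≡⇒≤ (sym e)
        ... | inj₂ (e , _) = ≤-respʳ (sym e) 0≤1

        own-≤1 : ∀ c p → own c p ≤ 1#
        own-≤1 c p with own-cases c p
        ... | inj₁ e = ≤-respˡ (sym e) 0≤1
        ... | inj₂ (e , _) = ≡⇒≤ e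

        module Budget (X : ℕ → ℕ → ℝ) where
          open Round own X

          F : ℝ
          F = Σ< n (fl x)

          g : ℕ → ℕ → ℝ
          g c a = lt01 (threshold a) (fc c)

          fc-nonneg : ∀ c → 0# ≤ fc c
          fc-nonneg c = Σ-nonneg n λ p _ → *-nonneg (own-nonneg c p) (fl-nonneg x p)

          fc≤n : ∀ c → fc c ≤ fromℕ n
          fc≤n c = ≤-trans (Σ-mono-≤ n λ p _ → *-mono-≤ (own-nonneg c p) (fl-nonneg x p) (own-≤1 c p) (fl-≤1 x p)) (≡⇒≤ (trans (Σ-const n (1# * 1#)) (trans (cong (fromℕ n *_) (*-identityʳ 1#)) (*-identityʳ _))))

          Σfc : Σ< n fc ≡ F
          Σfc = trans (Σ-swap n n _) (Σ-cong n λ p p<n → trans (Σ-*ʳ n (fl x p) _) (trans (cong (_* fl x p) (partition p p<n)) (*-identityˡ _)))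

          -- At the largest `a` with a threshold below `f`, at most a + 1 indices have been counted,
          -- so s^d + 1 ≤ `threshold a` < `f`.
          count : ∀ f m → let s = Σ< m (λ a → lt01 (threshold a) f) in 0# ≤ s × s ≤ fromℕ m × (s ≡ 0# ⊎ s ^ d + 1# < f)
          count f zero = ≤-refl , ≤-refl , inj₁ refl
          count f (suc m) with count f m | lt01-cases (threshold m) f
          ... | 0≤s , s≤m , h | inj₂ (_ , e) = ≤-respʳ (sym s≡) 0≤s , ≤-respˡ (sym s≡) (≤-trans s≤m (y≤x+y 0≤1)) , subst (λ s → s ≡ 0# ⊎ s ^ d + 1# < f) (sym s≡) h
            where
            s≡ : Σ< m (λ a → lt01 (threshold a) f) + lt01 (threshold m) f ≡ Σ< m (λ a → lt01 (threshold a) f)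
            s≡ = trans (cong (Σ< m (λ a → lt01 (threshold a) f) +_) e) (+-identityʳ _)
          ... | 0≤s , s≤m , h | inj₁ (t<f , e) = +-nonneg 0≤s (lt01-nonneg _ _) , ≤-respʳ (+-comm _ _) (+-mono-≤ s≤m (≡⇒≤ e)) ,
              inj₂ (≤-<-trans (+-mono-≤ (^-mono-≤ d (+-nonneg 0≤s (lt01-nonneg _ _)) (+-mono-≤ s≤m (≡⇒≤ e))) ≤-refl) t<f)

          s : ℕ → ℝ
          s c = Σ< n (g c)

          sumEnf≡ : sumEnf ≡ Σ< n (λ c → s c ^ d)
          sumEnf≡ = Σ-ext n λ c → ΣV-product d (g c)

          s^d≤fc : ∀ c → s c ^ d ≤ fc c
          s^d≤fc c with proj₂ (proj₂ (count (fc c) n))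
          ... | inj₁ e = ≤-respˡ (sym (trans (cong (_^ d) e) (0^ d 1≤d))) (fc-nonneg c)
          ... | inj₂ q = <⇒≤ (≤-<-trans (x≤x+y 0≤1) q)

          -- Summing s^d ≤ `fc c` over the clusters leaves no room for the total. If a cluster has s
          -- > 0, its strict gain of 1 from `count` makes the room; if none has, no moment is
          -- enforced and `1# < F` suffices.
          budget : 1# < F → 1# + sumEnf < F
          budget 1<F with em (∃[ c ] c ℕ.< n × s c ^ d + 1# < fc c)
          ... | yes (c , c<n , q) = <-respˡ (trans (cong (_+ 1#) (sym sumEnf≡)) (+-comm _ _)) (<-respʳ Σfc (Σ-mono-< n (λ i _ → s^d≤fc i) c 1# c<n q))
          ... | no none = <-respˡ (sym (trans (cong (1# +_) (trans sumEnf≡ (Σ-0 n allzero))) (+-identityʳ 1#))) 1<F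
            where
            allzero : ∀ c → c ℕ.< n → s c ^ d ≡ 0#
            allzero c c<n with proj₂ (proj₂ (count (fc c) n))
            ... | inj₁ e = trans (cong (_^ d) e) (0^ d 1≤d)
            ... | inj₂ q = ⊥-elim (none (c , c<n , q))

          threshold≤ : ∀ (α : Vec ℕ d) k → threshold (lookup α k) ≤ L α
          threshold≤ α k = ≤-trans (+-mono-≤ (≤-trans (^-mono-≤ d (+-nonneg (fromℕ-nonneg a) 0≤1) (suc≤2^ a)) (≡⇒≤ (^-swap (1# + 1#) a d))) (1≤^ a 1≤B))
            (≤-trans (≡⇒≤ (solve 1 (λ b → b :+ b := (:1 :+ :1) :* b) refl (B ^ a))) (*-monoˡ-≤ (<⇒≤ 0<2) (factor≤ΠF (λ k → 1≤^ (lookup α k) 1≤B) k)))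
            where a = lookup α k

          -- Either the moment is preserved in this round, or so few fractional weights are left in
          -- the cluster that it may be dropped for good.
          dichotomy : ∀ c α → (Bounded α × enf c α ≡ 1#) ⊎ fc c ≤ L α
          dichotomy c α with Fin-all-or-some {P = λ k → lookup α k ℕ.< n × g c (lookup α k) ≡ 1#} {Q = λ k → fc c ≤ threshold (lookup α k)} decide
            where
            decide : ∀ k → (lookup α k ℕ.< n × g c (lookup α k) ≡ 1#) ⊎ fc c ≤ threshold (lookup α k)
            decide k with lt01-cases (threshold (lookup α k)) (fc c)
            ... | inj₂ (q , _) = inj₂ q
            ... | inj₁ (_ , e) with lookup α k ℕ.<? n
            ... | yes p = inj₁ (p , e)
            -- An exponent beyond the range of the loops does no harm: `fc c` is at most `n`, which
            -- is at most that exponent and so at most its threshold.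
            ... | no ¬p = inj₂ (≤-trans (fc≤n c) (≤-trans (fromℕ-mono-≤ (ℕP.≮⇒≥ ¬p)) (≤-trans (x≤x+y 0≤1) (≤-trans (self≤^ d 1≤d (y≤x+y (fromℕ-nonneg (lookup α k)))) (x≤x+y 0≤1)))))
          ... | inj₂ (k , q) = inj₂ (≤-trans q (threshold≤ α k))
          ... | inj₁ all = inj₁ ((λ k → proj₁ (all k)) , trans (ΠF-cong λ k → proj₂ (all k)) (trans (ΠF-const d 1#) (1^ d)))

        module Trajectory (X : ℕ → ℕ → ℕ → ℝ) (rounds : ∀ r → Round.RoundResult own (X r) (λ p → X (suc r) p p)) (rg₀ : Range (λ p → X 0 p p)) where

          x : ℕ → ℕ → ℝ
          x r p = X r p p

          module RR (r : ℕ) = Round.RoundResult (rounds r)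

          range : ∀ r → Range (x r)
          range zero    = rg₀
          range (suc r) = RR.range r

          total : ∀ r → Σ< n (x r) ≡ Σ< n (x 0)
          total zero    = refl
          total (suc r) = trans (RR.total r) (total r)

          fl-dec : ∀ r p → fl (x (suc r)) p ≤ fl (x r) p
          fl-dec r p with fl-cases (x r) p
          ... | inj₁ (_ , _ , e) = ≤-respʳ (sym e) (fl-≤1 (x (suc r)) p)
          ... | inj₂ e = ≡⇒≤ (fl-cong {x (suc r)} {x r} (RR.frozen r p e))

          frozen : ∀ r j p → fl (x r) p ≡ 0# → x (r ℕ.+ j) p ≡ x r p
          frozen r zero    p e = cong (λ z → x z p) (ℕP.+-identityʳ r)
          frozen r (suc j) p e = trans (cong (λ z → x z p) (ℕP.+-suc r j)) (trans (RR.frozen (r ℕ.+ j) p (trans (fl-cong {x (r ℕ.+ j)} {x r} ih) e)) ih)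
            where ih = frozen r j p e

          -- Each round that starts with more than one fractional weight removes one, so after `n`
          -- rounds at most one is left.
          floats : ∀ r → Σ< n (fl (x r)) ≤ 1# ⊎ Σ< n (fl (x r)) + fromℕ r ≤ fromℕ n
          floats zero = inj₂ (≤-trans (≡⇒≤ (+-identityʳ _)) (≤-trans (Σ-mono-≤ n λ p _ → fl-≤1 (x 0) p) (≡⇒≤ (trans (Σ-const n 1#) (*-identityʳ _)))))
          floats (suc r) with <-or-≥ 1# (Σ< n (fl (x r))) | floats r
          ... | inj₂ q | _ = inj₁ (≤-trans (Σ-mono-≤ n λ p _ → fl-dec r p) q)
          ... | inj₁ q | inj₁ q' = ⊥-elim (<⇒≱ q q')
          ... | inj₁ q | inj₂ q' = inj₂ (≤-trans (≡⇒≤ (sym (+-assoc _ _ _))) (≤-trans (+-mono-≤ (RR.progress r (Budget.budget (X r) q)) ≤-refl) q'))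

          few-floats : Σ< n (fl (x n)) ≤ 1#
          few-floats with floats n
          ... | inj₁ q = q
          ... | inj₂ q = ≤-trans (≤-by (≤⇒0≤ q) (solve 2 (λ a b → :0 :- a := b :- (a :+ b)) refl (Σ< n (fl (x n))) (fromℕ n))) 0≤1

          mono : ℕ → Vec ℕ d → ℕ → ℝ
          mono = Round.mono own (X 0)

          mono-≤1 : ∀ c α p → (∀ k → abs (y p c k) ≤ 1#) → abs (mono c α p) ≤ 1#
          mono-≤1 c α p h = ≤-trans (≡⇒≤ (ΠF-abs {d} _)) (ΠF-≤1 {d} (λ k → abs-nonneg _) λ k →
            ≤-trans (≡⇒≤ (trans (abs-* _ _) (cong₂ _*_ (abs-≥0 (exp-nonneg _)) (abs-^ (y p c k) (lookup α k)))))
              (≤-respʳ (*-identityʳ 1#) (*-mono-≤ (exp-nonneg _) (^-nonneg (lookup α k) (abs-nonneg _)) (exp-≤1 (neg-nonpos (sq-nonneg (y p c k)))) (^-≤1 (lookup α k) (abs-nonneg _) (h k)))))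

          unit-diff : ∀ {a b} → 0# ≤ a × a ≤ 1# → 0# ≤ b × b ≤ 1# → abs (a - b) ≤ 1#
          unit-diff {a} {b} (p , q) (r , s) = abs-≤ (≤-by (+-nonneg (≤⇒0≤ q) r) (solve 2 (λ a b → :1 :- (a :- b) := (:1 :- a) :+ b) refl a b))
            (≤-by (+-nonneg (≤⇒0≤ s) p) (solve 2 (λ a b → :1 :- (:- (a :- b)) := (:1 :- b) :+ a) refl a b))

          -- Weights rounded by round `r` never move again, the others move by at most 1, and on a
          -- cluster the moment weights are at most 1 in absolute value.
          loose : ∀ r j c α → abs (Σ< n (λ p → (x (r ℕ.+ j) p - x r p) * (own c p * mono c α p))) ≤ Round.fc own (X r) c
          loose r j c α = ≤-trans (Σ-abs n _) (Σ-mono-≤ n bound)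
            where
            bound : ∀ p → p ℕ.< n → abs ((x (r ℕ.+ j) p - x r p) * (own c p * mono c α p)) ≤ own c p * fl (x r) p
            bound p p<n with fl-cases (x r) p | own-cases c p
            ... | inj₂ e | _ = ≡⇒≤ (trans (cong abs (trans (cong (λ z → (z - x r p) * (own c p * mono c α p)) (frozen r j p e)) (trans (cong (_* (own c p * mono c α p)) (-‿inverseʳ _)) (zeroˡ _)))) (trans (abs-≥0 ≤-refl) (sym (trans (cong (own c p *_) e) (zeroʳ _)))))
            ... | inj₁ _ | inj₁ e = ≡⇒≤ (trans (cong abs (trans (cong (λ z → (x (r ℕ.+ j) p - x r p) * (z * mono c α p)) e) (trans (cong ((x (r ℕ.+ j) p - x r p) *_) (zeroˡ _)) (zeroʳ _)))) (trans (abs-≥0 ≤-refl) (sym (trans (cong (_* fl (x r) p) e) (zeroˡ _)))))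
            ... | inj₁ (_ , _ , e) | inj₂ (e' , _ , h) = ≤-trans (≡⇒≤ (trans (cong abs (cong (λ z → (x (r ℕ.+ j) p - x r p) * (z * mono c α p)) e')) (trans (cong abs (cong ((x (r ℕ.+ j) p - x r p) *_) (*-identityˡ _))) (abs-* _ _))))
              (≤-trans (*-mono-≤ (abs-nonneg _) (abs-nonneg _) (unit-diff (range (r ℕ.+ j) p p<n) (range r p p<n)) (mono-≤1 c α p h)) (≡⇒≤ (sym (cong₂ _*_ e' e))))

          -- Induction on the number `j` of rounds left. A round that enforces the moment
          -- contributes nothing; at the first one that does not, the whole remaining change is
          -- bounded by the number of fractional weights in the cluster, hence by `L α`.
          moment-bound : ∀ j r c → c ℕ.< n → ∀ α → abs (Σ< n (λ p → (x (r ℕ.+ j) p - x r p) * (own c p * mono c α p))) ≤ L α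
          moment-bound zero r c c<n α = ≤-trans (≡⇒≤ (trans (cong abs (Σ-0 n λ p _ → trans (cong (λ z → (x z p - x r p) * (own c p * mono c α p)) (ℕP.+-identityʳ r)) (trans (cong (_* (own c p * mono c α p)) (-‿inverseʳ _)) (zeroˡ _)))) (abs-≥0 ≤-refl)))
            (*-nonneg (<⇒≤ 0<2) (ΠF-nonneg {d} λ k → ^-nonneg (lookup α k) (≤-trans 0≤1 1≤B)))
          moment-bound (suc j) r c c<n α with Budget.dichotomy (X r) c α
          ... | inj₂ q = ≤-trans (loose r (suc j) c α) q
          ... | inj₁ (bd , e) = ≤-respˡ (cong abs (sym split)) (moment-bound j (suc r) c c<n α)
            where
            w : ℕ → ℝ
            w p = own c p * mono c α p
            split : Σ< n (λ p → (x (r ℕ.+ suc j) p - x r p) * w p) ≡ Σ< n (λ p → (x (suc r ℕ.+ j) p - x (suc r) p) * w p)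
            split = trans (Σ-ext n λ p → trans (cong (λ z → (x z p - x r p) * w p) (ℕP.+-suc r j)) (solve 4 (λ a b c w → (a :- c) :* w := (a :- b) :* w :+ (b :- c) :* w) refl (x (suc r ℕ.+ j) p) (x (suc r) p) (x r p) (w p)))
              (trans (Σ-+ n _ _) (trans (cong (Σ< n (λ p → (x (suc r ℕ.+ j) p - x (suc r) p) * w p) +_) (RR.moment r c c<n α bd e)) (+-identityʳ _)))

          δ : ℕ → ℝ
          δ p = x n p - x 0 p

          kernel : (Fin d → ℝ) → ℕ → ℝ
          kernel z p = ΠF (λ k → exp (- ((z k - co p k) * (z k - co p k))))

          kernel-split : ∀ z c p → kernel z p ≡ ΠF (λ k → exp (- ((z k - co c k) * (z k - co c k)))) * ΠF (λ k → exp (- (y p c k * y p c k)) * exp (((1# + 1#) * (z k - co c k)) * y p c k))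
          kernel-split z c p = trans (ΠF-cong {d} factor) (ΠF-* {d} _ _)
            where
            factor : ∀ k → exp (- ((z k - co p k) * (z k - co p k))) ≡ exp (- ((z k - co c k) * (z k - co c k))) * (exp (- (y p c k * y p c k)) * exp (((1# + 1#) * (z k - co c k)) * y p c k))
            factor k = trans (cong exp (solve 3 (λ z p c → :- ((z :- p) :* (z :- p)) := (:- ((z :- c) :* (z :- c))) :+ ((:- ((p :- c) :* (p :- c))) :+ ((:1 :+ :1) :* (z :- c)) :* (p :- c))) refl (z k) (co p k) (co c k)))
              (trans (exp-+ _ _) (cong (exp (- ((z k - co c k) * (z k - co c k))) *_) (exp-+ _ _)))

          -- Around the centre the kernel is a Gaussian in z - c times a generating function of the
          -- moments. `moment-bound` feeds `exp-moments-product`, and the Gaussian absorbs the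
          -- exponential growth coordinate by coordinate.
          cluster-bound : ∀ z c → c ℕ.< n → abs (Σ< n (λ p → (δ p * own c p) * kernel z p)) ≤ (1# + 1#) * (E ^ d * ΠF (λ k → exp (- abs (z k - co c k))))
          cluster-bound z c c<n =
            abs (Σ< n (λ p → (δ p * own c p) * kernel z p)) ≡⟨ cong abs (trans (Σ-ext n λ p → trans (cong ((δ p * own c p) *_) (kernel-split z c p)) (solve 3 (λ w a b → w :* (a :* b) := a :* (w :* b)) refl (δ p * own c p) G (H p))) (Σ-*ˡ n G _)) ⟩≤
            abs (G * Σ< n (λ p → (δ p * own c p) * H p)) ≡⟨ trans (abs-* _ _) (cong (_* abs (Σ< n (λ p → (δ p * own c p) * H p))) (abs-≥0 0≤G)) ⟩≤
            G * abs (Σ< n (λ p → (δ p * own c p) * H p)) ≤⟨ *-monoˡ-≤ 0≤G (exp-moments-product n (λ p → δ p * own c p) (λ k p → exp (- (y p c k * y p c k))) (λ k p → y p c k) (λ k → (1# + 1#) * v k) (1# + 1#) B (<⇒≤ 0<2) (≤-trans 0≤1 1≤B) moments) ⟩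
            G * ((1# + 1#) * ΠF (λ k → exp (B * abs ((1# + 1#) * v k)))) ≡⟨ trans (solve 3 (λ g t h → g :* (t :* h) := t :* (g :* h)) refl G (1# + 1#) _) (cong ((1# + 1#) *_) (sym (ΠF-* {d} _ _))) ⟩≤
            (1# + 1#) * ΠF (λ k → exp (- (v k * v k)) * exp (B * abs ((1# + 1#) * v k))) ≤⟨ *-monoˡ-≤ (<⇒≤ 0<2) (ΠF-mono-≤ {d} (λ k → *-nonneg (exp-nonneg _) (exp-nonneg _)) λ k →
                ≤-respˡ (cong (λ u → exp (- (v k * v k)) * exp u) (scale (v k))) (gauss-tail B' (v k) (*-nonneg (<⇒≤ 0<2) (≤-trans 0≤1 1≤B)))) ⟩
            (1# + 1#) * ΠF (λ k → E * exp (- abs (v k))) ≡⟨ cong ((1# + 1#) *_) (trans (ΠF-* {d} _ _) (cong (_* ΠF (λ k → exp (- abs (v k)))) (ΠF-const d E))) ⟩≤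
            (1# + 1#) * (E ^ d * ΠF (λ k → exp (- abs (v k)))) □
            where
            v : Fin d → ℝ
            v k = z k - co c k
            G : ℝ
            G = ΠF (λ k → exp (- (v k * v k)))
            0≤G : 0# ≤ G
            0≤G = ΠF-nonneg {d} λ k → exp-nonneg _
            H : ℕ → ℝ
            H p = ΠF (λ k → exp (- (y p c k * y p c k)) * exp (((1# + 1#) * v k) * y p c k))
            scale : ∀ u → B' * abs u ≡ B * abs ((1# + 1#) * u)
            scale u = trans (solve 3 (λ t b u → t :* b :* u := b :* (t :* u)) refl (1# + 1#) B (abs u)) (cong (B *_) (sym (trans (abs-* (1# + 1#) u) (cong (_* abs u) (abs-≥0 (<⇒≤ 0<2))))))
            moments : ∀ (α : Vec ℕ d) → abs (Σ< n (λ p → (δ p * own c p) * ΠF (λ k → exp (- (y p c k * y p c k)) * y p c k ^ lookup α k))) ≤ (1# + 1#) * ΠF (λ k → B ^ lookup α k)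
            moments α = ≤-respˡ (cong abs (Σ-ext n λ p → sym (*-assoc (δ p) (own c p) _))) (moment-bound n 0 c c<n α)

          0≤K' : 0# ≤ (1# + 1#) * E ^ d
          0≤K' = *-nonneg (<⇒≤ 0<2) (^-nonneg d (exp-nonneg _))

          -- The partition distributes the sum over the clusters. An index that is not a centre owns
          -- nothing, and the bounds at the centres are summed by `packing`, seen from `z`.
          discrepancy : ∀ z → abs (Σ< n (λ p → δ p * kernel z p)) ≤ K
          discrepancy z =
            abs (Σ< n (λ p → δ p * kernel z p)) ≡⟨ cong abs (trans (Σ-cong n λ p p<n → sym (trans (Σ-ext n λ c → solve 3 (λ a o k → (a :* o) :* k := o :* (a :* k)) refl (δ p) (own c p) (kernel z p)) (trans (Σ-*ʳ n (δ p * kernel z p) _) (trans (cong (_* (δ p * kernel z p)) (partition p p<n)) (*-identityˡ _))))) (Σ-swap n n _)) ⟩≤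
            abs (Σ< n (λ c → Σ< n (λ p → (δ p * own c p) * kernel z p))) ≤⟨ Σ-abs n _ ⟩
            Σ< n (λ c → abs (Σ< n (λ p → (δ p * own c p) * kernel z p))) ≤⟨ Σ-mono-≤ n each ⟩
            Σ< n (λ c → ((1# + 1#) * E ^ d) * (𝟙 (S c) * tail c)) ≡⟨ Σ-*ˡ n ((1# + 1#) * E ^ d) _ ⟩≤
            ((1# + 1#) * E ^ d) * Σ< n (λ c → 𝟙 (S c) * tail c) ≤⟨ *-monoˡ-≤ 0≤K' (packing n S (λ c k → z k - co c k) sep) ⟩
            ((1# + 1#) * E ^ d) * fromℕ 4 ^ d ≡⟨ *-assoc _ _ _ ⟩≤
            K □
            where
            tail : ℕ → ℝ
            tail c = ΠF (λ k → exp (- abs (z k - co c k)))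
            sep : Separated S (λ c k → z k - co c k)
            sep c c' ne s s' with separated c c' ne s s'
            ... | k , q = k , <-respʳ (solve 3 (λ a b z → (a :- b) :* (a :- b) := ((z :- a) :- (z :- b)) :* ((z :- a) :- (z :- b))) refl (co c k) (co c' k) (z k)) q
            each : ∀ c → c ℕ.< n → abs (Σ< n (λ p → (δ p * own c p) * kernel z p)) ≤ ((1# + 1#) * E ^ d) * (𝟙 (S c) * tail c)
            each c c<n with 𝟙-cases (S c)
            ... | inj₁ (_ , e) = ≤-trans (cluster-bound z c c<n) (≡⇒≤ (trans (sym (*-assoc _ _ _)) (cong (((1# + 1#) * E ^ d) *_) (sym (trans (cong (_* tail c) e) (*-identityˡ _))))))
            ... | inj₂ (¬s , e) = ≤-trans (≡⇒≤ (trans (cong abs (Σ-0 n λ p _ → trans (cong (λ o → (δ p * o) * kernel z p) (empty p)) (trans (cong (_* kernel z p) (zeroʳ _)) (zeroˡ _)))) (abs-≥0 ≤-refl)))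
                (*-nonneg 0≤K' (*-nonneg (𝟙-nonneg (S c)) (ΠF-nonneg {d} λ k → exp-nonneg _)))
              where
              empty : ∀ p → own c p ≡ 0#
              empty p with own-cases c p
              ... | inj₁ o = o
              ... | inj₂ (_ , s , _) = ⊥-elim (¬s s)

  -- Greedy clustering and the choice of the size m.

  module Clustering where

    open Reals
    open Sums
    open Geometry using (Separated)
    open Projection
    open Rounding
    open Algorithms
    open Discrepancies

    module MainProgram (d : ℕ) where
      open Algorithm d hiding (module Run) public

      gainE : ∀ {m} → Fin m → Fin m → Expr m
      gainE c j = mul (notE (arr aAsg c c)) (mul (notE (arr aAsg j j)) (nearE c j))

      eqE : ∀ {m} → Fin m → Fin m → Expr m
      eqE i j = mul (notE (ltI i j)) (notE (ltI j i))

      -- m is a real from the start. It grows by 1 in each of the `n` iterations until m ε exceeds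
      -- `C`, so it ends as `n` or as the least integer with m ε > C.
      countC : ∀ {m} → ℕ → Cmd m
      countC C = tab aM nil ⟫ for (tab aM (add (arr aM zero (suc zero)) (notE (lt (numE C) (mul (arr aM zero (suc zero)) (epsE zero))))))

      clusterC : ∀ {m} → Cmd m
      clusterC = tab aAsg nil ⟫ tab aOwn nil ⟫
        for (tab aOwn (add (arr aOwn zero (suc zero)) (mul (eqE zero (suc (suc zero))) (gainE (suc (suc zero)) (suc zero)))) ⟫
             tab aAsg (add (arr aAsg zero zero) (gainE (suc (suc zero)) zero)))

      mainC : ℕ → Cmd 0
      mainC C = countC C ⟫ tab aX (div (arr aM zero zero) (sumE one)) ⟫ clusterC ⟫ for roundC

      module MainRun (n : ℕ) (low : ℕ → ℝ) where
        open Algorithm.Run d n low public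

        near : ℕ → ℕ → ℝ
        near c j = ΠF (λ k → 1# - lt01 1# (y j c k * y j c k))

        -- `asg c j` tells whether `j` belongs to a centre before `c`. A point still free at its own
        -- turn becomes a centre and gains all free points within distance 1.
        asg gain : ℕ → ℕ → ℝ
        asg zero    j = 0#
        asg (suc c) j = asg c j + gain c j
        gain c j = (1# - asg c c) * ((1# - asg c j) * near c j)

        near-cases : ∀ c j → (near c j ≡ 1# × (∀ k → y j c k * y j c k ≤ 1#)) ⊎ (near c j ≡ 0# × (∃[ k ] 1# < y j c k * y j c k))
        near-cases c j = go {d} (λ k → y j c k * y j c k)
          where
          go : ∀ {d'} (f : Fin d' → ℝ) → (ΠF (λ k → 1# - lt01 1# (f k)) ≡ 1# × (∀ k → f k ≤ 1#)) ⊎ (ΠF (λ k → 1# - lt01 1# (f k)) ≡ 0# × (∃[ k ] 1# < f k))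
          go {zero}   f = inj₁ (refl , λ ())
          go {suc d'} f with lt01-cases 1# (f zero) | go (λ k → f (suc k))
          ... | inj₁ (p , e) | _ = inj₂ (trans (cong (λ z → (1# - z) * ΠF (λ k → 1# - lt01 1# (f (suc k)))) e) (trans (cong (_* ΠF (λ k → 1# - lt01 1# (f (suc k)))) (-‿inverseʳ 1#)) (zeroˡ _)) , zero , p)
          ... | inj₂ (_ , _) | inj₂ (e , k , p) = inj₂ (trans (cong ((1# - lt01 1# (f zero)) *_) e) (zeroʳ _) , suc k , p)
          ... | inj₂ (p , e) | inj₁ (e' , ps) = inj₁ (trans (cong₂ (λ a b → (1# - a) * b) e e') (solve 0 ((:1 :- :0) :* :1 := :1) refl) , λ { zero → p ; (suc k) → ps k })

        Is01 : ℝ → Set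
        Is01 z = z ≡ 0# ⊎ z ≡ 1#

        gain-assigned : ∀ c j → asg c j ≡ 1# → gain c j ≡ 0#
        gain-assigned c j e = trans (cong (λ z → (1# - asg c c) * ((1# - z) * near c j)) e) (solve 2 (λ a b → a :* ((:1 :- :1) :* b) := :0) refl (1# - asg c c) (near c j))

        gain-no-centre : ∀ c j → asg c c ≡ 1# → gain c j ≡ 0#
        gain-no-centre c j e = trans (cong (λ z → (1# - z) * ((1# - asg c j) * near c j)) e) (solve 1 (λ a → (:1 :- :1) :* a := :0) refl ((1# - asg c j) * near c j))

        gain-far : ∀ c j → near c j ≡ 0# → gain c j ≡ 0#
        gain-far c j e = trans (cong (λ z → (1# - asg c c) * ((1# - asg c j) * z)) e) (solve 2 (λ a b → a :* (b :* :0) := :0) refl (1# - asg c c) (1# - asg c j))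

        gain-new : ∀ c j → asg c c ≡ 0# → asg c j ≡ 0# → near c j ≡ 1# → gain c j ≡ 1#
        gain-new c j e f g = trans (cong₂ (λ a b → (1# - a) * b) e (cong₂ (λ a b → (1# - a) * b) f g)) (solve 0 ((:1 :- :0) :* ((:1 :- :0) :* :1) := :1) refl)

        asg-01 : ∀ c j → Is01 (asg c j)
        gain-cases : ∀ c j → gain c j ≡ 0# ⊎ (gain c j ≡ 1# × asg c c ≡ 0# × asg c j ≡ 0# × near c j ≡ 1#)
        gain-cases c j with asg-01 c c | asg-01 c j | near-cases c j
        ... | inj₂ e | _ | _ = inj₁ (gain-no-centre c j e)
        ... | inj₁ _ | inj₂ e | _ = inj₁ (gain-assigned c j e)
        ... | inj₁ _ | inj₁ _ | inj₂ (e , _) = inj₁ (gain-far c j e)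
        ... | inj₁ e | inj₁ f | inj₁ (g , _) = inj₂ (gain-new c j e f g , e , f , g)
        asg-01 zero    j = inj₁ refl
        asg-01 (suc c) j with asg-01 c j | gain-cases c j
        ... | inj₁ e | inj₁ f = inj₁ (trans (cong₂ _+_ e f) (+-identityˡ 0#))
        ... | inj₁ e | inj₂ (f , _) = inj₂ (trans (cong₂ _+_ e f) (+-identityˡ 1#))
        ... | inj₂ e | _ = inj₂ (trans (cong₂ _+_ e (gain-assigned c j e)) (+-identityʳ 1#))

        asg-mono : ∀ {c c'} j → c ℕ.≤′ c' → asg c j ≡ 1# → asg c' j ≡ 1#
        asg-mono j ℕ.≤′-refl e = e
        asg-mono {c' = suc c'} j (ℕ.≤′-step p) e = let h = asg-mono j p e in trans (cong₂ _+_ h (gain-assigned c' j h)) (+-identityʳ 1#)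

        near-self : ∀ j → near j j ≡ 1#
        near-self j with near-cases j j
        ... | inj₁ (e , _) = e
        ... | inj₂ (_ , k , p) = ⊥-elim (<⇒≱ p (≤-respˡ (sym (solve 1 (λ a → (a :- a) :* (a :- a) := :0) refl (co j k))) 0≤1))

        asg-self : ∀ j → asg (suc j) j ≡ 1#
        asg-self j with asg-01 j j
        ... | inj₂ e = asg-mono {j} {suc j} j (ℕ.≤′-step ℕ.≤′-refl) e
        ... | inj₁ e = trans (cong₂ _+_ e (gain-new j j e e (near-self j))) (+-identityˡ 1#)

        Σ-gain : ∀ m j → Σ< m (λ c → gain c j) ≡ asg m j
        Σ-gain zero    j = refl
        Σ-gain (suc m) j = cong (_+ gain m j) (Σ-gain m j)

        Centre : ℕ → Set
        Centre c = asg c c ≡ 0#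

        -- A point near an earlier centre is assigned once that centre has had its turn, and stays
        -- so; it cannot become a centre itself.
        far : ∀ {c c'} → c ℕ.< c' → Centre c → Centre c' → ∃[ k ] 1# < y c' c k * y c' c k
        far {c} {c'} c<c' s s' with near-cases c c' | asg-01 c c'
        ... | inj₂ (_ , q) | _ = q
        ... | inj₁ (e , _) | inj₂ a = ⊥-elim (0≢1 (trans (sym s') (asg-mono c' (ℕP.≤⇒≤′ (ℕP.<⇒≤ c<c')) a)))
        ... | inj₁ (e , _) | inj₁ a = ⊥-elim (0≢1 (trans (sym s') (asg-mono {suc c} c' (ℕP.≤⇒≤′ c<c') (trans (cong₂ _+_ a (gain-new c c' s a e)) (+-identityˡ 1#)))))

        separated : Separated Centre co
        separated c c' ne s s' with ℕP.<-cmp c c'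
        ... | tri≈ _ e _ = ⊥-elim (ne e)
        ... | tri< p _ _ = let (k , q) = far p s s' in k , <-respʳ (solve 2 (λ a b → (b :- a) :* (b :- a) := (a :- b) :* (a :- b)) refl (co c k) (co c' k)) q
        ... | tri> _ _ p = far p s' s

        abs≤1 : ∀ z → z * z ≤ 1# → abs z ≤ 1#
        abs≤1 z p with <-or-≥ 1# (abs z)
        ... | inj₂ q = q
        ... | inj₁ q = ⊥-elim (<⇒≱ (<-≤-trans q (≤-respˡ (*-identityʳ (abs z)) (*-monoˡ-≤ (abs-nonneg z) (<⇒≤ q)))) (≤-respˡ (trans (sym (abs-≥0 (sq-nonneg z))) (abs-* z z)) p))

        -- The form in which the loop of `clusterC` accumulates membership; for `i` below `n` the
        -- delta picks `gain i j`.
        own : ℕ → ℕ → ℝ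
        own i j = Σ< n (λ c → eq01 i c * gain c j)

        own-gain : ∀ i j → i ℕ.< n → own i j ≡ gain i j
        own-gain i j i<n = Σ-eq01 (λ c → gain c j) i i<n

        clusters : ∀ (1≤d : 1 ℕ.≤ d) (ow : ℕ → ℕ → ℝ) → (∀ i j → ow i j ≡ own i j) → Discrepancy.Clusters d 1≤d n low ow Centre
        clusters 1≤d ow e = record { own-cases = cases ; partition = part ; separated = separated }
          where
          cases : ∀ c p → ow c p ≡ 0# ⊎ (ow c p ≡ 1# × Centre c × (∀ k → abs (y p c k) ≤ 1#))
          cases c p with c ℕ.<? n
          ... | no ¬p = inj₁ (trans (e c p) (Σ-0 n λ i i<n → trans (cong (_* gain i p) (eq01-≢ {c} {i} λ { refl → ¬p i<n })) (zeroˡ _)))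
          ... | yes c<n with gain-cases c p | near-cases c p
          ... | inj₁ g | _ = inj₁ (trans (e c p) (trans (own-gain c p c<n) g))
          ... | inj₂ (g , s , _ , _) | inj₁ (_ , h) = inj₂ (trans (e c p) (trans (own-gain c p c<n) g) , s , λ k → abs≤1 _ (h k))
          ... | inj₂ (_ , _ , _ , h) | inj₂ (h' , _) = ⊥-elim (0≢1 (trans (sym h') h))
          part : ∀ p → p ℕ.< n → Σ< n (λ c → ow c p) ≡ 1#
          part p p<n = trans (Σ-cong n λ c c<n → trans (e c p) (own-gain c p c<n)) (trans (Σ-gain n p) (asg-mono {suc p} p (ℕP.≤⇒≤′ p<n) (asg-self p)))

        ClusterState : Store → ℕ → Store → Set
        ClusterState σ q σ' = (∀ i → σ' aAsg i i ≡ asg q i) × (∀ i j → σ' aOwn i j ≡ Σ< q (λ c → eq01 i c * gain c j)) × σ' aX ≡ σ aX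

        eval-near : ∀ {m} (c j : Fin m) ρ σ → eval (nearE c j) ρ σ ≡ near (lookup ρ c) (lookup ρ j)
        eval-near c j ρ σ = eval-prodF (λ k → notE (lt one (mul (diffE k j c) (diffE k j c)))) ρ σ

        cluster-correct : ∀ {m} (ρ : Vec ℕ m) σ → ClusterState σ n (effect clusterC ρ σ)
        cluster-correct ρ σ = iterate-inv (ClusterState σ) n ((λ i → refl) , (λ i j → refl) , refl)
          λ { q σ' q<n (eA , eO , eX) →
            (λ i → cong₂ _+_ (eA i) (cong₂ _*_ (cong (λ z → 1# - z) (eA q)) (cong₂ _*_ (cong (λ z → 1# - z) (eA i)) (eval-near (suc (suc zero)) zero (i ∷ i ∷ q ∷ ρ) _)))) ,
            (λ i j → cong₂ _+_ (eO i j) (cong (eq01 i q *_) (cong₂ _*_ (cong (λ z → 1# - z) (eA q)) (cong₂ _*_ (cong (λ z → 1# - z) (eA j)) (eval-near (suc (suc zero)) (suc zero) (i ∷ j ∷ q ∷ ρ) σ'))))) , eX }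

        module Count (C : ℕ) (0<ε : 0# < low 0) where

          -- The last component is the test that the predecessor of `m` passed; it yields the size
          -- bound. The disjunction before it yields the error bound.
          CountState : ℕ → Store → Set
          CountState q σ' = ∃[ m ] (∀ i j → σ' aM i j ≡ fromℕ m) × m ℕ.≤ q × (m ≡ q ⊎ fromℕ C < fromℕ m * low 0) × (∀ m' → m ≡ suc m' → fromℕ m' * low 0 ≤ fromℕ C)

          eval-test : ∀ {k} (ρ : Vec ℕ (suc (suc k))) σ → eval (lt (numE C) (mul (arr aM zero (suc zero)) (epsE zero))) ρ σ ≡ lt01 (fromℕ C) (σ aM (lookup ρ zero) (lookup ρ (suc zero)) * low 0)
          eval-test ρ σ = cong (λ z → lt01 z _) (eval-num C ρ σ)

          count-correct : ∀ {k} (ρ : Vec ℕ k) σ → CountState n (effect (countC C) ρ σ)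
          count-correct ρ σ = iterate-inv CountState n (0 , (λ _ _ → refl) , ℕ.z≤n , inj₁ refl , λ _ ()) step
            where
            step : ∀ q σ' → q ℕ.< n → CountState q σ' → CountState (suc q) (effect (tab aM (add (arr aM zero (suc zero)) (notE (lt (numE C) (mul (arr aM zero (suc zero)) (epsE zero)))))) (q ∷ ρ) σ')
            step q σ' q<n (m , eM , m≤q , top , bot) with lt01-cases (fromℕ C) (fromℕ m * low 0)
            ... | inj₁ (big , e) = m , (λ i j → trans (cong₂ _+_ (eM i j) (cong (λ z → 1# - z) (trans (eval-test (i ∷ j ∷ q ∷ ρ) σ') (trans (cong (λ z → lt01 (fromℕ C) (z * low 0)) (eM i j)) e)))) (solve 1 (λ a → a :+ (:1 :- :1) := a) refl (fromℕ m))) ,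
                ℕP.m≤n⇒m≤1+n m≤q , inj₂ big , bot
            ... | inj₂ (small , e) = suc m , (λ i j → trans (cong₂ _+_ (eM i j) (cong (λ z → 1# - z) (trans (eval-test (i ∷ j ∷ q ∷ ρ) σ') (trans (cong (λ z → lt01 (fromℕ C) (z * low 0)) (eM i j)) e)))) (solve 1 (λ a → a :+ (:1 :- :0) := :1 :+ a) refl (fromℕ m))) ,
                ℕ.s≤s m≤q , inj₁ (cong suc (m≡q top)) , λ { _ refl → small }
              where
              m≡q : m ≡ q ⊎ fromℕ C < fromℕ m * low 0 → m ≡ q
              m≡q (inj₁ e) = e
              m≡q (inj₂ q) = ⊥-elim (<⇒≱ q small)

  -- From the final weights to the coreset.

  module Assembling where

    open Reals
    open Sums
    open Analysis
    open Geometry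
    open Projection
    open Rounding
    open Discrepancies
    open Clustering
    open RealRAM 𝓡
    open import Data.Fin using (fromℕ<)
    import Data.Fin.Properties as FinP
    open import Data.Fin.Subset using (Subset; ∣_∣; Nonempty)
    open import Data.List as List using (List; []; _∷_; length; map; concatMap)
    import Data.List.Properties as ListP
    import Data.List.Relation.Unary.All as All
    open import Data.Maybe using (just; fromMaybe)
    open import Data.Vec as Vec using (toList; tabulate; zipWith)
    import Data.Vec.Properties as VecP

    sum-toList : ∀ {A : Set} {n} (v : Vec A n) (f : A → ℝ) (F : ℕ → ℝ) → (∀ i → F (toℕ i) ≡ f (lookup v i)) → sumℝ (map f (toList v)) ≡ Σ< n F
    sum-toList []      f F h = refl
    sum-toList {n = suc n} (a ∷ v) f F h = trans (cong₂ _+_ (sym (h zero)) (sum-toList v f (λ i → F (suc i)) (λ i → h (suc i)))) (sym (Σ-head n F))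

    sum-select : ∀ {A : Set} {n} (b : Fin n → Bool) (v : Vec A n) (f : A → ℝ) (F : ℕ → ℝ) → (∀ i → F (toℕ i) ≡ (if b i then f (lookup v i) else 0#)) → sumℝ (map f (select (tabulate b) v)) ≡ Σ< n F
    sum-select b []      f F h = refl
    sum-select {n = suc n} b (a ∷ v) f F h with b zero | h zero
    ... | true  | e = trans (cong₂ _+_ (sym e) (sum-select (λ i → b (suc i)) v f (λ i → F (suc i)) (λ i → h (suc i)))) (sym (Σ-head n F))
    ... | false | e = trans (sum-select (λ i → b (suc i)) v f (λ i → F (suc i)) (λ i → h (suc i))) (trans (sym (+-identityˡ _)) (trans (cong (_+ Σ< n (λ i → F (suc i))) (sym e)) (sym (Σ-head n F))))

    length-select : ∀ {A : Set} {n} (Q : Subset n) (v : Vec A n) → length (select Q v) ≡ ∣ Q ∣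
    length-select []          []      = refl
    length-select (true  ∷ Q) (a ∷ v) = cong suc (length-select Q v)
    length-select (false ∷ Q) (a ∷ v) = length-select Q v

    sum-ones : ∀ {A : Set} (l : List A) → sumℝ (map (λ _ → 1#) l) ≡ fromℕ (length l)
    sum-ones []      = refl
    sum-ones (_ ∷ l) = cong (1# +_) (sum-ones l)

    nth-++ˡ : ∀ {A : Set} {d} (v : Vec A d) (l : List A) k → nth (toList v List.++ l) (toℕ k) ≡ just (lookup v k)
    nth-++ˡ (a ∷ v) l zero    = refl
    nth-++ˡ (a ∷ v) l (suc k) = nth-++ˡ v l k

    nth-++ʳ : ∀ {A : Set} {d} (v : Vec A d) (l : List A) i → nth (toList v List.++ l) (d ℕ.+ i) ≡ nth l i
    nth-++ʳ []      l i = refl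
    nth-++ʳ (a ∷ v) l i = nth-++ʳ v l i

    nth-concat : ∀ {A : Set} {d n} (P : Vec (Vec A d) n) i k → nth (concatMap toList (toList P)) (d ℕ.* toℕ i ℕ.+ toℕ k) ≡ just (lookup (lookup P i) k)
    nth-concat {d = d} (p ∷ P) zero    k = trans (cong (λ z → nth (concatMap toList (toList (p ∷ P))) (z ℕ.+ toℕ k)) (ℕP.*-zeroʳ d)) (nth-++ˡ p _ k)
    nth-concat {d = d} (p ∷ P) (suc i) k = trans (cong (nth (concatMap toList (toList (p ∷ P)))) (trans (cong (ℕ._+ toℕ k) (ℕP.*-suc d (toℕ i))) (ℕP.+-assoc d _ _)))
      (trans (nth-++ʳ p _ (d ℕ.* toℕ i ℕ.+ toℕ k)) (nth-concat P i k))

    length-bitStrings : ∀ T → length (bitStrings T) ≡ 2 ℕ.^ T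
    length-bitStrings zero    = refl
    length-bitStrings (suc T) = trans (ListP.length-++ (map (true ∷_) (bitStrings T)))
      (cong₂ ℕ._+_ (trans (ListP.length-map _ (bitStrings T)) (length-bitStrings T)) (trans (ListP.length-map _ (bitStrings T)) (trans (length-bitStrings T) (sym (ℕP.+-identityʳ _)))))

    Pr-certain : ∀ T (E : Vec Bool T → Set) → (∀ ω → E ω) → Pr T E ≡ 1#
    Pr-certain T E h = trans (cong (λ z → fromℕ z * fromℕ (2 ℕ.^ T) ⁻¹) (trans (cong length (ListP.filter-all (λ ω → em (E ω)) {bitStrings T} (All.universal h (bitStrings T)))) (length-bitStrings T)))
      (*-inverse _ (>⇒≢ (fromℕ-pos (ℕP.m^n>0 2 T))))

    ⅔≤1 : ⅔ ≤ 1#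
    ⅔≤1 = *⁻¹-≤ (fromℕ-suc-pos 2) (≤-respʳ (sym (*-identityˡ _)) (fromℕ-mono-≤ {2} {3} (ℕP.n≤1+n 2)))

    gap-cases : ∀ x → 0# ≤ x → x ≤ 1# → (lt01 0# x ≡ x) ⊎ (0# < x × x < 1# × lt01 0# x ≡ 1#)
    gap-cases x 0≤x x≤1 with lt01-cases 0# x | lt01-cases x 1#
    ... | inj₂ (x≤0 , e) | _ = inj₁ (trans e (≤-antisym 0≤x x≤0))
    ... | inj₁ (0<x , e) | inj₁ (x<1 , _) = inj₂ (0<x , x<1 , e)
    ... | inj₁ (0<x , e) | inj₂ (1≤x , _) = inj₁ (trans e (≤-antisym 1≤x x≤1))

    -- Rounding the fractional weights up changes the total by less than 1: there is at most one,
    -- and it gains 1 - x p. Both totals are integers, hence equal, and nothing was fractional.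
    integral : ∀ n (x : ℕ → ℝ) m z → Moves.Range n x → Σ< n (fl x) ≤ 1# → Σ< n x ≡ fromℕ m → Σ< n (λ p → lt01 0# (x p)) ≡ fromℕ z →
      z ≡ m × (∀ p → p ℕ.< n → x p ≡ lt01 0# (x p))
    integral n x m z rg few sx sz = z≡m , λ p p<n → ≤-antisym (0≤⇒≤ (gap-nonneg p p<n)) (≤-by (neg-nonneg (≤-respʳ gap0 (term≤Σ n gap-nonneg p p<n))) (solve 2 (λ a b → a :- b := :- (b :- a)) refl (x p) (lt01 0# (x p))))
      where
      gap : ℕ → ℝ
      gap p = lt01 0# (x p) - x p
      Σgap : Σ< n gap ≡ fromℕ z - fromℕ m
      Σgap = trans (Σ-- n _ _) (cong₂ _-_ sz sx)
      gap-nonneg : ∀ p → p ℕ.< n → 0# ≤ gap p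
      gap-nonneg p p<n with gap-cases (x p) (proj₁ (rg p p<n)) (proj₂ (rg p p<n))
      ... | inj₁ e = ≡⇒≤ (sym (trans (cong (_- x p) e) (-‿inverseʳ _)))
      ... | inj₂ (_ , x<1 , e) = ≤-respʳ (cong (_- x p) (sym e)) (≤⇒0≤ (<⇒≤ x<1))
      gap≤fl : ∀ p → p ℕ.< n → gap p ≤ fl x p
      gap≤fl p p<n with gap-cases (x p) (proj₁ (rg p p<n)) (proj₂ (rg p p<n))
      ... | inj₁ e = ≤-respˡ (sym (trans (cong (_- x p) e) (-‿inverseʳ _))) (fl-nonneg x p)
      ... | inj₂ (0<x , x<1 , e) = ≤-by (<⇒≤ 0<x) (trans (cong₂ (λ a b → a - (b - x p)) (fl-true {x} 0<x x<1) e) (solve 1 (λ x → :1 :- (:1 :- x) := x) refl (x p)))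
      gap<1 : Σ< n gap < 1#
      gap<1 = split (em (∃[ p ] p ℕ.< n × 0# < x p × x p < 1#))
       where
       split : Dec (∃[ p ] p ℕ.< n × 0# < x p × x p < 1#) → Σ< n gap < 1#
       split (yes (p , p<n , 0<x , x<1)) = <-≤-trans (<-by 0<x (solve 2 (λ a b → (a :+ b) :- a := b) refl (Σ< n gap) (x p)))
        (≤-trans (Σ-mono-+ n gap≤fl p (x p) p<n (≡⇒≤ (trans (solve 2 (λ a b → (a :- b) :+ b := a) refl (lt01 0# (x p)) (x p)) (trans (lt01-true 0<x) (sym (fl-true {x} 0<x x<1)))))) few)
       split (no none) = ≤-<-trans (≤-trans (Σ-mono-≤ n gap≤fl) (≡⇒≤ (Σ-0 n zero-fl))) 0<1
        where
        zero-fl : ∀ p → p ℕ.< n → fl x p ≡ 0#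
        zero-fl p p<n with fl-cases x p
        ... | inj₂ e = e
        ... | inj₁ (a , b , _) = ⊥-elim (none (p , p<n , a , b))
      z≡m : z ≡ m
      z≡m = ℕP.≤-antisym
        (ℕ.s≤s⁻¹ (fromℕ-cancel-< (<-by (<⇒0< (<-respˡ Σgap gap<1)) (solve 2 (λ z m → (:1 :+ m) :- z := :1 :- (z :- m)) refl (fromℕ z) (fromℕ m)))))
        (ℕ.s≤s⁻¹ (fromℕ-cancel-< (≤-<-trans (0≤⇒≤ (≤-respʳ Σgap (Σ-nonneg n gap-nonneg))) (<-by 0<1 (solve 1 (λ z → (:1 :+ z) :- z := :1) refl (fromℕ z))))))
      gap0 : Σ< n gap ≡ 0#
      gap0 = trans Σgap (trans (cong (λ w → fromℕ w - fromℕ m) z≡m) (-‿inverseʳ _))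

    -- A bound below `ε` at each point would not keep the supremum below `ε`; the uniform `b` does.
    supDistance : ∀ {d} (P Q : List (Point d)) b ε → b < ε → (∀ x → abs (Ḡ P x - Ḡ Q x) ≤ b) → ∃[ s ] IsSupDistance P Q s × s < ε
    supDistance {d} P Q b ε b<ε h = proj₁ sup , proj₂ sup , ≤-<-trans (≮⇒≥ λ b<s → excess (proj₂ (proj₂ sup) b b<s)) b<ε
      where
      Value : ℝ → Set
      Value y = ∃[ x ] y ≡ abs (Ḡ P x - Ḡ Q x)
      bounded : IsUpperBound Value b
      bounded y (x , e) = ≤-respˡ (sym e) (h x)
      sup : ∃ (IsSup Value)
      sup = complete Value (abs (Ḡ P (Vec.replicate d 0#) - Ḡ Q (Vec.replicate d 0#)) , Vec.replicate d 0# , refl) (b , bounded)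
      excess : ¬ (∃[ y ] Value y × b < y)
      excess (y , v , b<y) = <⇒≱ b<y (bounded y v)

    -- The initial weights `m * i` turn the mean over all points into 1/m times a weighted sum, so
    -- both means have the same normalisation.
    mean-difference : ∀ n (κ x x₀ : ℕ → ℝ) m i → 0# < m → (∀ p → x₀ p ≡ m * i) →
      abs (i * Σ< n κ - m ⁻¹ * Σ< n (λ p → x p * κ p)) ≡ m ⁻¹ * abs (Σ< n (λ p → (x p - x₀ p) * κ p))
    mean-difference n κ x x₀ m i 0<m e = trans (cong abs eq) (trans (abs-neg _) (trans (abs-* _ _) (cong (_* abs (Σ< n (λ p → (x p - x₀ p) * κ p))) (abs-≥0 (<⇒≤ (⁻¹-pos 0<m))))))
      where
      A A' j : ℝ
      A = Σ< n κ
      A' = Σ< n (λ p → x p * κ p)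
      j = m ⁻¹
      Σδ : Σ< n (λ p → (x p - x₀ p) * κ p) ≡ A' - (m * i) * A
      Σδ = trans (Σ-ext n λ p → trans (cong (λ w → (x p - w) * κ p) (e p)) (solve 3 (λ a b k → (a :- b) :* k := a :* k :- b :* k) refl (x p) (m * i) (κ p))) (trans (Σ-- n _ _) (cong (λ w → A' - w) (Σ-*ˡ n (m * i) κ)))
      eq : i * A - j * A' ≡ - (j * Σ< n (λ p → (x p - x₀ p) * κ p))
      eq = trans (cong (λ w → w - j * A') (trans (sym (*-identityˡ (i * A))) (cong (_* (i * A)) (sym (*-inverseˡ m (>⇒≢ 0<m))))))
        (trans (solve 5 (λ j m i a b → (j :* m) :* (i :* a) :- j :* b := :- (j :* (b :- (m :* i) :* a))) refl j m i A A') (cong (λ w → - (j * w)) (sym Σδ)))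

    -- All runs end in the same state, so the probability of success is 1.
    deterministic : ∀ {d n T} (P : Vec (Point d) n) c ε prog s → Halted prog s → (∀ (ω : Vec Bool T) → run prog ω (input P ε) ≡ s) → IsCoreset c ε P (output n s) →
      HaltsWithin T prog (input P ε) × ⅔ ≤ SuccessProbability T prog (input P ε) (IsCoreset c ε P)
    deterministic {n = n} {T} P c ε prog s halted runs good = (λ ω → subst (Halted prog) (sym (runs ω)) halted) ,
      ≤-respʳ (sym (Pr-certain T (λ ω → IsCoreset c ε P (output n (run prog ω (input P ε)))) λ ω → subst (λ s → IsCoreset c ε P (output n s)) (sym (runs ω)) good)) ⅔≤1

    module Assembly (d : ℕ) (1≤d : 1 ℕ.≤ d) where
      open Constants d using (K)
      open MainProgram d hiding (module MainRun)

      -- The programs build their constants from 0 and 1, so a natural number above `K` takes the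
      -- place of `K`.
      C : ℕ
      C = proj₁ (archimedean K)

      K<C : K < fromℕ C
      K<C = proj₂ (archimedean K)

      prog : Program
      prog = compile (mainC C) aX

      module OnInput (n : ℕ) (1≤n : 1 ℕ.≤ n) (P : Vec (Point d) n) (ε : ℝ) (0<ε : 0# < ε) where

        low : ℕ → ℝ
        low a = fromMaybe 0# (nth (ε ∷ concatMap toList (toList P)) a)

        open MainProgram.MainRun d n low
        open Correctness n 1≤n low using (compile-correct; addr)

        σ₀ σ₁ σ₂ σ₃ : Store
        σ₀ k i j = low (addr (arrName k) i j)
        σ₁ = effect (countC C) [] σ₀
        σ₂ = effect (tab aX (div (arr aM zero zero) (sumE one))) [] σ₁
        σ₃ = effect clusterC [] σ₂

        st : ℕ → Store
        st r = iterate r (λ i → effect roundC (i ∷ [])) σ₃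

        counted : Count.CountState C 0<ε n σ₁
        counted = Count.count-correct C 0<ε [] σ₀

        m : ℕ
        m = proj₁ counted

        ow : ℕ → ℕ → ℝ
        ow = σ₃ aOwn

        clustered : ClusterState σ₂ n σ₃
        clustered = cluster-correct [] σ₂

        cl : Discrepancy.Clusters d 1≤d n low ow Centre
        cl = clusters 1≤d ow (proj₁ (proj₂ clustered))

        0<n : 0# < fromℕ n
        0<n = fromℕ-pos 1≤n

        x₀≡ : ∀ p → σ₃ aX p p ≡ fromℕ m * fromℕ n ⁻¹
        x₀≡ p = trans (cong (λ f → f p p) (proj₂ (proj₂ clustered))) (cong₂ (λ a b → a * b ⁻¹) (proj₁ (proj₂ counted) p p) (trans (Σ-const n 1#) (*-identityʳ _)))

        rg₀ : Range (λ p → σ₃ aX p p)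
        rg₀ p _ = ≤-respʳ (sym (x₀≡ p)) (*-nonneg (fromℕ-nonneg m) (⁻¹-nonneg (<⇒≤ 0<n))) ,
          ≤-respˡ (sym (x₀≡ p)) (*⁻¹-≤ 0<n (≤-respʳ (sym (*-identityˡ _)) (fromℕ-mono-≤ (proj₁ (proj₂ (proj₂ counted))))))

        -- Ownership and range are carried through the rounds together: `RoundAt` asks for the
        -- range, and all rounds must refer to one fixed ownership array.
        owned : ∀ r → st r aOwn ≡ ow × Range (λ p → st r aX p p)
        owned zero    = refl , rg₀
        owned (suc r) = trans (RoundAt.own₇ (r ∷ []) (st r) rg) e , Round.RoundResult.range (RoundAt.result (r ∷ []) (st r) rg)
          where
          e = proj₁ (owned r)
          rg = proj₂ (owned r)

        rounds : ∀ r → Round.RoundResult ow (st r aX) (λ p → st (suc r) aX p p)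
        rounds r = subst (λ o → Round.RoundResult o (st r aX) (λ p → st (suc r) aX p p)) (proj₁ (owned r)) (RoundAt.result (r ∷ []) (st r) (proj₂ (owned r)))

        open Discrepancy d 1≤d n low hiding (Clusters)
        open WithClusters cl
        open Trajectory (λ r → st r aX) rounds rg₀

        machine : ∃[ s ] Halted prog s × (∀ p → p ℕ.< n → R s p ≡ x n p) × (∀ {T} → Time.time n (mainC C) aX ℕ.≤ T → (ω : Vec Bool T) → run prog ω (input P ε) ≡ s)
        machine = compile-correct (mainC C) aX (I (input P ε)) low refl (λ _ _ → refl)

        s∞ : State
        s∞ = proj₁ machine

        Q : Subset n
        Q = output n s∞

        out≡ : ∀ i → R s∞ (toℕ i) ≡ x n (toℕ i)
        out≡ i = proj₁ (proj₂ (proj₂ machine)) (toℕ i) (FinP.toℕ<n i)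

        β : ℕ → ℝ
        β p = lt01 0# (x n p)

        chosen : ∀ (f : Point d → ℝ) (F : ℕ → ℝ) → (∀ i → F (toℕ i) ≡ f (lookup P i)) → sumℝ (map f (select Q P)) ≡ Σ< n (λ p → β p * F p)
        chosen f F h = sum-select _ P f (λ p → β p * F p) λ i → trans (cong₂ _*_ (sym (cong (lt01 0#) (out≡ i))) (h i)) (if-* (does (0# <? R s∞ (toℕ i))) (f (lookup P i)))
          where
          if-* : ∀ b z → (if b then 1# else 0#) * z ≡ (if b then z else 0#)
          if-* true  z = *-identityˡ z
          if-* false z = zeroˡ z

        sizeQ : fromℕ ∣ Q ∣ ≡ Σ< n β
        sizeQ = trans (cong fromℕ (sym (length-select Q P))) (trans (sym (sum-ones (select Q P))) (trans (chosen (λ _ → 1#) (λ _ → 1#) (λ _ → refl)) (Σ-ext n λ p → *-identityʳ _)))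

        totalx : Σ< n (x n) ≡ fromℕ m
        totalx = trans (total n) (trans (Σ-ext n x₀≡) (trans (Σ-const n _) (trans (solve 3 (λ n m i → n :* (m :* i) := m :* (n :* i)) refl (fromℕ n) (fromℕ m) (fromℕ n ⁻¹)) (trans (cong (fromℕ m *_) (*-inverse _ (>⇒≢ 0<n))) (*-identityʳ _)))))

        integrality : ∣ Q ∣ ≡ m × (∀ p → p ℕ.< n → x n p ≡ β p)
        integrality = integral n (x n) m ∣ Q ∣ (range n) few-floats totalx (sym sizeQ)

        reached : m ≡ n ⊎ fromℕ C < fromℕ m * ε
        reached = proj₁ (proj₂ (proj₂ (proj₂ counted)))

        1≤m : 1 ℕ.≤ m
        1≤m = go m reached
          where
          go : ∀ k → k ≡ n ⊎ fromℕ C < fromℕ k * ε → 1 ℕ.≤ k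
          go (suc k) _          = ℕ.s≤s ℕ.z≤n
          go zero    (inj₁ e)   = ⊥-elim (ℕP.<⇒≢ 1≤n e)
          go zero    (inj₂ big) = ⊥-elim (<⇒≱ big (≤-respˡ (sym (zeroˡ ε)) (fromℕ-nonneg C)))

        0<m : 0# < fromℕ m
        0<m = fromℕ-pos 1≤m

        nonempty : Nonempty Q
        nonempty = member (Σ-pos⇒∃ n (<-respʳ (trans (sym totalx) (Σ-cong n (proj₂ integrality))) 0<m))
          where
          selected : ∀ {r} → 0# < lt01 0# r → does (0# <? r) ≡ true
          selected {r} q with 0# <? r
          ... | yes _ = refl
          ... | no _  = ⊥-elim (irrefl refl q)
          member : ∃[ p ] p ℕ.< n × 0# < β p → Nonempty Q
          member (p , p<n , q) = i , VecP.lookup⇒[]= i Q (trans (VecP.lookup∘tabulate _ i) (selected (<-respʳ (cong (lt01 0#) (trans (cong (x n) (sym (FinP.toℕ-fromℕ< p<n))) (sym (out≡ i)))) q)))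
            where i = fromℕ< p<n

        -- The predecessor k of `m` satisfies k ε ≤ C, so m ε ≤ C + ε ≤ C + 1.
        size-bound : ε < 1# → fromℕ ∣ Q ∣ ≤ (fromℕ C + 1#) * ε ⁻¹
        size-bound ε<1 = ≤-respˡ (cong fromℕ (sym (proj₁ integrality))) (≤-*⁻¹ 0<ε (bound m refl))
          where
          bound : ∀ k → m ≡ k → fromℕ k * ε ≤ fromℕ C + 1#
          bound zero    e = ≤-respˡ (sym (zeroˡ ε)) (+-nonneg (fromℕ-nonneg C) 0≤1)
          bound (suc k) e = ≤-respˡ (solve 2 (λ k e → k :* e :+ e := (:1 :+ k) :* e) refl (fromℕ k) ε) (+-mono-≤ (proj₂ (proj₂ (proj₂ (proj₂ counted))) k e) (<⇒≤ ε<1))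

        co≡ : ∀ i k → co (toℕ i) k ≡ lookup (lookup P i) k
        co≡ i k = trans (cong low (ℕP.+-suc (d ℕ.* toℕ i) (toℕ k))) (cong (fromMaybe 0#) (nth-concat P i k))

        κ : Point d → Point d → ℝ
        κ z p = exp (- (norm (zipWith _-_ z p) ^ 2))

        kz : Point d → ℕ → ℝ
        kz z = kernel (lookup z)

        kz≡ : ∀ z i → kz z (toℕ i) ≡ κ z (lookup P i)
        kz≡ z i = trans (ΠF-cong {d} λ k → cong (λ c → exp (- ((lookup z k - c) * (lookup z k - c)))) (co≡ i k)) (sym (kernel-product z (lookup P i)))

        ḠP : ∀ z → Ḡ (toList P) z ≡ fromℕ n ⁻¹ * Σ< n (kz z)
        ḠP z = cong₂ (λ a b → fromℕ a ⁻¹ * b) (VecP.length-toList P) (sum-toList P (κ z) (kz z) (kz≡ z))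

        ḠQ : ∀ z → Ḡ (select Q P) z ≡ fromℕ m ⁻¹ * Σ< n (λ p → x n p * kz z p)
        ḠQ z = cong₂ (λ a b → fromℕ a ⁻¹ * b) (trans (length-select Q P) (proj₁ integrality)) (trans (chosen (κ z) (kz z) (kz≡ z)) (Σ-cong n λ p p<n → cong (_* kz z p) (sym (proj₂ integrality p p<n))))

        difference : ∀ z → abs (Ḡ (toList P) z - Ḡ (select Q P) z) ≡ fromℕ m ⁻¹ * abs (Σ< n (λ p → δ p * kz z p))
        difference z = trans (cong abs (cong₂ _-_ (ḠP z) (ḠQ z))) (mean-difference n (kz z) (x n) (x 0) (fromℕ m) (fromℕ n ⁻¹) 0<m x₀≡)

        error-bound : ∃[ b ] b < ε × (∀ z → abs (Ḡ (toList P) z - Ḡ (select Q P) z) ≤ b)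
        error-bound = bound reached
          where
          bound : m ≡ n ⊎ fromℕ C < fromℕ m * ε → ∃[ b ] b < ε × (∀ z → abs (Ḡ (toList P) z - Ḡ (select Q P) z) ≤ b)
          bound (inj₂ big) = fromℕ m ⁻¹ * K , small , λ z → ≤-respˡ (sym (difference z)) (*-monoˡ-≤ (<⇒≤ (⁻¹-pos 0<m)) (discrepancy (lookup z)))
            where
            small : fromℕ m ⁻¹ * K < ε
            small = <-respʳ (trans (sym (*-assoc _ _ _)) (trans (cong (_* ε) (*-inverseˡ _ (>⇒≢ 0<m))) (*-identityˡ ε))) (*-monoˡ-< (⁻¹-pos 0<m) (<-trans K<C big))
          -- If `m` is `n`, all weights start at 1 and never move, so the error is 0.
          bound (inj₁ m≡n) = 0# , 0<ε , λ z → ≡⇒≤ (trans (difference z) (trans (cong (λ w → fromℕ m ⁻¹ * abs w) (Σ-0 n λ p _ → trans (cong (_* kz z p) (unmoved p)) (zeroˡ _))) (trans (cong (fromℕ m ⁻¹ *_) (abs-≥0 ≤-refl)) (zeroʳ _))))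
            where
            x₀≡1 : ∀ p → x 0 p ≡ 1#
            x₀≡1 p = trans (x₀≡ p) (trans (cong (λ k → fromℕ k * fromℕ n ⁻¹) m≡n) (*-inverse _ (>⇒≢ 0<n)))
            unmoved : ∀ p → δ p ≡ 0#
            unmoved p = trans (cong (_- x 0 p) (frozen 0 n p (fl-1 {x 0} (x₀≡1 p)))) (-‿inverseʳ _)

        coreset : ε < 1# → IsCoreset (fromℕ C + 1#) ε P Q
        coreset ε<1 = nonempty , size-bound ε<1 , supDistance (toList P) (select Q P) (proj₁ error-bound) ε (proj₁ (proj₂ error-bound)) (proj₂ (proj₂ error-bound))

      polynomial : PolyBounded (λ n → Time.time n (mainC C) aX)
      polynomial = poly-time (mainC C) aX

      constructs : ConstructsCoresets d (fromℕ C + 1#) prog (proj₁ polynomial) (proj₁ (proj₂ polynomial))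
      constructs n 1≤n P _ ε 0<ε ε<1 = deterministic P (fromℕ C + 1#) ε prog s∞ (proj₁ (proj₂ machine)) (proj₂ (proj₂ (proj₂ machine)) (proj₂ (proj₂ polynomial) n 1≤n)) (coreset ε<1)
        where open OnInput n 1≤n P ε 0<ε

open import Data.Nat using (_≤_)

theorem5 : (𝓡 : RealNumbers) (d : ℕ) → 1 ≤ d →
    ∃[ c ] ∃[ prog ] ∃[ C ] ∃[ k ] RealRAM.ConstructsCoresets 𝓡 d c prog C k
theorem5 𝓡 d 1≤d = _ , prog , proj₁ polynomial , proj₁ (proj₂ polynomial) , constructs
  where open Development.Assembling.Assembly 𝓡 d 1≤d
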